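{- Let $(\mathcal{A},\mathcal{B})$ be a pair of structures over the same signature such that every positive equality-free sentence true on $\mathcal{A}$ is true on $\mathcal{B}$. (1) If there exists $\phi$ that breaks $\wedge$ on both $\mathcal{A}$ and $\mathcal{B}$, then $\mathrm{PMC}(\mathcal{A},\mathcal{B})$ is NP-hard. (2) If there exists $\psi$ that breaks $\vee$ on both $\mathcal{A}$ and $\mathcal{B}$, then $\mathrm{PMC}(\mathcal{A},\mathcal{B})$ is co-NP-hard. (3) If there exist $\phi$ and $\psi$ such that $\phi$ breaks $\wedge$ on both $\mathcal{A}$ and $\mathcal{B}$, and $\psi$ breaks $\vee$ on both $\mathcal{A}$ and $\mathcal{B}$, then $\mathrm{PMC}(\mathcal{A},\mathcal{B})$ is Pspace-hard.
   Context: All structures have a finite relational signature and nonempty domain. A positive equality-free formula is a first-order formula built from relational atoms of the signature (the equality symbol is not available unless it is one of the relations) using only $\forall,\exists,\wedge,\vee$. $\mathrm{PMC}(\mathcal{A},\mathcal{B})$ is the promise problem whose input is a positive equality-free sentence $\theta$ over the common signature, whose yes-instances are those with $\mathcal{A}\models\theta$ and whose no-instances are those with $\mathcal{B}\not\models\theta$ (any answer is allowed if $\mathcal{A}\not\models\theta$ and $\mathcal{B}\models\theta$). A positive equality-free sentence $\phi = Q_1v_1\ldots Q_kv_k\,(\phi_1\wedge\phi_2)$, with $Q_i\in\{\forall,\exists\}$ and $\phi_1,\phi_2$ positive equality-free formulas, breaks $\wedge$ on a structure $\mathcal{C}$ if $\mathcal{C}\not\models\phi$ but $\mathcal{C}\models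 Q_1v_1\ldots Q_kv_k\,\phi_1$ and $\mathcal{C}\models Q_1v_1\ldots Q_kv_k\,\phi_2$ (when breaking on both $\mathcal{A}$ and $\mathcal{B}$, the same $\phi,\phi_1,\phi_2$ are used for both). A positive equality-free sentence $\psi = Q'_1w_1\ldots Q'_\ell w_\ell\,(\psi_1\vee\psi_2)$ breaks $\vee$ on $\mathcal{C}$ if $\mathcal{C}\models\psi$ but $\mathcal{C}\not\models Q'_1w_1\ldots Q'_\ell w_\ell\,\psi_1$ and $\mathcal{C}\not\models Q'_1w_1\ldots Q'_\ell w_\ell\,\psi_2$ (again with the same $\psi,\psi_1,\psi_2$ for both structures). Hardness of a promise problem for a class means: for every language $L$ in the class there is a polynomial-time computable map sending members of $L$ to yes-instances and non-members of $L$ to no-instances. -}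

module Defs where

open import Data.Bool.Base using (Bool; true; false; T)
open import Data.Fin.Base using (Fin; toℕ; fromℕ)
open import Data.List.Base as List using (List; []; _∷_; _++_; length; replicate; reverse)
open import Data.List.Membership.Propositional using (_∈_)
open import Data.Nat.Base using (ℕ; zero; suc; _+_; _*_; _≤_)
open import Data.Product.Base using (_×_; _,_; ∃; ∃-syntax)
open import Data.Sum.Base using (_⊎_)
open import Data.Vec.Base as Vec using (Vec; []; _∷_)
open import Function.Base using (_∘_)
open import Function.Bundles using (_↔_; _⇔_)
open import Level using (0ℓ)
open import Relation.Binary.PropositionalEquality.Core using (_≡_)
open import Relation.Nullary.Negation.Core using (¬_)
open import Relation.Unary using (Pred; ∁)

------------------------------------------------------------------------
-- Positive equality-free logic

record Signature : Set where
  field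
    symbols : ℕ
    arity   : Fin symbols → ℕ

open Signature public

record Structure (σ : Signature) : Set₁ where
  field
    Domain : Set
    point  : Domain
    rel    : (R : Fin (symbols σ)) → Vec Domain (arity σ R) → Set

open Structure public

data Quantifier : Set where
  ∀′ ∃′ : Quantifier

infixr 6 _∧_
infixr 5 _∨_

-- Formulas with free variables in Fin n, as de Bruijn indices.

data Formula (σ : Signature) (n : ℕ) : Set where
  atom    : (R : Fin (symbols σ)) → Vec (Fin n) (arity σ R) → Formula σ n
  _∧_ _∨_ : Formula σ n → Formula σ n → Formula σ n
  quant   : Quantifier → Formula σ (suc n) → Formula σ n

Sentence : Signature → Set
Sentence σ = Formula σ 0

Sat : ∀ {σ n} (C : Structure σ) → Vec (Domain C) n → Formula σ n → Set
Sat C ρ (atom R xs)  = rel C R (Vec.map (Vec.lookup ρ) xs)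
Sat C ρ (φ ∧ ψ)      = Sat C ρ φ × Sat C ρ ψ
Sat C ρ (φ ∨ ψ)      = Sat C ρ φ ⊎ Sat C ρ ψ
Sat C ρ (quant ∀′ φ) = ∀ d → Sat C (d ∷ ρ) φ
Sat C ρ (quant ∃′ φ) = ∃[ d ] Sat C (d ∷ ρ) φ

infix 4 _⊨_ _⊭_

_⊨_ _⊭_ : ∀ {σ} → Structure σ → Sentence σ → Set
C ⊨ θ = Sat C [] θ
C ⊭ θ = ¬ (C ⊨ θ)

-- Q₁v₁ … Qₖvₖ φ.  The prefix is stored innermost quantifier first, so that
-- its i-th entry binds the variable with index i.

close : ∀ {σ k} → Vec Quantifier k → Formula σ k → Sentence σ
close []       φ = φ
close (q ∷ qs) φ = close qs (quant q φ)

Breaks∧ Breaks∨ : ∀ {σ k} → Vec Quantifier k → Formula σ k → Formula σ k →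
                  Structure σ → Set
Breaks∧ qs φ₁ φ₂ C = C ⊭ close qs (φ₁ ∧ φ₂) × C ⊨ close qs φ₁ × C ⊨ close qs φ₂
Breaks∨ qs ψ₁ ψ₂ C = C ⊨ close qs (ψ₁ ∨ ψ₂) × C ⊭ close qs ψ₁ × C ⊭ close qs ψ₂

SomeBreaks∧ SomeBreaks∨ : ∀ {σ} → Structure σ → Structure σ → Set
SomeBreaks∧ {σ} A B = ∃[ k ] ∃[ qs ] ∃[ φ₁ ] ∃[ φ₂ ]
  Breaks∧ {σ} {k} qs φ₁ φ₂ A × Breaks∧ qs φ₁ φ₂ B
SomeBreaks∨ {σ} A B = ∃[ k ] ∃[ qs ] ∃[ ψ₁ ] ∃[ ψ₂ ]
  Breaks∨ {σ} {k} qs ψ₁ ψ₂ A × Breaks∨ qs ψ₁ ψ₂ B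

-- Formulas as bit strings: a prefix code in Polish notation, with relation
-- symbols and variables in unary.  As the indices of bound variables are
-- smaller than the quantifier depth, unary costs at most a polynomial.

unary : ℕ → List Bool
unary n = replicate n true ++ false ∷ []

encode : ∀ {σ n} → Formula σ n → List Bool
encode (atom R xs)  = false ∷ unary (toℕ R) ++ List.concatMap (unary ∘ toℕ) (Vec.toList xs)
encode (φ ∧ ψ)      = true ∷ false ∷ false ∷ encode φ ++ encode ψ
encode (φ ∨ ψ)      = true ∷ false ∷ true  ∷ encode φ ++ encode ψ
encode (quant ∀′ φ) = true ∷ true  ∷ false ∷ encode φ
encode (quant ∃′ φ) = true ∷ true  ∷ true  ∷ encode φ

------------------------------------------------------------------------
-- Turing machines

data Symbol (Aux : Set) : Set where
  blank : Symbol Aux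
  bit   : Bool → Symbol Aux
  aux   : Aux → Symbol Aux

data Move : Set where
  left stay right : Move

-- A two-way infinite tape.  The lists hold the cells on either side of the
-- head, nearest first; all cells beyond them are blank.  Moves never shorten
-- the stored part, so it covers exactly the initial input and the cells
-- visited so far.

record Tape (Γ : Set) : Set where
  constructor ⟨_,_,_⟩
  field
    before  : List Γ
    current : Γ
    after   : List Γ

open Tape public

module _ {Aux : Set} where

  load : List (Symbol Aux) → Tape (Symbol Aux)
  load []       = ⟨ [] , blank , [] ⟩
  load (s ∷ ss) = ⟨ [] , s , ss ⟩

  move : Move → Tape (Symbol Aux) → Tape (Symbol Aux)
  move left  ⟨ []     , s , rs ⟩     = ⟨ [] , blank , s ∷ rs ⟩
  move left  ⟨ l ∷ ls , s , rs ⟩     = ⟨ ls , l , s ∷ rs ⟩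
  move stay  t                       = t
  move right ⟨ ls     , s , [] ⟩     = ⟨ s ∷ ls , blank , [] ⟩
  move right ⟨ ls     , s , r ∷ rs ⟩ = ⟨ s ∷ ls , r , rs ⟩

  act : Symbol Aux × Move → Tape (Symbol Aux) → Tape (Symbol Aux)
  act (s , m) t = move m (record t { current = s })

  contents : Tape (Symbol Aux) → List (Symbol Aux)
  contents ⟨ ls , s , rs ⟩ = reverse ls ++ s ∷ rs

  Inscribed : Tape (Symbol Aux) → List Bool → Set
  Inscribed t w = ∃[ m ] ∃[ n ]
    contents t ≡ replicate m blank ++ List.map bit w ++ replicate n blank

-- A machine with 1 + extra tapes.  It is nondeterministic, the next action
-- being any entry of the list given by δ; it halts when that list is empty.

record Machine : Set₁ where
  field
    State        : Set
    Aux          : Set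
    state-finite : ∃[ n ] (State ↔ Fin n)
    aux-finite   : ∃[ n ] (Aux ↔ Fin n)
    extra        : ℕ
    start        : State
    accepting    : State → Bool
    δ            : State → Vec (Symbol Aux) (suc extra) →
                   List (State × Vec (Symbol Aux × Move) (suc extra))

module _ (M : Machine) where
  open Machine M

  record Config : Set where
    constructor config
    field
      state : State
      tapes : Vec (Tape (Symbol Aux)) (suc extra)

  open Config public

  initial : List Bool → Config
  initial x = config start (load (List.map bit x) ∷ Vec.replicate extra (load []))

  successors : Config → List Config
  successors (config q ts) =
    List.map (λ (q′ , as) → config q′ (Vec.zipWith act as ts))
             (δ q (Vec.map current ts))

  data Run : ℕ → Config → Config → Set where
    done : ∀ {c} → Run 0 c c
    step : ∀ {n c d e} → d ∈ successors c → Run n d e → Run (suc n) c e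

  Halted : Config → Set
  Halted c = successors c ≡ []

  Deterministic : Set
  Deterministic = ∀ q ss → length (δ q ss) ≤ 1

  HaltsAlways : Set
  HaltsAlways = ∀ x → ∃[ n ] ∃[ c ] Run n (initial x) c × Halted c

  Accepts : List Bool → Set
  Accepts x = ∃[ n ] ∃[ c ] Run n (initial x) c × Halted c × T (accepting (state c))

  -- The output is written on the last tape.

  Outputs : List Bool → List Bool → Set
  Outputs x y = ∃[ n ] ∃[ c ]
    Run n (initial x) c × Halted c × Inscribed (Vec.lookup (tapes c) (fromℕ extra)) y

  space : Config → ℕ
  space c = Vec.sum (Vec.map (length ∘ contents) (tapes c))

  RunsInTime RunsInSpace : (ℕ → ℕ) → Set
  RunsInTime  t = ∀ x {n c} → Run n (initial x) c → n ≤ t (length x)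
  RunsInSpace s = ∀ x {n c} → Run n (initial x) c → space c ≤ s (length x)

------------------------------------------------------------------------
-- Complexity classes and hardness

Polynomial : Set
Polynomial = List ℕ

⟦_⟧ : Polynomial → ℕ → ℕ
⟦ [] ⟧     n = 0
⟦ a ∷ as ⟧ n = a + n * ⟦ as ⟧ n

PolyTime : (List Bool → List Bool) → Set₁
PolyTime f = ∃[ M ] ∃[ p ]
  Deterministic M × RunsInTime M ⟦ p ⟧ × (∀ x → Outputs M x (f x))

Language : Set₁
Language = Pred (List Bool) 0ℓ

NP coNP PSPACE : Language → Set₁
NP L     = ∃[ M ] ∃[ p ] RunsInTime M ⟦ p ⟧ × (∀ x → L x ⇔ Accepts M x)
coNP L   = NP (∁ L)
PSPACE L = ∃[ M ] ∃[ p ]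
  Deterministic M × HaltsAlways M × RunsInSpace M ⟦ p ⟧ × (∀ x → L x ⇔ Accepts M x)

record PromiseProblem : Set₁ where
  field
    Instance : Set
    code     : Instance → List Bool
    Yes No   : Instance → Set

PMC : ∀ {σ} → Structure σ → Structure σ → PromiseProblem
PMC {σ} A B = record
  { Instance = Sentence σ
  ; code     = encode
  ; Yes      = A ⊨_
  ; No       = B ⊭_
  }

_-hard : (Language → Set₁) → PromiseProblem → Set₁
(𝒞 -hard) P = ∀ L → 𝒞 L → ∃[ f ]
  PolyTime (code ∘ f) × (∀ x → L x → Yes (f x)) × (∀ x → ¬ L x → No (f x))
  where open PromiseProblem P

{-# OPTIONS --safe #-}
module Submission where

-- If Q (φ₁ ∧ φ₂) fails while Q φ₁ and Q φ₂ hold, then in the game of the quantifier block Q the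
-- existential player can reach φ₁ and can reach φ₂, but the universal player can prevent both
-- from holding.  Reading φ₁ and φ₂ as the two literals of a Boolean variable, the block thus acts
-- as a Boolean ∃ in front of any formula positive in these literals.  Dually, a block that breaks ∨
-- acts as a Boolean ∀.  So it suffices to reduce NP to ∃-formulas, coNP to the dual formulas, and
-- PSPACE to quantified Boolean formulas, in time polynomial.
--
-- A configuration is written as a row whose r-th column holds the cells at distance r + 1 from
-- the heads.  Relative to the heads, a step of a machine with several tapes is local: it is
-- described by constraints on adjacent columns of two rows.  An NP computation is a sequence of
-- existentially quantified rows; a PSPACE computation of length 2^t is verified by halving it t
-- times, as in Savitch's theorem.  Each round is put directly behind its own quantifiers, so its
-- de Bruijn indices do not depend on the round and are affine in a few list lengths.  Hence the
-- formula is printed by nested loops over lists, which a multitape machine runs in polynomial time.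

-- A play of a gadget may leave both literals of a variable true, or both false, so they need not be
-- complementary. As the translated formulas are positive, one-sided control suffices: truth passes
-- to a structure if the literals true under the assignment hold, and it passes back if the literals
-- false under it fail. Each half of the definition of breaking supplies one of these.
--
-- Excluded middle does two jobs. It compares the strategies for two winning conditions of a block
-- without building counter-strategies, and it decides the finitely many local constraints of a
-- tiling when the reduction is set up, so that the printing machine carries the answers as fixed
-- text.
--
-- Time bounds on bare Turing machines would be unwieldy. A generator only loops over lists that it
-- leaves unchanged, so a polynomial bound can be read off its syntax; stack programs are the bridge
-- from generators to machines.

open import Defs
open import Axiom.ExcludedMiddle using (ExcludedMiddle)
open import Data.Bool.Base using (Bool; true; false; not; if_then_else_; T)
open import Data.Empty using (⊥; ⊥-elim)
open import Data.Fin.Base using (Fin; zero; suc; toℕ; fromℕ; combine; _↑ˡ_; _↑ʳ_)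
open import Data.Fin.Patterns using (0F; 1F; 2F; 3F)
import Data.Fin.Properties as Fin
open import Data.Fin.Properties using (+↔⊎; 1↔⊤; 2↔Bool)
open import Data.List.Base as List
  using (List; []; _∷_; _++_; _ʳ++_; length; replicate; reverse; concatMap)
open import Data.List.Membership.Propositional using (_∈_)
open import Data.List.Membership.Propositional.Properties using (∈-map⁻; ∈-map⁺)
import Data.List.Properties as List
open import Data.List.Relation.Unary.Any using (here)
open import Data.Maybe.Base as Maybe using (Maybe; just; nothing; maybe)
open import Data.Nat.Base
open import Data.Nat.ListAction using (sum)
open import Data.Nat.Properties
open import Data.Nat.Tactic.RingSolver using (solve-∀)
open import Data.Product.Base as Product using (_×_; _,_; ∃; ∃-syntax; proj₁; proj₂; map₁)
open import Data.Sum.Base as Sum using (_⊎_; inj₁; inj₂)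
open import Data.Sum.Function.Propositional using (_⊎-↔_)
open import Data.Unit.Base using (⊤; tt)
open import Data.Vec.Base as Vec
  using (Vec; []; _∷_; lookup; concat; tabulate; toList; _[_]≔_; zipWith)
  renaming (_++_ to _++ᵛ_)
import Data.Vec.Properties as Vec
open import Data.Vec.Properties
  using (lookup∘update; lookup∘update′; []≔-lookup; lookup-map; lookup-replicate)
open import Function.Base using (_∘_; id)
open import Function.Bundles using (_↔_; _⇔_; Inverse; Equivalence; mk↔ₛ′; mk⇔)
open import Function.Properties.Equivalence using () renaming (trans to ⇔-trans)
open import Function.Properties.Inverse using (↔-sym; ↔-trans; ↔-refl)
open import Level using (0ℓ)
open import Relation.Binary.PropositionalEquality hiding (inspect)
open import Relation.Nullary using (¬_; Dec; yes; no; does)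

open Equivalence using (to; from)

-- Polynomial bounds

infixl 6 _⊕_
infixl 7 _⊗_

_⊕_ : Polynomial → Polynomial → Polynomial
[]       ⊕ q        = q
(a ∷ as) ⊕ []       = a ∷ as
(a ∷ as) ⊕ (b ∷ bs) = a + b ∷ as ⊕ bs

⟦⊕⟧ : ∀ p q n → ⟦ p ⊕ q ⟧ n ≡ ⟦ p ⟧ n + ⟦ q ⟧ n
⟦⊕⟧ []       q        n = refl
⟦⊕⟧ (a ∷ as) []       n = sym (+-identityʳ _)
⟦⊕⟧ (a ∷ as) (b ∷ bs) n = begin
  a + b + n * ⟦ as ⊕ bs ⟧ n             ≡⟨ cong (λ k → a + b + n * k) (⟦⊕⟧ as bs n) ⟩
  a + b + n * (⟦ as ⟧ n + ⟦ bs ⟧ n)     ≡⟨ shuffle a b n (⟦ as ⟧ n) (⟦ bs ⟧ n) ⟩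
  a + n * ⟦ as ⟧ n + (b + n * ⟦ bs ⟧ n) ∎
  where
  open ≡-Reasoning
  shuffle : ∀ a b n k l → a + b + n * (k + l) ≡ a + n * k + (b + n * l)
  shuffle = solve-∀

⟦scale⟧ : ∀ a q n → ⟦ List.map (a *_) q ⟧ n ≡ a * ⟦ q ⟧ n
⟦scale⟧ a []       n = sym (*-zeroʳ a)
⟦scale⟧ a (b ∷ bs) n = begin
  a * b + n * ⟦ List.map (a *_) bs ⟧ n ≡⟨ cong (λ k → a * b + n * k) (⟦scale⟧ a bs n) ⟩
  a * b + n * (a * ⟦ bs ⟧ n)           ≡⟨ shuffle a b n (⟦ bs ⟧ n) ⟩
  a * (b + n * ⟦ bs ⟧ n)               ∎
  where
  open ≡-Reasoning
  shuffle : ∀ a b n k → a * b + n * (a * k) ≡ a * (b + n * k)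
  shuffle = solve-∀

_⊗_ : Polynomial → Polynomial → Polynomial
[]       ⊗ q = []
(a ∷ as) ⊗ q = List.map (a *_) q ⊕ (0 ∷ as ⊗ q)

⟦⊗⟧ : ∀ p q n → ⟦ p ⊗ q ⟧ n ≡ ⟦ p ⟧ n * ⟦ q ⟧ n
⟦⊗⟧ []       q n = refl
⟦⊗⟧ (a ∷ as) q n = begin
  ⟦ List.map (a *_) q ⊕ (0 ∷ as ⊗ q) ⟧ n       ≡⟨ ⟦⊕⟧ (List.map (a *_) q) (0 ∷ as ⊗ q) n ⟩
  ⟦ List.map (a *_) q ⟧ n + n * ⟦ as ⊗ q ⟧ n   ≡⟨ cong₂ (λ k l → k + n * l) (⟦scale⟧ a q n) (⟦⊗⟧ as q n) ⟩
  a * ⟦ q ⟧ n + n * (⟦ as ⟧ n * ⟦ q ⟧ n)       ≡⟨ shuffle a n (⟦ as ⟧ n) (⟦ q ⟧ n) ⟩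
  (a + n * ⟦ as ⟧ n) * ⟦ q ⟧ n                 ∎
  where
  open ≡-Reasoning
  shuffle : ∀ a n k l → a * l + n * (k * l) ≡ (a + n * k) * l
  shuffle = solve-∀

_⊚_ : Polynomial → Polynomial → Polynomial
[]       ⊚ q = []
(a ∷ as) ⊚ q = (a ∷ []) ⊕ q ⊗ (as ⊚ q)

⟦⊚⟧ : ∀ p q n → ⟦ p ⊚ q ⟧ n ≡ ⟦ p ⟧ (⟦ q ⟧ n)
⟦⊚⟧ []       q n = refl
⟦⊚⟧ (a ∷ as) q n = begin
  ⟦ (a ∷ []) ⊕ q ⊗ (as ⊚ q) ⟧ n           ≡⟨ ⟦⊕⟧ (a ∷ []) (q ⊗ (as ⊚ q)) n ⟩
  a + n * 0 + ⟦ q ⊗ (as ⊚ q) ⟧ n          ≡⟨ cong₂ _+_ (trans (cong (a +_) (*-zeroʳ n)) (+-identityʳ a)) (⟦⊗⟧ q (as ⊚ q) n) ⟩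
  a + ⟦ q ⟧ n * ⟦ as ⊚ q ⟧ n              ≡⟨ cong (λ k → a + ⟦ q ⟧ n * k) (⟦⊚⟧ as q n) ⟩
  a + ⟦ q ⟧ n * ⟦ as ⟧ (⟦ q ⟧ n)          ∎
  where open ≡-Reasoning

⟦⟧-mono : ∀ p {m n} → m ≤ n → ⟦ p ⟧ m ≤ ⟦ p ⟧ n
⟦⟧-mono []       m≤n = z≤n
⟦⟧-mono (a ∷ as) m≤n = +-monoʳ-≤ a (*-mono-≤ m≤n (⟦⟧-mono as m≤n))

PolyBounded : (ℕ → ℕ) → Set
PolyBounded f = ∃[ p ] ∀ n → f n ≤ ⟦ p ⟧ n

poly-const : ∀ c → PolyBounded λ _ → c
poly-const c = c ∷ [] , λ n → m≤m+n c _

poly-id : PolyBounded λ n → n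
poly-id = 0 ∷ 1 ∷ [] , λ n → ≤-reflexive (sym (trans (cong (n *_) (cong suc (*-zeroʳ n))) (*-identityʳ n)))

poly-+ : ∀ {f g} → PolyBounded f → PolyBounded g → PolyBounded λ n → f n + g n
poly-+ (p , f≤p) (q , g≤q) =
  p ⊕ q , λ n → ≤-trans (+-mono-≤ (f≤p n) (g≤q n)) (≤-reflexive (sym (⟦⊕⟧ p q n)))

poly-* : ∀ {f g} → PolyBounded f → PolyBounded g → PolyBounded λ n → f n * g n
poly-* (p , f≤p) (q , g≤q) =
  p ⊗ q , λ n → ≤-trans (*-mono-≤ (f≤p n) (g≤q n)) (≤-reflexive (sym (⟦⊗⟧ p q n)))

poly-∘ : ∀ {f g} → PolyBounded f → PolyBounded g → PolyBounded λ n → f (g n)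
poly-∘ {g = g} (p , f≤p) (q , g≤q) = p ⊚ q , λ n →
  ≤-trans (f≤p (g n)) (≤-trans (⟦⟧-mono p (g≤q n)) (≤-reflexive (sym (⟦⊚⟧ p q n))))

-- Finite types

Finite : Set → Set
Finite X = ∃[ n ] (X ↔ Fin n)

finite-⊎ : ∀ {X Y} → Finite X → Finite Y → Finite (X ⊎ Y)
finite-⊎ (m , f) (n , g) = m + n , ↔-trans (f ⊎-↔ g) (↔-sym +↔⊎)

finite-⊤ : Finite ⊤
finite-⊤ = 1 , ↔-sym 1↔⊤

finite-Bool : Finite Bool
finite-Bool = 2 , ↔-sym 2↔Bool

finite-Maybe : ∀ {X} → Finite X → Finite (Maybe X)
finite-Maybe {X} (n , f) = suc n , mk↔ₛ′ to′ from′ to∘from from∘to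
  where
  open Inverse f using (strictlyInverseˡ; strictlyInverseʳ) renaming (to to index; from to element)
  to′ : Maybe X → Fin (suc n)
  to′ nothing  = zero
  to′ (just x) = suc (index x)
  from′ : Fin (suc n) → Maybe X
  from′ zero    = nothing
  from′ (suc i) = just (element i)
  to∘from : ∀ i → to′ (from′ i) ≡ i
  to∘from zero    = refl
  to∘from (suc i) = cong suc (strictlyInverseˡ i)
  from∘to : ∀ x → from′ (to′ x) ≡ x
  from∘to nothing  = refl
  from∘to (just x) = cong just (strictlyInverseʳ x)

-- Stack programs and their compilation to Turing machines

infixr 4 _⨾_

data Prog (T : ℕ) : Set where
  skip  : Prog T
  push  : Fin T → Bool → Prog T
  _⨾_   : Prog T → Prog T → Prog T
  drain : Fin T → (Bool → Prog T) → Prog T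

Stacks : ℕ → Set
Stacks T = Vec (List Bool) T

infix 3 _,_⇓[_]_

-- The index is the exact number of steps of the compiled machine. Each test of `drain` costs two,
-- one to step left onto the top of the stack and one to examine it; sequencing is free, since the
-- last action of `P` already enters `Q`.
data _,_⇓[_]_ {T} : Prog T → Stacks T → ℕ → Stacks T → Set where
  ⇓skip : ∀ {σ} → skip , σ ⇓[ 1 ] σ
  ⇓push : ∀ {j b σ} → push j b , σ ⇓[ 1 ] (σ [ j ]≔ (b ∷ lookup σ j))
  ⇓⨾    : ∀ {P Q σ σ′ σ″ m n} → P , σ ⇓[ m ] σ′ → Q , σ′ ⇓[ n ] σ″ → P ⨾ Q , σ ⇓[ m + n ] σ″
  ⇓stop : ∀ {j P σ} → lookup σ j ≡ [] → drain j P , σ ⇓[ 2 ] σ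
  ⇓pop  : ∀ {j P σ σ′ σ″ b bs m n} → lookup σ j ≡ b ∷ bs →
          P b , σ [ j ]≔ bs ⇓[ m ] σ′ → drain j P , σ′ ⇓[ n ] σ″ →
          drain j P , σ ⇓[ 2 + (m + n) ] σ″

Sym : Set
Sym = Symbol (Fin 0)

-- inj₁ false steps left onto the top of the stack, inj₁ true examines it.

Node : ∀ {T} → Prog T → Set
Node skip        = ⊤
Node (push _ _)  = ⊤
Node (P ⨾ Q)     = Node P ⊎ Node Q
Node (drain _ P) = Bool ⊎ (Node (P true) ⊎ Node (P false))

node-finite : ∀ {T} (P : Prog T) → Finite (Node P)
node-finite skip        = finite-⊤
node-finite (push _ _)  = finite-⊤
node-finite (P ⨾ Q)     = finite-⊎ (node-finite P) (node-finite Q)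
node-finite (drain _ P) = finite-⊎ finite-Bool (finite-⊎ (node-finite (P true)) (node-finite (P false)))

entry : ∀ {T} (P : Prog T) → Node P
entry skip        = tt
entry (push _ _)  = tt
entry (P ⨾ Q)     = inj₁ (entry P)
entry (drain _ _) = inj₁ false

body : ∀ {T j P} b → Node (P b) → Node {T} (drain j P)
body true  p = inj₂ (inj₁ p)
body false p = inj₂ (inj₂ p)

Actions : ℕ → Set
Actions T = Vec (Sym × Move) T

keep : ∀ {A : Set} {T} → Vec (Symbol A) T → Vec (Symbol A × Move) T
keep = Vec.map (_, stay)

examine : ∀ {T} (j : Fin T) (P : Bool → Prog T) → Sym → Vec Sym T → Maybe (Node (drain j P)) × Actions T
examine j P (bit b) ss = just (body {j = j} {P} b (entry (P b))) , keep ss [ j ]≔ (blank , stay)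
examine j P _       ss = nothing , keep ss

resume-⨾ˡ : ∀ {T} {P} (Q : Prog T) → Maybe (Node P) → Maybe (Node (P ⨾ Q))
resume-⨾ˡ Q = just ∘ maybe inj₁ (inj₂ (entry Q))

resume-⨾ʳ : ∀ {T} (P : Prog T) {Q} → Maybe (Node Q) → Maybe (Node (P ⨾ Q))
resume-⨾ʳ P = Maybe.map inj₂

resume-drain : ∀ {T} (j : Fin T) P b → Maybe (Node (P b)) → Maybe (Node (drain j P))
resume-drain j P b = just ∘ maybe (body {j = j} {P} b) (inj₁ false)

next : ∀ {T} (P : Prog T) → Node P → Vec Sym T → Maybe (Node P) × Actions T
next skip        _        ss = nothing , keep ss
next (push j b)  _        ss = nothing , keep ss [ j ]≔ (bit b , right)
next (P ⨾ Q)     (inj₁ p) ss = map₁ (resume-⨾ˡ Q) (next P p ss)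
next (P ⨾ Q)     (inj₂ q) ss = map₁ (resume-⨾ʳ P) (next Q q ss)
next (drain j P) (inj₁ false)    ss = just (inj₁ true) , keep ss [ j ]≔ (blank , left)
next (drain j P) (inj₁ true)     ss = examine j P (lookup ss j) ss
next (drain j P) (inj₂ (inj₁ p)) ss = map₁ (resume-drain j P true) (next (P true) p ss)
next (drain j P) (inj₂ (inj₂ p)) ss = map₁ (resume-drain j P false) (next (P false) p ss)

Tapes : ℕ → Set
Tapes T = Vec (Tape Sym) T

data Exec {T} (P : Prog T) : Node P → Tapes T → ℕ → Tapes T → Set where
  exit : ∀ {p ts as} → next P p (Vec.map current ts) ≡ (nothing , as) →
         Exec P p ts 1 (zipWith act as ts)
  more : ∀ {p p′ ts ts′ as n} → next P p (Vec.map current ts) ≡ (just p′ , as) →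
         Exec P p′ (zipWith act as ts) n ts′ → Exec P p ts (suc n) ts′

exec-inj₂ : ∀ {T} {P Q : Prog T} {q ts n ts′} →
            Exec Q q ts n ts′ → Exec (P ⨾ Q) (inj₂ q) ts n ts′
exec-inj₂ {P = P} (exit eq)   = exit (cong (map₁ (resume-⨾ʳ P)) eq)
exec-inj₂ {P = P} (more eq e) = more (cong (map₁ (resume-⨾ʳ P)) eq) (exec-inj₂ e)

exec-⨾ : ∀ {T} {P Q : Prog T} {p ts m ts′ n ts″} → Exec P p ts m ts′ →
         Exec Q (entry Q) ts′ n ts″ → Exec (P ⨾ Q) (inj₁ p) ts (m + n) ts″
exec-⨾ {Q = Q} (exit eq)   e′ = more (cong (map₁ (resume-⨾ˡ Q)) eq) (exec-inj₂ e′)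
exec-⨾ {Q = Q} (more eq e) e′ = more (cong (map₁ (resume-⨾ˡ Q)) eq) (exec-⨾ e e′)

exec-body : ∀ {T j} {P : Bool → Prog T} b {p ts m ts′ n ts″} → Exec (P b) p ts m ts′ →
            Exec (drain j P) (inj₁ false) ts′ n ts″ →
            Exec (drain j P) (body {j = j} {P} b p) ts (m + n) ts″
exec-body {j = j} {P} true  (exit eq)   e′ = more (cong (map₁ (resume-drain j P true)) eq) e′
exec-body {j = j} {P} false (exit eq)   e′ = more (cong (map₁ (resume-drain j P false)) eq) e′
exec-body {j = j} {P} true  (more eq e) e′ = more (cong (map₁ (resume-drain j P true)) eq) (exec-body true e e′)
exec-body {j = j} {P} false (more eq e) e′ = more (cong (map₁ (resume-drain j P false)) eq) (exec-body false e e′)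

module _ {A : Set} where

  act-keep : ∀ {T} (ts : Vec (Tape (Symbol A)) T) → zipWith act (keep (Vec.map current ts)) ts ≡ ts
  act-keep []       = refl
  act-keep (t ∷ ts) = cong (t ∷_) (act-keep ts)

  act-keep-at : ∀ {T} (ts : Vec (Tape (Symbol A)) T) j {a} →
                zipWith act (keep (Vec.map current ts) [ j ]≔ a) ts ≡ ts [ j ]≔ act a (lookup ts j)
  act-keep-at (t ∷ ts) zero    = cong (_ ∷_) (act-keep ts)
  act-keep-at (t ∷ ts) (suc j) = cong (t ∷_) (act-keep-at ts j)

-- The head rests on the blank next to the top of the stack. Popped cells remain stored as blanks,
-- and testing an empty stack moves its bottom one cell to the left; both only increase `m`.
Holds : Tape Sym → List Bool → Set
Holds t xs = ∃[ m ] t ≡ ⟨ List.map bit xs , blank , replicate m blank ⟩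

infix 4 _holds_

record _holds_ {T} (ts : Tapes T) (σ : Stacks T) : Set where
  constructor holding
  field held : ∀ j → Holds (lookup ts j) (lookup σ j)

open _holds_

holds-update : ∀ {T} {ts : Tapes T} {σ} j {t xs} → (∀ i → i ≢ j → Holds (lookup ts i) (lookup σ i)) →
               Holds t xs → (ts [ j ]≔ t) holds (σ [ j ]≔ xs)
held (holds-update {ts = ts} {σ} j {t} {xs} h h′) i with i Fin.≟ j
... | yes refl = subst₂ Holds (sym (lookup∘update j ts t)) (sym (lookup∘update j σ xs)) h′
... | no  i≢j  = subst₂ Holds (sym (lookup∘update′ i≢j ts t)) (sym (lookup∘update′ i≢j σ xs)) (h i i≢j)

act-push : ∀ {t xs} b → Holds t xs → Holds (act (bit b , right) t) (b ∷ xs)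
act-push b (zero  , refl) = 0 , refl
act-push b (suc m , refl) = m , refl

act-left-[] : ∀ {t} → Holds t [] → Holds (act (blank , left) t) []
act-left-[] (m , refl) = suc m , refl

act-left-∷ : ∀ {t b xs} → Holds t (b ∷ xs) →
             current (act (blank , left) t) ≡ bit b × Holds (act (blank , stay) (act (blank , left) t)) xs
act-left-∷ (m , refl) = refl , suc m , refl

exec-examine : ∀ {T} (j : Fin T) P {s ss r} → lookup ss j ≡ s → examine j P s ss ≡ r →
               next (drain j P) (inj₁ true) ss ≡ r
exec-examine j P refl eq = eq

simulate : ∀ {T} {P : Prog T} {σ n σ′ ts} → P , σ ⇓[ n ] σ′ → ts holds σ →
           ∃[ ts′ ] ts′ holds σ′ × Exec P (entry P) ts n ts′
simulate {ts = ts} ⇓skip h = _ , subst (_holds _) (sym (act-keep ts)) h , exit refl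
simulate {ts = ts} (⇓push {j} {b} {σ}) h =
  _ , subst (_holds _) (sym (act-keep-at ts j)) (holds-update {ts = ts} {σ} j (λ i _ → held h i) (act-push b (held h j))) , exit refl
simulate (⇓⨾ d d′) h =
  let _ , h′ , e = simulate d h
      _ , h″ , e′ = simulate d′ h′
  in _ , h″ , exec-⨾ e e′
simulate {T} {ts = ts} (⇓stop {j} {P} {σ} eq) h = _ , final , more refl (exit (exec-examine j P at-blank refl))
  where
  ts₁ : Tapes T
  ts₁ = zipWith act (keep (Vec.map current ts) [ j ]≔ (blank , left)) ts
  ts₁≡ : ts₁ ≡ ts [ j ]≔ act (blank , left) (lookup ts j)
  ts₁≡ = act-keep-at ts j
  empty : Holds (act (blank , left) (lookup ts j)) []
  empty = act-left-[] (subst (Holds _) eq (held h j))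
  at-blank : lookup (Vec.map current ts₁) j ≡ blank
  at-blank = trans (lookup-map j current ts₁)
    (trans (cong (λ us → current (lookup us j)) ts₁≡)
    (trans (cong current (lookup∘update j ts _)) (cong current (proj₂ empty))))
  final : zipWith act (keep (Vec.map current ts₁)) ts₁ holds σ
  final = subst₂ _holds_ (sym (trans (act-keep ts₁) ts₁≡)) (trans (cong (σ [ j ]≔_) (sym eq)) ([]≔-lookup σ j))
          (holds-update {ts = ts} {σ} j (λ i _ → held h i) empty)
simulate {T} {ts = ts} (⇓pop {j} {P} {σ} {b = b} {bs} {m = m} {n = n} eq d d′) h =
  let _ , h′ , e = simulate d popped
      _ , h″ , e′ = simulate d′ h′
  in _ , h″ , more refl (more (exec-examine j P at-bit refl) (exec-body {j = j} {P} b e e′))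
  where
  ts₁ ts₂ : Tapes T
  ts₁ = zipWith act (keep (Vec.map current ts) [ j ]≔ (blank , left)) ts
  ts₂ = zipWith act (keep (Vec.map current ts₁) [ j ]≔ (blank , stay)) ts₁
  ts₁≡ : ts₁ ≡ ts [ j ]≔ act (blank , left) (lookup ts j)
  ts₁≡ = act-keep-at ts j
  top : current (act (blank , left) (lookup ts j)) ≡ bit b ×
        Holds (act (blank , stay) (act (blank , left) (lookup ts j))) bs
  top = act-left-∷ (subst (Holds _) eq (held h j))
  ts₁[j]≡ : lookup ts₁ j ≡ act (blank , left) (lookup ts j)
  ts₁[j]≡ = trans (cong (λ us → lookup us j) ts₁≡) (lookup∘update j ts _)
  at-bit : lookup (Vec.map current ts₁) j ≡ bit b
  at-bit = trans (lookup-map j current ts₁) (trans (cong current ts₁[j]≡) (proj₁ top))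
  popped : ts₂ holds (σ [ j ]≔ bs)
  popped = subst (_holds _) (sym (act-keep-at ts₁ j)) (holds-update {ts = ts₁} {σ} j
    (λ i i≢j → subst (λ t → Holds t _) (sym (trans (cong (λ us → lookup us i) ts₁≡) (lookup∘update′ i≢j ts _))) (held h i))
    (subst (λ t → Holds (act (blank , stay) t) bs) (sym ts₁[j]≡) (proj₂ top)))

-- Runs of deterministic machines

module _ (M : Machine) where

  private
    ∈-unique : ∀ {A : Set} {x y : A} xs → length xs ≤ 1 → x ∈ xs → y ∈ xs → x ≡ y
    ∈-unique (_ ∷ [])    _        (here refl) (here refl) = refl
    ∈-unique (_ ∷ _ ∷ _) (s≤s ())

  successor-unique : Deterministic M → ∀ {c d e} → d ∈ successors M c → e ∈ successors M c → d ≡ e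
  successor-unique det {config q ts} =
    ∈-unique _ (subst (_≤ 1) (sym (List.length-map _ (Machine.δ M q (Vec.map current ts)))) (det q (Vec.map current ts)))

  -- As successors are unique, every run is a prefix of the halting one. A single halting run thus
  -- bounds all runs, as `RunsInTime` demands.
  halted-run-longest : Deterministic M → ∀ {m n c d e} → Run M n c e → Halted M e → Run M m c d → m ≤ n
  halted-run-longest det done       h done        = z≤n
  halted-run-longest det done       h (step d∈ _) with () ← subst (_ ∈_) h d∈
  halted-run-longest det (step _ _) h done        = z≤n
  halted-run-longest det (step d∈ r) h (step d∈′ r′) with refl ← successor-unique det d∈ d∈′ =
    s≤s (halted-run-longest det r h r′)

  Run-++ : ∀ {m n c d e} → Run M m c d → Run M n d e → Run M (m + n) c e
  Run-++ done        r = r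
  Run-++ (step d∈ r′) r = step d∈ (Run-++ r′ r)

-- The machine of a stack program

module _ {extra} (P : Prog (suc extra)) where

  -- nothing: scanning the input; just nothing: finished.

  scan : Sym → Vec Sym (suc extra) → Maybe (Maybe (Node P)) × Actions (suc extra)
  scan blank ss = just (just (entry P)) , keep ss
  scan s     ss = nothing , keep ss [ zero ]≔ (s , right)

  control : Maybe (Maybe (Node P)) → Vec Sym (suc extra) → List (Maybe (Maybe (Node P)) × Actions (suc extra))
  control nothing         ss = scan (lookup ss zero) ss ∷ []
  control (just nothing)  ss = []
  control (just (just p)) ss = map₁ just (next P p ss) ∷ []

  machine : Machine
  machine = record
    { State        = Maybe (Maybe (Node P))
    ; Aux          = Fin 0
    ; state-finite = finite-Maybe (finite-Maybe (node-finite P))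
    ; aux-finite   = 0 , ↔-refl
    ; extra        = extra
    ; start        = nothing
    ; accepting    = λ _ → true
    ; δ            = control
    }

  machine-deterministic : Deterministic machine
  machine-deterministic nothing         ss = ≤-refl
  machine-deterministic (just nothing)  ss = z≤n
  machine-deterministic (just (just p)) ss = ≤-refl

  exec-run : ∀ {p ts n ts′} → Exec P p ts n ts′ →
             Run machine n (config (just (just p)) ts) (config (just nothing) ts′)
  exec-run {ts = ts} (exit eq)   = step (here (cong (λ (q , as) → config (just q) (zipWith act as ts)) (sym eq))) done
  exec-run {ts = ts} (more eq e) = step (here (cong (λ (q , as) → config (just q) (zipWith act as ts)) (sym eq))) (exec-run e)

  scan-step-bit : ∀ b l rs ts → config nothing (act (bit b , right) ⟨ l , bit b , rs ⟩ ∷ ts)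
                  ∈ successors machine (config nothing (⟨ l , bit b , rs ⟩ ∷ ts))
  scan-step-bit b l rs ts = here (cong (λ us → config nothing (act (bit b , right) ⟨ l , bit b , rs ⟩ ∷ us)) (sym (act-keep ts)))

  -- Walking over the input leaves it to the left of the head with the last letter nearest, which is
  -- exactly a stack holding `reverse x`.
  scan-run : ∀ x ys ts → Run machine (length x)
    (config nothing (record (load (List.map bit x)) { before = List.map bit ys } ∷ ts))
    (config nothing (⟨ List.map bit (x ʳ++ ys) , blank , [] ⟩ ∷ ts))
  scan-run []           ys ts = done
  scan-run (b ∷ [])     ys ts = step (scan-step-bit b (List.map bit ys) [] ts) done
  scan-run (b ∷ b′ ∷ x) ys ts = step (scan-step-bit b (List.map bit ys) (List.map bit (b′ ∷ x)) ts) (scan-run (b′ ∷ x) (b ∷ ys) ts)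

  module _ {x : List Bool} {n σ} (d : P , reverse x ∷ Vec.replicate extra [] ⇓[ n ] σ) where

    private
      blanks : Tapes extra
      blanks = Vec.replicate extra (load [])

      scanned : Tape Sym
      scanned = ⟨ List.map bit (reverse x) , blank , [] ⟩

      begin-holds : (scanned ∷ blanks) holds (reverse x ∷ Vec.replicate extra [])
      held begin-holds zero    = 0 , refl
      held begin-holds (suc j) = 0 ,
        trans (lookup-replicate j _) (cong (λ xs → ⟨ List.map bit xs , blank , [] ⟩) (sym (lookup-replicate j [])))

      load-eta : ∀ x → load (List.map bit x) ≡ record (load {Fin 0} (List.map bit x)) { before = List.map bit [] }
      load-eta []      = refl
      load-eta (_ ∷ _) = refl

      result : ∃[ ts ] ts holds σ × Exec P (entry P) (scanned ∷ blanks) n ts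
      result = simulate d begin-holds

      whole : Run machine (length x + suc n) (initial machine x) (config (just nothing) (proj₁ result))
      whole = Run-++ machine
        (subst (λ t → Run machine (length x) (config nothing (t ∷ blanks)) (config nothing (scanned ∷ blanks)))
               (sym (load-eta x)) (scan-run x [] blanks))
        -- This single step is taken at the first blank behind the input, where control passes to
        -- the program.
        (step (here (cong (λ us → config (just (just (entry P))) (scanned ∷ us)) (sym (act-keep blanks))))
              (exec-run (proj₂ (proj₂ result))))

      contents-holds : ∀ {t xs} → Holds t xs → Inscribed t (reverse xs)
      contents-holds {xs = xs} (m , refl) = 0 , suc m , cong (_++ blank ∷ replicate m blank) (sym (List.reverse-map bit xs))

    -- Reading the tape from left to right runs through the stack from bottom to top, hence the
    -- reversal.
    machine-outputs : Outputs machine x (reverse (lookup σ (fromℕ extra)))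
    machine-outputs = _ , _ , whole , refl , contents-holds (held (proj₁ (proj₂ result)) (fromℕ extra))

    machine-time : ∀ {m c} → Run machine m (initial machine x) c → m ≤ length x + suc n
    machine-time = halted-run-longest machine machine-deterministic whole refl

-- Generators and their compilation

clamp : ∀ {m} → ℕ → Fin (suc m)
clamp {_}     zero    = zero
clamp {zero}  (suc c) = zero
clamp {suc m} (suc c) = suc (clamp c)

toℕ-clamp : ∀ {m c} → c ≤ m → toℕ (clamp {m} c) ≡ c
toℕ-clamp z≤n       = refl
toℕ-clamp (s≤s c≤m) = cong suc (toℕ-clamp c≤m)

-- Loops run over read-only lists, so a generator always takes polynomial time.  The
-- variable bound by a loop is the part of its list not yet visited.

data Gen (k : ℕ) : Set where
  put  : List Bool → Gen k
  _⨾_  : Gen k → Gen k → Gen k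
  for  : Fin k → (Bool → Gen (suc k)) → Gen k
  bind : Gen k → Gen (suc k) → Gen k

Env : ℕ → Set
Env = Vec (List Bool)

loop : (Bool → List Bool → List Bool) → List Bool → List Bool
loop f []       = []
loop f (b ∷ bs) = f b bs ++ loop f bs

-- Printing pushes letter after letter, so a result that becomes a variable has its last letter on
-- top; this is the `reverse` in `bind`.
printed : ∀ {k} → Gen k → Env k → List Bool
printed (put w)    ρ = w
printed (G ⨾ H)    ρ = printed G ρ ++ printed H ρ
printed (for v G)  ρ = loop (λ b bs → printed (G b) (bs ∷ ρ)) (lookup ρ v)
printed (bind G H) ρ = printed H (reverse (printed G ρ) ∷ ρ)

-- `L` bounds the lengths of all lists in scope. Every pass of a loop is charged for both branches,
-- so the bound does not depend on the letters; `bind` raises `L` by a polynomial, and polynomials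
-- are closed under this composition.
size : ∀ {k} → Gen k → ℕ → ℕ
size (put w)    L = length w
size (G ⨾ H)    L = size G L + size H L
size (for v G)  L = L * (size (G true) L + size (G false) L)
size (bind G H) L = size H (L + size G L)

-- The three summands for `for` belong to the three drains of its compilation: moving the list to
-- the scratch stack, copying it back to its own stack and to a fresh one, and consuming the fresh
-- copy. The last summand for `bind` pays for clearing the stack of the bound variable.
time : ∀ {k} → Gen k → ℕ → ℕ
time (put w)    L = length w + 1
time (G ⨾ H)    L = time G L + time H L
time (for v G)  L = (L * 3 + 2) + ((L * 4 + 2) + (L * (2 + (time (G true) L + time (G false) L)) + 2))
time (bind G H) L = time G L + (time H (L + size G L) + (size G L * 3 + 2))

size-poly : ∀ {k} (G : Gen k) → PolyBounded (size G)
size-poly (put w)    = poly-const (length w)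
size-poly (G ⨾ H)    = poly-+ (size-poly G) (size-poly H)
size-poly (for v G)  = poly-* poly-id (poly-+ (size-poly (G true)) (size-poly (G false)))
size-poly (bind G H) = poly-∘ (size-poly H) (poly-+ poly-id (size-poly G))

time-poly : ∀ {k} (G : Gen k) → PolyBounded (time G)
time-poly (put w)    = poly-const (length w + 1)
time-poly (G ⨾ H)    = poly-+ (time-poly G) (time-poly H)
time-poly (for v G)  = poly-+ (poly-+ (poly-* poly-id (poly-const 3)) (poly-const 2))
  (poly-+ (poly-+ (poly-* poly-id (poly-const 4)) (poly-const 2))
  (poly-+ (poly-* poly-id (poly-+ (poly-const 2) (poly-+ (time-poly (G true)) (time-poly (G false))))) (poly-const 2)))
time-poly (bind G H) = poly-+ (time-poly G) (poly-+ (poly-∘ (time-poly H) (poly-+ poly-id (size-poly G)))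
  (poly-+ (poly-* (size-poly G) (poly-const 3)) (poly-const 2)))

LengthsAtMost : ∀ {k} → Env k → ℕ → Set
LengthsAtMost ρ L = ∀ i → length (lookup ρ i) ≤ L

lengths-∷ : ∀ {k} {ρ : Env k} {L xs} → length xs ≤ L → LengthsAtMost ρ L → LengthsAtMost (xs ∷ ρ) L
lengths-∷ h hs zero    = h
lengths-∷ h hs (suc i) = hs i

either : (f : Bool → ℕ) → ∀ b → f b ≤ f true + f false
either f true  = m≤m+n _ _
either f false = m≤n+m _ _

length-loop : ∀ {f c L} → (∀ b bs → length bs ≤ L → length (f b bs) ≤ c) →
              ∀ xs → length xs ≤ L → length (loop f xs) ≤ length xs * c
length-loop         hf []       h = z≤n
length-loop {f} {c} hf (b ∷ bs) h = ≤-trans (≤-reflexive (List.length-++ (f b bs)))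
  (+-mono-≤ (hf b bs (≤-trans (n≤1+n _) h)) (length-loop hf bs (≤-trans (n≤1+n _) h)))

length-printed : ∀ {k} (G : Gen k) {ρ L} → LengthsAtMost ρ L → length (printed G ρ) ≤ size G L
length-reverse-printed : ∀ {k} (G : Gen k) {ρ L} → LengthsAtMost ρ L → length (reverse (printed G ρ)) ≤ size G L

length-printed (put w)   h = ≤-refl
length-printed (G ⨾ H) {ρ} h = ≤-trans (≤-reflexive (List.length-++ (printed G ρ)))
  (+-mono-≤ (length-printed G h) (length-printed H h))
length-printed (for v G) {ρ} {L} h = ≤-trans
  (length-loop (λ b bs hb → ≤-trans (length-printed (G b) (lengths-∷ hb h)) (either (λ b → size (G b) L) b)) (lookup ρ v) (h v))
  (*-monoˡ-≤ _ (h v))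
length-printed (bind G H) h = length-printed H
  (lengths-∷ (≤-trans (length-reverse-printed G h) (m≤n+m _ _)) (λ i → ≤-trans (h i) (m≤m+n _ _)))

length-reverse-printed G {ρ} h = ≤-trans (≤-reflexive (List.length-reverse (printed G ρ))) (length-printed G h)

-- The number of fresh stacks in use at once. Consecutive parts share theirs, since each part
-- returns its fresh stacks empty.
depth : ∀ {k} → Gen k → ℕ
depth (put w)    = 0
depth (G ⨾ H)    = depth G ⊔ depth H
depth (for v G)  = suc (depth (G true) ⊔ depth (G false))
depth (bind G H) = suc (depth G ⊔ depth H)

-- t is a scratch stack, o the stack printed to; stacks from number s on are free.

compile : ∀ {k T} → Gen k → Vec (Fin (suc T)) k → (t o : Fin (suc T)) (s : ℕ) → Prog (suc T)
compile (put [])      vars t o s = skip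
compile (put (b ∷ w)) vars t o s = push o b ⨾ compile (put w) vars t o s
compile (G ⨾ H)       vars t o s = compile G vars t o s ⨾ compile H vars t o s
compile (for v G)     vars t o s =
  drain (lookup vars v) (push t) ⨾
  drain t (λ b → push (lookup vars v) b ⨾ push (clamp s) b) ⨾
  drain (clamp s) (λ b → compile (G b) (clamp s ∷ vars) t o (suc s))
compile (bind G H)    vars t o s =
  compile G vars t (clamp s) (suc s) ⨾
  compile H (clamp s ∷ vars) t o (suc s) ⨾
  drain (clamp s) (λ _ → skip)

module _ {T : ℕ} where

  private
    update-other : ∀ (σ : Stacks T) {i j xs} → i ≢ j → lookup (σ [ j ]≔ xs) i ≡ lookup σ i
    update-other σ i≢j = lookup∘update′ i≢j σ _

    update-same : ∀ (σ : Stacks T) {j xs} → lookup (σ [ j ]≔ xs) j ≡ xs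
    update-same σ {j} = lookup∘update j σ _

  drain-push : ∀ {v t : Fin T} xs {σ} → v ≢ t → lookup σ v ≡ xs → ∃[ σ′ ]
    drain v (push t) , σ ⇓[ length xs * 3 + 2 ] σ′ × lookup σ′ v ≡ [] ×
    lookup σ′ t ≡ xs ʳ++ lookup σ t × (∀ i → i ≢ v → i ≢ t → lookup σ′ i ≡ lookup σ i)
  drain-push []       v≢t eq = _ , ⇓stop eq , eq , refl , λ i _ _ → refl
  drain-push {v} {t} (b ∷ bs) {σ} v≢t eq =
    let σ₁ = σ [ v ]≔ bs
        σ₂ = σ₁ [ t ]≔ (b ∷ lookup σ₁ t)
        σ′ , d , v≡ , t≡ , same = drain-push bs {σ₂} v≢t (trans (update-other σ₁ v≢t) (update-same σ))
    in σ′ , ⇓pop eq ⇓push d , v≡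
     , trans t≡ (cong (bs ʳ++_) (trans (update-same σ₁) (cong (b ∷_) (update-other σ (v≢t ∘ sym)))))
     , λ i i≢v i≢t → trans (same i i≢v i≢t) (trans (update-other σ₁ i≢t) (update-other σ i≢v))

  drain-push² : ∀ {v t l : Fin T} xs {σ} → v ≢ t → l ≢ t → l ≢ v → lookup σ t ≡ xs → ∃[ σ′ ]
    drain t (λ b → push v b ⨾ push l b) , σ ⇓[ length xs * 4 + 2 ] σ′ × lookup σ′ t ≡ [] ×
    lookup σ′ v ≡ xs ʳ++ lookup σ v × lookup σ′ l ≡ xs ʳ++ lookup σ l ×
    (∀ i → i ≢ v → i ≢ t → i ≢ l → lookup σ′ i ≡ lookup σ i)
  drain-push² []       v≢t l≢t l≢v eq = _ , ⇓stop eq , eq , refl , refl , λ i _ _ _ → refl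
  drain-push² {v} {t} {l} (b ∷ bs) {σ} v≢t l≢t l≢v eq =
    let σ₁ = σ [ t ]≔ bs
        σ₂ = σ₁ [ v ]≔ (b ∷ lookup σ₁ v)
        σ₃ = σ₂ [ l ]≔ (b ∷ lookup σ₂ l)
        σ′ , d , t≡ , v≡ , l≡ , same = drain-push² bs {σ₃} v≢t l≢t l≢v
          (trans (update-other σ₂ (l≢t ∘ sym)) (trans (update-other σ₁ (v≢t ∘ sym)) (update-same σ)))
    in σ′ , ⇓pop eq (⇓⨾ ⇓push ⇓push) d , t≡
     , trans v≡ (cong (bs ʳ++_) (trans (update-other σ₂ (l≢v ∘ sym)) (trans (update-same σ₁) (cong (b ∷_) (update-other σ v≢t)))))
     , trans l≡ (cong (bs ʳ++_) (trans (update-same σ₂) (cong (b ∷_) (trans (update-other σ₁ l≢v) (update-other σ l≢t)))))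
     , λ i i≢v i≢t i≢l → trans (same i i≢v i≢t i≢l)
         (trans (update-other σ₂ i≢l) (trans (update-other σ₁ i≢v) (update-other σ i≢t)))

  drain-skip : ∀ {v : Fin T} xs {σ} → lookup σ v ≡ xs → ∃[ σ′ ]
    drain v (λ _ → skip) , σ ⇓[ length xs * 3 + 2 ] σ′ × lookup σ′ v ≡ [] ×
    (∀ i → i ≢ v → lookup σ′ i ≡ lookup σ i)
  drain-skip []       eq = _ , ⇓stop eq , eq , λ i _ → refl
  drain-skip {v} (b ∷ bs) {σ} eq =
    let σ′ , d , v≡ , same = drain-skip bs {σ [ v ]≔ bs} (update-same σ)
    in σ′ , ⇓pop eq ⇓skip d , v≡ , λ i i≢v → trans (same i i≢v) (update-other σ i≢v)

module _ {T E : ℕ} (E≤T : E ≤ suc T) where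

  Outside : ℕ → Fin (suc T) → Set
  Outside s p = toℕ p < s ⊎ E ≤ toℕ p

  record Layout {k} (vars : Vec (Fin (suc T)) k) (t o : Fin (suc T)) (s : ℕ) : Set where
    field
      vars≢t       : ∀ i → lookup vars i ≢ t
      vars≢o       : ∀ i → lookup vars i ≢ o
      t≢o          : t ≢ o
      vars-outside : ∀ i → Outside s (lookup vars i)
      t-outside    : Outside s t
      o-outside    : Outside s o

  record Ready {k} (vars : Vec (Fin (suc T)) k) (t : Fin (suc T)) (s : ℕ) (ρ : Env k) (σ : Stacks (suc T)) : Set where
    field
      vars-hold  : ∀ i → lookup σ (lookup vars i) ≡ lookup ρ i
      t-empty    : lookup σ t ≡ []
      free-empty : ∀ p → s ≤ toℕ p → toℕ p < E → lookup σ p ≡ []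

  open Layout
  open Ready

  outside-suc : ∀ {s p} → Outside s p → Outside (suc s) p
  outside-suc (inj₁ p<s) = inj₁ (m≤n⇒m≤1+n p<s)
  outside-suc (inj₂ E≤p) = inj₂ E≤p

  toℕ-fresh : ∀ {s} → s < E → toℕ (clamp {T} s) ≡ s
  toℕ-fresh s<E = toℕ-clamp (s≤s⁻¹ (≤-trans s<E E≤T))

  fresh-outside : ∀ {s} → s < E → Outside (suc s) (clamp s)
  fresh-outside s<E = inj₁ (s≤s (≤-reflexive (toℕ-fresh s<E)))

  fresh≢ : ∀ {s p} → s < E → Outside s p → clamp s ≢ p
  fresh≢ s<E (inj₁ p<s) refl = <-irrefl (toℕ-fresh s<E) p<s
  fresh≢ s<E (inj₂ E≤p) refl = <⇒≱ s<E (subst (E ≤_) (toℕ-fresh s<E) E≤p)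

  free≢ : ∀ {s p q} → Outside s q → s ≤ toℕ p → toℕ p < E → p ≢ q
  free≢ (inj₁ q<s) s≤p p<E refl = <⇒≱ q<s s≤p
  free≢ (inj₂ E≤q) s≤p p<E refl = <⇒≱ p<E E≤q

  layout-∷ : ∀ {k} {vars : Vec _ k} {t o s} → s < E → Layout vars t o s → Layout (clamp s ∷ vars) t o (suc s)
  layout-∷ s<E lay = record
    { vars≢t       = λ { zero → fresh≢ s<E (t-outside lay) ; (suc i) → vars≢t lay i }
    ; vars≢o       = λ { zero → fresh≢ s<E (o-outside lay) ; (suc i) → vars≢o lay i }
    ; t≢o          = t≢o lay
    ; vars-outside = λ { zero → fresh-outside s<E ; (suc i) → outside-suc (vars-outside lay i) }
    ; t-outside    = outside-suc (t-outside lay)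
    ; o-outside    = outside-suc (o-outside lay)
    }

  layout-target : ∀ {k} {vars : Vec _ k} {t o s} → s < E → Layout vars t o s → Layout vars t (clamp s) (suc s)
  layout-target s<E lay = record
    { vars≢t       = vars≢t lay
    ; vars≢o       = λ i → fresh≢ s<E (vars-outside lay i) ∘ sym
    ; t≢o          = fresh≢ s<E (t-outside lay) ∘ sym
    ; vars-outside = λ i → outside-suc (vars-outside lay i)
    ; t-outside    = outside-suc (t-outside lay)
    ; o-outside    = fresh-outside s<E
    }

  record Appended (o : Fin (suc T)) (w : List Bool) (σ σ′ : Stacks (suc T)) : Set where
    constructor appended
    field
      target    : lookup σ′ o ≡ w ʳ++ lookup σ o
      elsewhere : ∀ i → i ≢ o → lookup σ′ i ≡ lookup σ i

  ready-appended : ∀ {k} {vars : Vec _ k} {t o s ρ σ σ′ w} → Layout vars t o s →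
                   Appended o w σ σ′ → Ready vars t s ρ σ → Ready vars t s ρ σ′
  ready-appended lay (appended _ same) rdy = record
    { vars-hold  = λ i → trans (same _ (vars≢o lay i)) (vars-hold rdy i)
    ; t-empty    = trans (same _ (t≢o lay)) (t-empty rdy)
    ; free-empty = λ p s≤p p<E → trans (same p (free≢ (o-outside lay) s≤p p<E)) (free-empty rdy p s≤p p<E)
    }

  fresh-empty : ∀ {k} {vars : Vec _ k} {t s ρ σ} → s < E → Ready vars t s ρ σ → lookup σ (clamp s) ≡ []
  fresh-empty s<E rdy = free-empty rdy _ (≤-reflexive (sym (toℕ-fresh s<E))) (subst (_< E) (sym (toℕ-fresh s<E)) s<E)

  ready-suc : ∀ {k} {vars : Vec _ k} {t s ρ σ} → Ready vars t s ρ σ → Ready vars t (suc s) ρ σ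
  ready-suc rdy = record
    { vars-hold  = vars-hold rdy
    ; t-empty    = t-empty rdy
    ; free-empty = λ p s<p → free-empty rdy p (<⇒≤ s<p)
    }

  ready-elsewhere : ∀ {k} {vars : Vec _ k} {t o s ρ σ σ′} → s < E → Layout vars t o s →
    (∀ i → i ≢ o → i ≢ clamp s → lookup σ′ i ≡ lookup σ i) → Ready vars t (suc s) ρ σ → Ready vars t (suc s) ρ σ′
  ready-elsewhere s<E lay same rdy = record
    { vars-hold  = λ i → trans (same _ (vars≢o lay i) (fresh≢ s<E (vars-outside lay i) ∘ sym)) (vars-hold rdy i)
    ; t-empty    = trans (same _ (t≢o lay) (fresh≢ s<E (t-outside lay) ∘ sym)) (t-empty rdy)
    ; free-empty = λ p s<p p<E → trans
        (same p (free≢ (outside-suc (o-outside lay)) s<p p<E) (free≢ (fresh-outside s<E) s<p p<E)) (free-empty rdy p s<p p<E)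
    }

  ready-∷ : ∀ {k} {vars : Vec _ k} {t s ρ σ xs} → lookup σ (clamp s) ≡ xs →
            Ready vars t (suc s) ρ σ → Ready (clamp s ∷ vars) t (suc s) (xs ∷ ρ) σ
  ready-∷ eq rdy = record
    { vars-hold  = λ { zero → eq ; (suc i) → vars-hold rdy i }
    ; t-empty    = t-empty rdy
    ; free-empty = free-empty rdy
    }

  appended-trans : ∀ {o w w′ σ σ′ σ″} → Appended o w σ σ′ → Appended o w′ σ′ σ″ → Appended o (w ++ w′) σ σ″
  appended-trans {w = w} {w′} (appended o≡ same) (appended o≡′ same′) = appended
    (trans o≡′ (trans (cong (w′ ʳ++_) o≡) (sym (List.++-ʳ++ w)))) λ i i≢o → trans (same′ i i≢o) (same i i≢o)

  Runs : Prog (suc T) → Fin (suc T) → List Bool → ℕ → Stacks (suc T) → Set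
  Runs P o w B σ = ∃[ n ] ∃[ σ′ ] n ≤ B × P , σ ⇓[ n ] σ′ × Appended o w σ σ′

  -- The body may rely on the invariant `I`, provided that `I` survives every change confined to the
  -- loop stack and the output; these are the only stacks that differ between two passes.
  drain-loop : ∀ {l o : Fin (suc T)} {P : Bool → Prog (suc T)} {f c L}
    (I : Stacks (suc T) → Set) → l ≢ o →
    (∀ {σ σ′} → I σ → (∀ i → i ≢ o → i ≢ l → lookup σ′ i ≡ lookup σ i) → I σ′) →
    (∀ b bs {σ} → I σ → length bs ≤ L → lookup σ l ≡ bs → Runs (P b) o (f b bs) c σ) →
    ∀ xs {σ} → I σ → length xs ≤ L → lookup σ l ≡ xs →
    ∃[ n ] ∃[ σ′ ] n ≤ length xs * (2 + c) + 2 × drain l P , σ ⇓[ n ] σ′ ×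
      lookup σ′ o ≡ loop f xs ʳ++ lookup σ o × lookup σ′ l ≡ [] × (∀ i → i ≢ o → i ≢ l → lookup σ′ i ≡ lookup σ i)
  drain-loop I l≢o stable hP [] hI hL eq = _ , _ , ≤-refl , ⇓stop eq , refl , eq , λ i _ _ → refl
  drain-loop {l} {o} {f = f} {c} I l≢o stable hP (b ∷ bs) {σ} hI hL eq =
    let hL′ = ≤-trans (n≤1+n _) hL
        σ₁ = σ [ l ]≔ bs
        σ₁≡ = λ i i≢o i≢l → lookup∘update′ i≢l σ bs
        m , σ₂ , m≤ , d , appended o≡ same = hP b bs (stable hI σ₁≡) hL′ (lookup∘update l σ bs)
        σ₂≡ = λ i i≢o i≢l → trans (same i i≢o) (σ₁≡ i i≢o i≢l)
        n , σ′ , n≤ , d′ , o≡′ , l≡ , same′ = drain-loop I l≢o stable hP bs (stable hI σ₂≡) hL′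
          (trans (same l l≢o) (lookup∘update l σ bs))
    in _ , σ′
     , ≤-trans (s≤s (s≤s (+-mono-≤ m≤ n≤))) (≤-reflexive (cong (λ k → 2 + k) (sym (+-assoc c (length bs * (2 + c)) 2))))
     , ⇓pop eq d d′
     , trans o≡′ (trans (cong (loop f bs ʳ++_) (trans o≡ (cong (f b bs ʳ++_) (lookup∘update′ (l≢o ∘ sym) σ bs))))
         (sym (List.++-ʳ++ (f b bs))))
     , l≡
     , λ i i≢o i≢l → trans (same′ i i≢o i≢l) (σ₂≡ i i≢o i≢l)

  runs-weaken : ∀ {P o w B B′ σ} → B ≤ B′ → Runs P o w B σ → Runs P o w B′ σ
  runs-weaken B≤B′ (n , σ′ , n≤ , rest) = n , σ′ , ≤-trans n≤ B≤B′ , rest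

  compile-correct : ∀ {k} (G : Gen k) {vars t o s ρ σ L} → Layout vars t o s → Ready vars t s ρ σ →
    s + depth G ≤ E → LengthsAtMost ρ L → Runs (compile G vars t o s) o (printed G ρ) (time G L) σ
  compile-correct (put []) lay rdy hE hL = 1 , _ , ≤-refl , ⇓skip , appended refl λ i _ → refl
  compile-correct (put (b ∷ w)) {o = o} {σ = σ} {L} lay rdy hE hL =
    let pushed = appended (lookup∘update o σ (b ∷ lookup σ o)) λ i i≢o → lookup∘update′ i≢o σ (b ∷ lookup σ o)
        n , σ′ , n≤ , d , app = compile-correct (put w) {L = L} lay (ready-appended lay pushed rdy) hE hL
    in suc n , σ′ , s≤s n≤ , ⇓⨾ ⇓push d , appended-trans pushed app
  compile-correct (G ⨾ H) {ρ = ρ} lay rdy hE hL =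
    let m , σ₁ , m≤ , d , app = compile-correct G lay rdy (≤-trans (+-monoʳ-≤ _ (m≤m⊔n (depth G) (depth H))) hE) hL
        n , σ₂ , n≤ , d′ , app′ = compile-correct H lay (ready-appended lay app rdy)
                                    (≤-trans (+-monoʳ-≤ _ (m≤n⊔m (depth G) (depth H))) hE) hL
    in m + n , σ₂ , +-mono-≤ m≤ n≤ , ⇓⨾ d d′ , appended-trans app app′
  compile-correct (for v G) {vars} {t} {o} {s} {ρ} {σ} {L} lay rdy hE hL =
    -- The list travels to the scratch stack and back. Two reversals restore it, and the way back
    -- also leaves a copy on the fresh stack `l`, which the loop may then consume.
    let σ₁ , d₁ , v≡₁ , t≡₁ , same₁ = drain-push xs {σ} (vars≢t lay v) (vars-hold rdy v)
        t≡₁′ = trans t≡₁ (cong (xs ʳ++_) (t-empty rdy))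
        σ₂ , d₂ , t≡₂ , v≡₂ , l≡₂ , same₂ = drain-push² (xs ʳ++ []) {σ₁} (vars≢t lay v) l≢t l≢v t≡₁′
        v≡₂′ = trans v≡₂ (trans (cong ((xs ʳ++ []) ʳ++_) v≡₁) twice)
        l≡₂′ = trans l≡₂ (trans (cong ((xs ʳ++ []) ʳ++_) (trans (same₁ l l≢v l≢t) l-empty)) twice)
        unchanged = restored {σ₂} v≡₂′ t≡₂ λ i i≢v i≢t i≢l → trans (same₂ i i≢v i≢t i≢l) (same₁ i i≢v i≢t)
        n , σ₃ , n≤ , d₃ , o≡₃ , l≡₃ , same₃ = drain-loop (Ready vars t (suc s) ρ) l≢o
          (λ rdy same → ready-elsewhere s<E lay same rdy) iteration
          xs (ready-elsewhere s<E lay (λ i _ → unchanged i) (ready-suc rdy)) (hL v) l≡₂′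
    in _ , σ₃
     , +-mono-≤ (+-monoˡ-≤ 2 (*-monoˡ-≤ 3 (hL v)))
       (+-mono-≤ (+-monoˡ-≤ 2 (*-monoˡ-≤ 4 (≤-trans (≤-reflexive (List.length-reverse xs)) (hL v))))
       (≤-trans n≤ (+-monoˡ-≤ 2 (*-monoˡ-≤ _ (hL v)))))
     , ⇓⨾ d₁ (⇓⨾ d₂ d₃)
     , appended (trans o≡₃ (cong (printed (for v G) ρ ʳ++_) (unchanged o (l≢o ∘ sym))))
         λ i i≢o → elsewhere {σ₂} {σ₃} i i≢o l≡₃ unchanged same₃
    where
    xs : List Bool
    xs = lookup ρ v
    l : Fin (suc T)
    l = clamp s
    s<E : s < E
    s<E = ≤-trans (≤-trans (s≤s (m≤m+n s _)) (≤-reflexive (sym (+-suc s _)))) hE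
    l≢o : l ≢ o
    l≢o = fresh≢ s<E (o-outside lay)
    l≢t : l ≢ t
    l≢t = fresh≢ s<E (t-outside lay)
    l≢v : l ≢ lookup vars v
    l≢v = fresh≢ s<E (vars-outside lay v)
    l-empty : lookup σ l ≡ []
    l-empty = fresh-empty s<E rdy
    twice : (xs ʳ++ []) ʳ++ [] ≡ xs
    twice = trans (List.ʳ++-ʳ++ xs) (List.++-identityʳ xs)
    restored : ∀ {σ₂} → lookup σ₂ (lookup vars v) ≡ xs → lookup σ₂ t ≡ [] →
      (∀ i → i ≢ lookup vars v → i ≢ t → i ≢ l → lookup σ₂ i ≡ lookup σ i) →
      ∀ i → i ≢ l → lookup σ₂ i ≡ lookup σ i
    restored v≡ t≡ same i i≢l with i Fin.≟ lookup vars v | i Fin.≟ t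
    ... | yes refl | _        = trans v≡ (sym (vars-hold rdy v))
    ... | no _     | yes refl = trans t≡ (sym (t-empty rdy))
    ... | no i≢v   | no i≢t   = same i i≢v i≢t i≢l
    elsewhere : ∀ {σ₂ σ₃} i → i ≢ o → lookup σ₃ l ≡ [] → (∀ i → i ≢ l → lookup σ₂ i ≡ lookup σ i) →
      (∀ i → i ≢ o → i ≢ l → lookup σ₃ i ≡ lookup σ₂ i) → lookup σ₃ i ≡ lookup σ i
    elsewhere i i≢o l≡ before after with i Fin.≟ l
    ... | yes refl = trans l≡ (sym l-empty)
    ... | no i≢l   = trans (after i i≢o i≢l) (before i i≢l)
    depth-branch : ∀ b → depth (G b) ≤ depth (G true) ⊔ depth (G false)
    depth-branch true  = m≤m⊔n _ _
    depth-branch false = m≤n⊔m (depth (G true)) _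
    iteration : ∀ b bs {σ} → Ready vars t (suc s) ρ σ → length bs ≤ L → lookup σ l ≡ bs →
      Runs (compile (G b) (l ∷ vars) t o (suc s)) o (printed (G b) (bs ∷ ρ)) (time (G true) L + time (G false) L) σ
    iteration b bs rdy hbs eq = runs-weaken (either (λ b → time (G b) L) b)
      (compile-correct (G b) (layout-∷ s<E lay) (ready-∷ eq rdy)
        (≤-trans (≤-trans (s≤s (+-monoʳ-≤ s (depth-branch b))) (≤-reflexive (sym (+-suc s _)))) hE) (lengths-∷ hbs hL))
  compile-correct (bind G H) {vars} {t} {o} {s} {ρ} {σ} {L} lay rdy hE hL =
    let n₁ , σ₁ , n₁≤ , d₁ , appended l≡₁ same₁ = compile-correct G (layout-target s<E lay) (ready-suc rdy)
          (≤-trans (+-monoʳ-≤ (suc s) (m≤m⊔n (depth G) (depth H))) hE′) hL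
        l≡₁′ = trans l≡₁ (cong (printed G ρ ʳ++_) l-empty)
        n₂ , σ₂ , n₂≤ , d₂ , appended o≡₂ same₂ = compile-correct H (layout-∷ s<E lay)
          (ready-∷ l≡₁′ (ready-elsewhere s<E lay (λ i _ → same₁ i) (ready-suc rdy)))
          (≤-trans (+-monoʳ-≤ (suc s) (m≤n⊔m (depth G) (depth H))) hE′)
          (lengths-∷ (≤-trans (length-reverse-printed G hL) (m≤n+m _ _)) (λ i → ≤-trans (hL i) (m≤m+n _ _)))
        σ₃ , d₃ , l≡₃ , same₃ = drain-skip (reverse (printed G ρ)) {σ₂} (trans (same₂ l l≢o) l≡₁′)
    in _ , σ₃
     , +-mono-≤ n₁≤ (+-mono-≤ n₂≤ (+-monoˡ-≤ 2 (*-monoˡ-≤ 3 (length-reverse-printed G hL))))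
     , ⇓⨾ d₁ (⇓⨾ d₂ d₃)
     , appended (trans (same₃ o (l≢o ∘ sym)) (trans o≡₂ (cong (printed (bind G H) ρ ʳ++_) (same₁ o (l≢o ∘ sym)))))
         λ i i≢o → elsewhere {σ₁} {σ₂} {σ₃} i i≢o l≡₃ same₁ same₂ same₃
    where
    l : Fin (suc T)
    l = clamp s
    hE′ : suc s + (depth G ⊔ depth H) ≤ E
    hE′ = ≤-trans (≤-reflexive (sym (+-suc s _))) hE
    s<E : s < E
    s<E = ≤-trans (s≤s (m≤m+n s _)) hE′
    l≢o : l ≢ o
    l≢o = fresh≢ s<E (o-outside lay)
    l-empty : lookup σ l ≡ []
    l-empty = fresh-empty s<E rdy
    elsewhere : ∀ {σ₁ σ₂ σ₃} i → i ≢ o → lookup σ₃ l ≡ [] → (∀ i → i ≢ l → lookup σ₁ i ≡ lookup σ i) →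
      (∀ i → i ≢ o → lookup σ₂ i ≡ lookup σ₁ i) → (∀ i → i ≢ l → lookup σ₃ i ≡ lookup σ₂ i) → lookup σ₃ i ≡ lookup σ i
    elsewhere i i≢o l≡ s₁ s₂ s₃ with i Fin.≟ l
    ... | yes refl = trans l≡ (sym l-empty)
    ... | no i≢l   = trans (s₃ i i≢l) (trans (s₂ i i≢o) (s₁ i i≢l))

-- Stacks: 0 holds the input, 1 is scratch, the last is the output.

generated-poly-time : (G : Gen 1) → PolyTime (λ x → printed G (reverse x ∷ []))
generated-poly-time G =
  machine P , proj₁ bound , machine-deterministic P ,
  (λ x {n} {c} r → ≤-trans (machine-time P (program-run x) r)
    (≤-trans (+-monoʳ-≤ (length x) (s≤s (proj₁ (proj₂ (proj₂ (run x)))))) (proj₂ bound (length x)))) ,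
  λ x → subst (Outputs (machine P) x) (output x) (machine-outputs P (program-run x))
  where
  E : ℕ
  E = 2 + depth G
  P : Prog (suc E)
  P = compile G (zero ∷ []) (suc zero) (fromℕ E) 2
  bound : PolyBounded (λ n → n + suc (time G n))
  bound = poly-+ poly-id (poly-+ (poly-const 1) (time-poly G))
  start-stacks : List Bool → Stacks (suc E)
  start-stacks x = reverse x ∷ Vec.replicate E []
  layout : Layout (n≤1+n E) (zero ∷ []) (suc zero) (fromℕ E) 2
  layout = record
    { vars≢t       = λ { zero () }
    ; vars≢o       = λ { zero () }
    ; t≢o          = λ ()
    ; vars-outside = λ { zero → inj₁ (s≤s z≤n) }
    ; t-outside    = inj₁ (s≤s (s≤s z≤n))
    ; o-outside    = inj₂ (≤-reflexive (sym (Fin.toℕ-fromℕ E)))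
    }
  ready : ∀ x → Ready (n≤1+n E) (zero ∷ []) (suc zero) 2 (reverse x ∷ []) (start-stacks x)
  ready x = record
    { vars-hold  = λ { zero → refl }
    ; t-empty    = refl
    ; free-empty = λ { (suc p) _ _ → lookup-replicate p [] }
    }
  run : ∀ x → Runs (n≤1+n E) P (fromℕ E) (printed G (reverse x ∷ [])) (time G (length x)) (start-stacks x)
  run x = compile-correct (n≤1+n E) G layout (ready x) ≤-refl (λ { zero → ≤-reflexive (List.length-reverse x) })
  program-run : ∀ x → P , start-stacks x ⇓[ proj₁ (run x) ] proj₁ (proj₂ (run x))
  program-run x = proj₁ (proj₂ (proj₂ (proj₂ (run x))))
  output : ∀ x → reverse (lookup (proj₁ (proj₂ (run x))) (fromℕ E)) ≡ printed G (reverse x ∷ [])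
  output x = trans (cong reverse (trans (Appended.target (proj₂ (proj₂ (proj₂ (proj₂ (run x))))))
    (cong (printed G (reverse x ∷ []) ʳ++_) (lookup-replicate (fromℕ (suc (depth G))) []))))
    (List.reverse-involutive (printed G (reverse x ∷ [])))

-- Quantifier blocks as games

Over : Quantifier → {A : Set} → (A → Set) → Set
Over ∀′ P = ∀ a → P a
Over ∃′ P = ∃ P

over-map : ∀ q {A : Set} {P Q : A → Set} → (∀ a → P a → Q a) → Over q P → Over q Q
over-map ∀′ f h       = λ a → f a (h a)
over-map ∃′ f (a , p) = a , f a p

-- A block becomes a monotone operator on predicates of outcomes. Strategies need not be
-- represented: every later argument replaces the predicate under the block.
Play : ∀ {D : Set} {k} → Vec Quantifier k → (Vec D k → Set) → Set
Play []       P = P []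
Play (q ∷ qs) P = Play qs λ v → Over q λ d → P (d ∷ v)

play-map : ∀ {D : Set} {k} (qs : Vec Quantifier k) {P Q : Vec D k → Set} →
           (∀ v → P v → Q v) → Play qs P → Play qs Q
play-map []       f = f []
play-map (q ∷ qs) f = play-map qs λ v → over-map q λ d → f (d ∷ v)

play-++ : ∀ {D : Set} {k l} (qs : Vec Quantifier k) (ps : Vec Quantifier l) (P : Vec D (k + l) → Set) →
          Play (qs ++ᵛ ps) P ≡ Play ps λ w → Play qs λ v → P (v ++ᵛ w)
play-++ []       ps P = refl
play-++ (q ∷ qs) ps P = play-++ qs ps λ v → Over q λ d → P (d ∷ v)

-- Dummy quantifiers are harmless only over a nonempty domain: the given element instantiates `∀′`
-- and witnesses `∃′`.
play-const : ∀ {D : Set} {k} → D → (qs : Vec Quantifier k) {X : Set} → Play {D} qs (λ _ → X) ⇔ X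
play-const d []        = mk⇔ id id
play-const d (∀′ ∷ qs) = mk⇔ (λ h → to (play-const d qs) (play-map qs (λ _ f → f d) h))
                             (λ x → play-map qs (λ _ x _ → x) (from (play-const d qs) x))
play-const d (∃′ ∷ qs) = mk⇔ (λ h → to (play-const d qs) (play-map qs (λ _ → proj₂) h))
                             (λ x → play-map qs (λ _ → d ,_) (from (play-const d qs) x))

lift : ∀ {m n} → (Fin m → Fin n) → Fin (suc m) → Fin (suc n)
lift f zero    = zero
lift f (suc i) = suc (f i)

lookup-lift : ∀ {A : Set} {m n d} {f : Fin m → Fin n} {ρ : Vec A m} {ρ′ : Vec A n} →
              (∀ i → lookup ρ′ (f i) ≡ lookup ρ i) → ∀ i → lookup (d ∷ ρ′) (lift f i) ≡ lookup (d ∷ ρ) i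
lookup-lift h zero    = refl
lookup-lift h (suc i) = h i

module _ {σ : Signature} where

  rename : ∀ {m n} → (Fin m → Fin n) → Formula σ m → Formula σ n
  rename f (atom R xs)  = atom R (Vec.map f xs)
  rename f (φ ∧ ψ)      = rename f φ ∧ rename f ψ
  rename f (φ ∨ ψ)      = rename f φ ∨ rename f ψ
  rename f (quant q φ)  = quant q (rename (lift f) φ)

  bind-block : ∀ {k n} → Vec Quantifier k → Formula σ (k + n) → Formula σ n
  bind-block []       φ = φ
  bind-block (q ∷ qs) φ = bind-block qs (quant q φ)

  module _ (C : Structure σ) where

    sat-rename : ∀ {m n} {f : Fin m → Fin n} {ρ : Vec (Domain C) m} {ρ′ : Vec (Domain C) n} →
                 (∀ i → lookup ρ′ (f i) ≡ lookup ρ i) → ∀ φ → Sat C ρ′ (rename f φ) ⇔ Sat C ρ φ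
    sat-rename {f = f} {ρ} {ρ′} h (atom R xs) = mk⇔ (subst (rel C R) eq) (subst (rel C R) (sym eq))
      where
      eq : Vec.map (lookup ρ′) (Vec.map f xs) ≡ Vec.map (lookup ρ) xs
      eq = trans (sym (Vec.map-∘ (lookup ρ′) f xs)) (Vec.map-cong h xs)
    sat-rename h (φ ∧ ψ) = mk⇔ (Product.map (to (sat-rename h φ)) (to (sat-rename h ψ)))
                               (Product.map (from (sat-rename h φ)) (from (sat-rename h ψ)))
    sat-rename h (φ ∨ ψ) = mk⇔ (Sum.map (to (sat-rename h φ)) (to (sat-rename h ψ)))
                               (Sum.map (from (sat-rename h φ)) (from (sat-rename h ψ)))
    sat-rename h (quant ∀′ φ) =
      mk⇔ (λ s d → to (sat-rename (lookup-lift h) φ) (s d)) (λ s d → from (sat-rename (lookup-lift h) φ) (s d))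
    sat-rename h (quant ∃′ φ) =
      mk⇔ (λ (d , s) → d , to (sat-rename (lookup-lift h) φ) s) (λ (d , s) → d , from (sat-rename (lookup-lift h) φ) s)

    sat-close : ∀ {k} (qs : Vec Quantifier k) φ → (C ⊨ close qs φ) ≡ Play qs λ v → Sat C v φ
    sat-close []        φ = refl
    sat-close (∀′ ∷ qs) φ = sat-close qs (quant ∀′ φ)
    sat-close (∃′ ∷ qs) φ = sat-close qs (quant ∃′ φ)

    sat-bind-block : ∀ {k n} (qs : Vec Quantifier k) φ {ρ : Vec (Domain C) n} →
                     Sat C ρ (bind-block qs φ) ≡ Play qs λ v → Sat C (v ++ᵛ ρ) φ
    sat-bind-block []        φ = refl
    sat-bind-block (∀′ ∷ qs) φ = sat-bind-block qs (quant ∀′ φ)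
    sat-bind-block (∃′ ∷ qs) φ = sat-bind-block qs (quant ∃′ φ)

-- Quantified Boolean formulas

-- Every variable has a kind in κ; a polarity fixes how the variables of each kind are quantified.

data QBF (κ : Set) : ∀ {m} → Vec κ m → Set where
  lit     : ∀ {m} {Γ : Vec κ m} → Bool → Fin m → QBF κ Γ
  _∧_ _∨_ : ∀ {m} {Γ : Vec κ m} → QBF κ Γ → QBF κ Γ → QBF κ Γ
  quant   : ∀ {m} {Γ : Vec κ m} c → QBF κ (c ∷ Γ) → QBF κ Γ

True : ∀ {κ} → (κ → Quantifier) → ∀ {m} {Γ : Vec κ m} → Vec Bool m → QBF κ Γ → Set
True pol β (lit b i)   = lookup β i ≡ b
True pol β (θ ∧ χ)     = True pol β θ × True pol β χ
True pol β (θ ∨ χ)     = True pol β θ ⊎ True pol β χ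
True pol β (quant c θ) = Over (pol c) λ b → True pol (b ∷ β) θ

dual : ∀ {κ m} {Γ : Vec κ m} → QBF κ Γ → QBF κ Γ
dual (lit b i)   = lit (not b) i
dual (θ ∧ χ)     = dual θ ∨ dual χ
dual (θ ∨ χ)     = dual θ ∧ dual χ
dual (quant c θ) = quant c (dual θ)

flip : Quantifier → Quantifier
flip ∀′ = ∃′
flip ∃′ = ∀′

not-≢ : ∀ {a b} → a ≢ b → a ≡ not b
not-≢ {true}  {true}  h = ⊥-elim (h refl)
not-≢ {true}  {false} h = refl
not-≢ {false} {true}  h = refl
not-≢ {false} {false} h = ⊥-elim (h refl)

≢-not : ∀ {b} → b ≢ not b
≢-not {true}  ()
≢-not {false} ()

module _ {κ : Set} (pol : κ → Quantifier) where

  dual-false : ∀ {m} {Γ : Vec κ m} {β} (θ : QBF κ Γ) → True pol β θ → ¬ True (flip ∘ pol) β (dual θ)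
  dual-false (lit b i)   h        h′ = ≢-not (trans (sym h) h′)
  dual-false (θ ∧ χ)     (h , k)  (inj₁ h′) = dual-false θ h h′
  dual-false (θ ∧ χ)     (h , k)  (inj₂ k′) = dual-false χ k k′
  dual-false (θ ∨ χ)     (inj₁ h) (h′ , k′) = dual-false θ h h′
  dual-false (θ ∨ χ)     (inj₂ k) (h′ , k′) = dual-false χ k k′
  dual-false (quant c θ) h h′ with pol c
  dual-false (quant c θ) h (b , h′) | ∀′ = dual-false θ (h b) h′
  dual-false (quant c θ) (b , h) h′ | ∃′ = dual-false θ h (h′ b)

module Classical (em : ExcludedMiddle 0ℓ) where

  dne : {P : Set} → ¬ ¬ P → P
  dne {P} h with em {P}
  ... | yes p = p
  ... | no ¬p = ⊥-elim (h ¬p)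

  ¬∀⇒∃¬ : {A : Set} {P : A → Set} → ¬ (∀ a → P a) → ∃[ a ] ¬ P a
  ¬∀⇒∃¬ h = dne λ ¬∃ → h λ a → dne λ ¬p → ¬∃ (a , ¬p)

  dual-true : ∀ {κ} (pol : κ → Quantifier) {m} {Γ : Vec κ m} {β} (θ : QBF κ Γ) →
              ¬ True pol β θ → True (flip ∘ pol) β (dual θ)
  dual-true pol (lit b i) h = not-≢ h
  dual-true pol {β = β} (θ ∧ χ) h with em {True pol β θ}
  ... | yes t = inj₂ (dual-true pol χ λ t′ → h (t , t′))
  ... | no ¬t = inj₁ (dual-true pol θ ¬t)
  dual-true pol (θ ∨ χ) h = dual-true pol θ (h ∘ inj₁) , dual-true pol χ (h ∘ inj₂)
  dual-true pol (quant c θ) h with pol c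
  ... | ∀′ = let b , ¬t = ¬∀⇒∃¬ h in b , dual-true pol θ ¬t
  ... | ∃′ = λ b → dual-true pol θ λ t → h (b , t)

  -- If every outcome in `P` were in `Q`, monotonicity would turn a win for `P` into one for `Q`.
  -- This stands in for playing a winning strategy for `P` against a strategy of the opponent that
  -- prevents `Q`.
  play-escape : ∀ {D : Set} {k} (qs : Vec Quantifier k) {P Q : Vec D k → Set} →
                Play qs P → ¬ Play qs Q → ∃[ v ] P v × ¬ Q v
  play-escape qs h h′ = dne λ ¬∃ → h′ (play-map qs (λ v p → dne λ ¬q → ¬∃ (v , p , ¬q)) h)

-- Gadgets and the translation of Boolean formulas

record Gadget (σ : Signature) (K : ℕ) : Set where
  field
    prefix : Vec Quantifier K
    value  : Bool → Formula σ K

open Gadget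

Simulates : ∀ {σ K} → Quantifier → Structure σ → Gadget σ K → Set
Simulates ∃′ C g = (∀ b → Play (prefix g) λ v → Sat C v (value g b)) ×
                   ¬ Play (prefix g) (λ v → ∀ b → Sat C v (value g b))
Simulates ∀′ C g = Play (prefix g) (λ v → ∃[ b ] Sat C v (value g b)) ×
                   (∀ b → ¬ Play (prefix g) λ v → Sat C v (value g b))

lookup-concat : ∀ {A : Set} {K m} (vs : Vec (Vec A K) m) i j → lookup (concat vs) (combine i j) ≡ lookup (lookup vs i) j
lookup-concat (v ∷ vs) zero    j = Vec.lookup-++ˡ v (concat vs) j
lookup-concat (v ∷ vs) (suc i) j = trans (Vec.lookup-++ʳ v (concat vs) (combine i j)) (lookup-concat vs i j)

module Translation {σ : Signature} {K : ℕ} {κ : Set} (g : κ → Gadget σ K) where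

  translate : ∀ {m} {Γ : Vec κ m} → QBF κ Γ → Formula σ (m * K)
  translate {Γ = Γ} (lit b i) = rename (combine i) (value (g (lookup Γ i)) b)
  translate (θ ∧ χ)     = translate θ ∧ translate χ
  translate (θ ∨ χ)     = translate θ ∨ translate χ
  translate (quant c θ) = bind-block (prefix (g c)) (translate θ)

  module _ (em : ExcludedMiddle 0ℓ) (C : Structure σ) (pol : κ → Quantifier) (sim : ∀ c → Simulates (pol c) C (g c)) where

    open Classical em

    -- In a positive formula additional true literals can only help. So `Above` is enough to carry
    -- truth into the structure, and `Below` is enough to carry it back.
    Above Below : ∀ {m} → Vec κ m → Vec Bool m → Vec (Vec (Domain C) K) m → Set
    Above Γ β vs = ∀ i → Sat C (lookup vs i) (value (g (lookup Γ i)) (lookup β i))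
    Below Γ β vs = ∀ i → ¬ Sat C (lookup vs i) (value (g (lookup Γ i)) (not (lookup β i)))

    above-∷ : ∀ {m} {Γ : Vec κ m} β vs {c} b v → Sat C v (value (g c) b) → Above Γ β vs → Above (c ∷ Γ) (b ∷ β) (v ∷ vs)
    above-∷ β vs b v h hs zero    = h
    above-∷ β vs b v h hs (suc i) = hs i

    below-∷ : ∀ {m} {Γ : Vec κ m} β vs {c} b v → ¬ Sat C v (value (g c) (not b)) → Below Γ β vs → Below (c ∷ Γ) (b ∷ β) (v ∷ vs)
    below-∷ β vs b v h hs zero    = h
    below-∷ β vs b v h hs (suc i) = hs i

    true⇒sat : ∀ {m} {Γ : Vec κ m} β vs (θ : QBF κ Γ) → Above Γ β vs → True pol β θ → Sat C (concat vs) (translate θ)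
    true⇒sat {Γ = Γ} β vs (lit b i) hs refl = from (sat-rename C (lookup-concat vs i) (value (g (lookup Γ i)) b)) (hs i)
    true⇒sat β vs (θ ∧ χ) hs (t , t′) = true⇒sat β vs θ hs t , true⇒sat β vs χ hs t′
    true⇒sat β vs (θ ∨ χ) hs (inj₁ t) = inj₁ (true⇒sat β vs θ hs t)
    true⇒sat β vs (θ ∨ χ) hs (inj₂ t) = inj₂ (true⇒sat β vs χ hs t)
    true⇒sat {Γ = Γ} β vs (quant c θ) hs t =
      subst id (sym (sat-bind-block C (prefix (g c)) (translate θ))) (block (pol c) (sim c) t)
      where
      reply : ∀ b → True pol (b ∷ β) θ → ∀ v → Sat C v (value (g c) b) → Sat C (concat (v ∷ vs)) (translate θ)
      reply b t v h = true⇒sat (b ∷ β) (v ∷ vs) θ (above-∷ β vs b v h hs) t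
      block : ∀ q → Simulates q C (g c) → Over q (λ b → True pol (b ∷ β) θ) →
              Play (prefix (g c)) λ v → Sat C (concat (v ∷ vs)) (translate θ)
      block ∃′ (s , _) (b , t) = play-map (prefix (g c)) (reply b t) (s b)
      block ∀′ (s , _) t       = play-map (prefix (g c)) (λ v (b , h) → reply b (t b) v h) s

    sat⇒true : ∀ {m} {Γ : Vec κ m} β vs (θ : QBF κ Γ) → Below Γ β vs → Sat C (concat vs) (translate θ) → True pol β θ
    sat⇒true {Γ = Γ} β vs (lit b i) hs s = dne λ ne → hs i
      (subst (λ b → Sat C (lookup vs i) (value (g (lookup Γ i)) b)) (not-≢ (ne ∘ sym))
        (to (sat-rename C (lookup-concat vs i) (value (g (lookup Γ i)) b)) s))
    sat⇒true β vs (θ ∧ χ) hs (s , s′) = sat⇒true β vs θ hs s , sat⇒true β vs χ hs s′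
    sat⇒true β vs (θ ∨ χ) hs (inj₁ s) = inj₁ (sat⇒true β vs θ hs s)
    sat⇒true β vs (θ ∨ χ) hs (inj₂ s) = inj₂ (sat⇒true β vs χ hs s)
    sat⇒true {Γ = Γ} β vs (quant c θ) hs s =
      block (pol c) (sim c) (subst id (sat-bind-block C (prefix (g c)) (translate θ)) s)
      where
      reply : ∀ b v → ¬ Sat C v (value (g c) (not b)) → Sat C (concat (v ∷ vs)) (translate θ) → True pol (b ∷ β) θ
      reply b v h = sat⇒true (b ∷ β) (v ∷ vs) θ (below-∷ β vs b v h hs)
      block : ∀ q → Simulates q C (g c) → Play (prefix (g c)) (λ v → Sat C (concat (v ∷ vs)) (translate θ)) →
              Over q λ b → True pol (b ∷ β) θ
      -- Both literals cannot be secured together, so some play satisfies the formula while a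
      -- literal fails; the variable gets the value opposite to that literal.
      block ∃′ (_ , s) p with play-escape (prefix (g c)) p s
      ... | v , t , h with ¬∀⇒∃¬ h
      ... | true  , h = false , reply false v h t
      ... | false , h = true , reply true v h t
      -- The literal for `not b` cannot be secured alone, so some play satisfies the formula while
      -- it fails, which is what `Below` asks for the value `b`.
      block ∀′ (_ , s) p b with play-escape (prefix (g c)) p (s (not b))
      ... | v , t , h = reply b v h t

-- Codes of translated formulas

record Alphabet (κ : Set) : Set where
  field
    and or  : List Bool
    block   : κ → List Bool
    literal : κ → Bool → List (Maybe Bool)

open Alphabet

-- In a template, nothing stands for the offset in unary.

fill : ℕ → List (Maybe Bool) → List Bool
fill off = concatMap (maybe (_∷ []) (replicate off true))

fill-++ : ∀ off xs {ys} → fill off (xs ++ ys) ≡ fill off xs ++ fill off ys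
fill-++ off xs = List.concatMap-++ _ xs _

fill-just : ∀ off w → fill off (List.map just w) ≡ w
fill-just off []      = refl
fill-just off (b ∷ w) = cong (b ∷_) (fill-just off w)

code : ∀ {κ} → Alphabet κ → ℕ → ∀ {m} {Γ : Vec κ m} → QBF κ Γ → List Bool
code 𝒜 K {Γ = Γ} (lit b i) = fill (K * toℕ i) (literal 𝒜 (lookup Γ i) b)
code 𝒜 K (θ ∧ χ)     = and 𝒜 ++ code 𝒜 K θ ++ code 𝒜 K χ
code 𝒜 K (θ ∨ χ)     = or 𝒜 ++ code 𝒜 K θ ++ code 𝒜 K χ
code 𝒜 K (quant c θ) = block 𝒜 c ++ code 𝒜 K θ

dual-alphabet : ∀ {κ} → Alphabet κ → Alphabet κ
dual-alphabet 𝒜 = record { and = or 𝒜 ; or = and 𝒜 ; block = block 𝒜 ; literal = λ c → literal 𝒜 c ∘ not }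

-- Dualising keeps the blocks: the polarity, not the text, says how a kind is quantified. Hence a
-- generator that works for every alphabet prints the dual formula as well, given the swapped
-- alphabet.
code-dual : ∀ {κ} (𝒜 : Alphabet κ) K {m} {Γ : Vec κ m} (θ : QBF κ Γ) → code 𝒜 K (dual θ) ≡ code (dual-alphabet 𝒜) K θ
code-dual 𝒜 K (lit b i)   = refl
code-dual 𝒜 K (θ ∧ χ)     = cong (or 𝒜 ++_) (cong₂ _++_ (code-dual 𝒜 K θ) (code-dual 𝒜 K χ))
code-dual 𝒜 K (θ ∨ χ)     = cong (and 𝒜 ++_) (cong₂ _++_ (code-dual 𝒜 K θ) (code-dual 𝒜 K χ))
code-dual 𝒜 K (quant c θ) = cong (block 𝒜 c ++_) (code-dual 𝒜 K θ)

-- Under e local binders, variable x of a gadget is printed as x if x < e and as x plus the offset otherwise.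

shift : ℕ → ℕ → ℕ → ℕ
shift off zero    x       = off + x
shift off (suc e) zero    = zero
shift off (suc e) (suc x) = suc (shift off e x)

variable-template : ℕ → ℕ → List (Maybe Bool)
variable-template zero    x       = nothing ∷ List.map just (unary x)
variable-template (suc e) zero    = just false ∷ []
variable-template (suc e) (suc x) = just true ∷ variable-template e x

unary-+ : ∀ m n → unary (m + n) ≡ replicate m true ++ unary n
unary-+ zero    n = refl
unary-+ (suc m) n = cong (true ∷_) (unary-+ m n)

fill-variable : ∀ off e x → fill off (variable-template e x) ≡ unary (shift off e x)
fill-variable off zero    x       = trans (cong (replicate off true ++_) (fill-just off (unary x))) (sym (unary-+ off x))
fill-variable off (suc e) zero    = refl
fill-variable off (suc e) (suc x) = cong (true ∷_) (fill-variable off e x)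

quantifier-code : Quantifier → List Bool
quantifier-code ∀′ = true ∷ true ∷ false ∷ []
quantifier-code ∃′ = true ∷ true ∷ true ∷ []

block-code : ∀ {k} → Vec Quantifier k → List Bool
block-code []       = []
block-code (q ∷ qs) = block-code qs ++ quantifier-code q

and-code or-code : List Bool
and-code = true ∷ false ∷ false ∷ []
or-code  = true ∷ false ∷ true ∷ []

module _ {σ : Signature} where

  template : ∀ {n} → ℕ → Formula σ n → List (Maybe Bool)
  template e (atom R xs) = List.map just (false ∷ unary (toℕ R)) ++ concatMap (variable-template e ∘ toℕ) (toList xs)
  template e (φ ∧ ψ)     = List.map just and-code ++ template e φ ++ template e ψ
  template e (φ ∨ ψ)     = List.map just or-code ++ template e φ ++ template e ψ
  template e (quant q φ) = List.map just (quantifier-code q) ++ template (suc e) φ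

  shift-lift : ∀ {m n off e} {f : Fin m → Fin n} → (∀ i → toℕ (f i) ≡ shift off e (toℕ i)) →
               ∀ i → toℕ (lift f i) ≡ shift off (suc e) (toℕ i)
  shift-lift h zero    = refl
  shift-lift h (suc i) = cong suc (h i)

  encode-rename : ∀ {m n off e} {f : Fin m → Fin n} → (∀ i → toℕ (f i) ≡ shift off e (toℕ i)) →
                  ∀ φ → encode (rename f φ) ≡ fill off (template e φ)
  encode-rename {off = off} {e} {f} h (atom R xs) = sym
    (trans (fill-++ off (List.map just (false ∷ unary (toℕ R))))
      (cong₂ _++_ (fill-just off (false ∷ unary (toℕ R))) (variables xs)))
    where
    variables : ∀ {k} (xs : Vec _ k) → fill off (concatMap (variable-template e ∘ toℕ) (toList xs)) ≡
                concatMap (unary ∘ toℕ) (toList (Vec.map f xs))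
    variables []       = refl
    variables (x ∷ xs) = trans (fill-++ off (variable-template e (toℕ x)))
      (cong₂ _++_ (trans (fill-variable off e (toℕ x)) (cong unary (sym (h x)))) (variables xs))
  encode-rename {off = off} h (φ ∧ ψ) = cong (and-code ++_)
    (trans (cong₂ _++_ (encode-rename h φ) (encode-rename h ψ)) (sym (fill-++ off (template _ φ))))
  encode-rename {off = off} h (φ ∨ ψ) = cong (or-code ++_)
    (trans (cong₂ _++_ (encode-rename h φ) (encode-rename h ψ)) (sym (fill-++ off (template _ φ))))
  encode-rename h (quant ∀′ φ) = cong (quantifier-code ∀′ ++_) (encode-rename (shift-lift h) φ)
  encode-rename h (quant ∃′ φ) = cong (quantifier-code ∃′ ++_) (encode-rename (shift-lift h) φ)

  encode-quant : ∀ {n} q (φ : Formula σ (suc n)) → encode (quant q φ) ≡ quantifier-code q ++ encode φ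
  encode-quant ∀′ φ = refl
  encode-quant ∃′ φ = refl

  encode-bind-block : ∀ {k n} (qs : Vec Quantifier k) (φ : Formula σ (k + n)) →
                      encode (bind-block qs φ) ≡ block-code qs ++ encode φ
  encode-bind-block []       φ = refl
  encode-bind-block (q ∷ qs) φ = trans (encode-bind-block qs (quant q φ))
    (trans (cong (block-code qs ++_) (encode-quant q φ)) (sym (List.++-assoc (block-code qs) (quantifier-code q) (encode φ))))

  gadget-alphabet : ∀ {K κ} → (κ → Gadget σ K) → Alphabet κ
  gadget-alphabet g = record
    { and     = and-code
    ; or      = or-code
    ; block   = λ c → block-code (prefix (g c))
    ; literal = λ c b → template 0 (value (g c) b)
    }

  module _ {K : ℕ} {κ : Set} (g : κ → Gadget σ K) where

    open Translation g

    encode-translate : ∀ {m} {Γ : Vec κ m} (θ : QBF κ Γ) → encode (translate θ) ≡ code (gadget-alphabet g) K θ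
    encode-translate {Γ = Γ} (lit b i) = encode-rename (Fin.toℕ-combine i) (value (g (lookup Γ i)) b)
    encode-translate (θ ∧ χ) = cong (and-code ++_) (cong₂ _++_ (encode-translate θ) (encode-translate χ))
    encode-translate (θ ∨ χ) = cong (or-code ++_) (cong₂ _++_ (encode-translate θ) (encode-translate χ))
    encode-translate (quant c θ) = trans (encode-bind-block (prefix (g c)) (translate θ))
      (cong (block-code (prefix (g c)) ++_) (encode-translate θ))

-- Dummy quantifiers give the gadgets for both kinds of quantifiers the same length.

module _ {σ : Signature} {k : ℕ} (p : ℕ) (qs : Vec Quantifier k) (φ₁ φ₂ : Formula σ k) where

  choose : Bool → Formula σ k
  choose true  = φ₁
  choose false = φ₂

  padded : Gadget σ (k + p)
  padded = record { prefix = qs ++ᵛ Vec.replicate p ∀′ ; value = rename (_↑ˡ p) ∘ choose }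

  module _ (C : Structure σ) where

    play-padded : ∀ {P : Vec (Domain C) (k + p) → Set} {Q : Vec (Domain C) k → Set} → (∀ v w → P (v ++ᵛ w) ⇔ Q v) →
                  Play (qs ++ᵛ Vec.replicate p ∀′) P ⇔ Play qs Q
    play-padded {P} {Q} h = mk⇔
      (λ s → to (play-const (point C) ps) (play-map ps (λ w → play-map qs (λ v → to (h v w))) (subst id (play-++ qs ps P) s)))
      (λ s → subst id (sym (play-++ qs ps P)) (play-map ps (λ w → play-map qs (λ v → from (h v w))) (from (play-const (point C) ps) s)))
      where
      ps : Vec Quantifier p
      ps = Vec.replicate p ∀′

    value-padded : ∀ b v w → Sat C (v ++ᵛ w) (value padded b) ⇔ Sat C v (choose b)
    value-padded b v w = sat-rename C (Vec.lookup-++ˡ v w) (choose b)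

    close-padded : ∀ b → Play (prefix padded) (λ v → Sat C v (value padded b)) ⇔ C ⊨ close qs (choose b)
    close-padded b = mk⇔
      (λ s → subst id (sym (sat-close C qs (choose b))) (to (play-padded (value-padded b)) s))
      (λ s → from (play-padded (value-padded b)) (subst id (sat-close C qs (choose b)) s))

    breaks∧⇒simulates : Breaks∧ qs φ₁ φ₂ C → Simulates ∃′ C padded
    breaks∧⇒simulates (¬both , s₁ , s₂) =
      (λ { true → from (close-padded true) s₁ ; false → from (close-padded false) s₂ }) ,
      λ s → ¬both (subst id (sym (sat-close C qs (φ₁ ∧ φ₂))) (to (play-padded both) s))
      where
      both : ∀ v w → (∀ b → Sat C (v ++ᵛ w) (value padded b)) ⇔ Sat C v (φ₁ ∧ φ₂)
      both v w = mk⇔ (λ s → to (value-padded true v w) (s true) , to (value-padded false v w) (s false))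
        (λ (s₁ , s₂) → λ { true → from (value-padded true v w) s₁ ; false → from (value-padded false v w) s₂ })

    breaks∨⇒simulates : Breaks∨ qs φ₁ φ₂ C → Simulates ∀′ C padded
    breaks∨⇒simulates (s , ¬s₁ , ¬s₂) =
      from (play-padded some) (subst id (sat-close C qs (φ₁ ∨ φ₂)) s) ,
      λ { true → ¬s₁ ∘ to (close-padded true) ; false → ¬s₂ ∘ to (close-padded false) }
      where
      some : ∀ v w → (∃[ b ] Sat C (v ++ᵛ w) (value padded b)) ⇔ Sat C v (φ₁ ∨ φ₂)
      some v w = mk⇔ (λ { (true , s) → inj₁ (to (value-padded true v w) s) ; (false , s) → inj₂ (to (value-padded false v w) s) })
        (λ { (inj₁ s) → true , from (value-padded true v w) s ; (inj₂ s) → false , from (value-padded false v w) s })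

-- Building blocks of formulas and their truth conditions

repeat : ℕ → List Bool → List Bool
repeat zero    w = []
repeat (suc n) w = w ++ repeat n w

repeat-+ : ∀ m n w → repeat (m + n) w ≡ repeat m w ++ repeat n w
repeat-+ zero    n w = refl
repeat-+ (suc m) n w = trans (cong (w ++_) (repeat-+ m n w)) (sym (List.++-assoc w (repeat m w) (repeat n w)))

repeat-* : ∀ m n w → repeat (m * n) w ≡ repeat m (repeat n w)
repeat-* zero    n w = refl
repeat-* (suc m) n w = trans (repeat-+ n (m * n) w) (cong (repeat n w ++_) (repeat-* m n w))

repeat-true : ∀ n → repeat n (true ∷ []) ≡ replicate n true
repeat-true zero    = refl
repeat-true (suc n) = cong (true ∷_) (repeat-true n)

loop-repeat : ∀ w xs → loop (λ _ _ → w) xs ≡ repeat (length xs) w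
loop-repeat w []       = refl
loop-repeat w (b ∷ bs) = cong (w ++_) (loop-repeat w bs)

module _ {κ : Set} where

  -- `QBF` has no truth constants; a tautology and a contradiction in the variable bound last take
  -- their place.
  constant : ∀ {m} {Γ : Vec κ (suc m)} → Bool → QBF κ Γ
  constant true  = lit true zero ∨ lit false zero
  constant false = lit true zero ∧ lit false zero

  -- A full decision tree, of size exponential in `n`. It is applied only to headers, columns and
  -- option bits, whose lengths depend on the machine and not on its input.
  decide : ∀ {m} {Γ : Vec κ m} n → (Fin n → Fin m) → (Vec Bool n → QBF κ Γ) → QBF κ Γ
  decide zero    f θ = θ []
  decide (suc n) f θ = (lit true (f zero) ∧ decide n (f ∘ suc) (θ ∘ (true ∷_))) ∨
                       (lit false (f zero) ∧ decide n (f ∘ suc) (θ ∘ (false ∷_)))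

  -- The indices descend because a loop knows the rest of its list, and the length of that rest
  -- serves as the index.
  conjunction : ∀ {m} {Γ : Vec κ m} → ℕ → (ℕ → QBF κ Γ) → QBF κ Γ → QBF κ Γ
  conjunction zero    θ χ = χ
  conjunction (suc n) θ χ = θ n ∧ conjunction n θ χ

  bit-conjunction : ∀ {m} {Γ : Vec κ m} → List Bool → (Bool → ℕ → QBF κ Γ) → QBF κ Γ → QBF κ Γ
  bit-conjunction []       θ χ = χ
  bit-conjunction (b ∷ bs) θ χ = θ b (length bs) ∧ bit-conjunction bs θ χ

  quantify : ∀ n c {m} {Γ : Vec κ m} → QBF κ (Vec.replicate n c ++ᵛ Γ) → QBF κ Γ
  quantify zero    c θ = θ
  quantify (suc n) c θ = quantify n c (quant c θ)

  module _ (pol : κ → Quantifier) where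

    true-constant : ∀ {m} {Γ : Vec κ (suc m)} {β} b → True pol β (constant {Γ = Γ} b) ⇔ b ≡ true
    true-constant {β = true ∷ β}  true  = mk⇔ (λ _ → refl) (λ _ → inj₁ refl)
    true-constant {β = false ∷ β} true  = mk⇔ (λ _ → refl) (λ _ → inj₂ refl)
    true-constant {β = b ∷ β}     false = mk⇔ (λ { (refl , ()) }) λ ()

    true-decide : ∀ {m} {Γ : Vec κ m} {β} n f (θ : Vec Bool n → QBF κ Γ) →
                  True pol β (decide n f θ) ⇔ True pol β (θ (tabulate (lookup β ∘ f)))
    true-decide         zero    f θ = mk⇔ id id
    true-decide {β = β} (suc n) f θ with lookup β (f zero)
    ... | true  = mk⇔ (λ { (inj₁ (_ , t)) → to (true-decide n _ _) t ; (inj₂ (() , _)) })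
                      (λ t → inj₁ (refl , from (true-decide n _ _) t))
    ... | false = mk⇔ (λ { (inj₂ (_ , t)) → to (true-decide n _ _) t ; (inj₁ (() , _)) })
                      (λ t → inj₂ (refl , from (true-decide n _ _) t))

    true-conjunction : ∀ {m} {Γ : Vec κ m} {β} n θ (χ : QBF κ Γ) →
                       True pol β (conjunction n θ χ) ⇔ ((∀ {r} → r < n → True pol β (θ r)) × True pol β χ)
    true-conjunction zero    θ χ = mk⇔ (λ t → (λ ()) , t) proj₂
    true-conjunction {β = β} (suc n) θ χ = mk⇔
      (λ (t , u) → let hs , v = to (true-conjunction n θ χ) u in (λ r<1+n → cases t hs (m≤n⇒m<n∨m≡n (s≤s⁻¹ r<1+n))) , v)
      (λ (hs , v) → hs ≤-refl , from (true-conjunction n θ χ) ((λ r<n → hs (m≤n⇒m≤1+n r<n)) , v))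
      where
      cases : True pol β (θ n) → (∀ {r} → r < n → True pol β (θ r)) → ∀ {r} → r < n ⊎ r ≡ n → True pol β (θ r)
      cases t hs (inj₁ r<n)  = hs r<n
      cases t hs (inj₂ refl) = t

    true-bit-conjunction : ∀ {m} {Γ : Vec κ m} {β} bs θ (χ : QBF κ Γ) → True pol β (bit-conjunction bs θ χ) ⇔
      ((∀ pre {b suf} → bs ≡ pre ++ b ∷ suf → True pol β (θ b (length suf))) × True pol β χ)
    true-bit-conjunction []       θ χ = mk⇔ (λ t → (λ { [] () ; (_ ∷ _) () }) , t) proj₂
    true-bit-conjunction (b ∷ bs) θ χ = mk⇔
      (λ (t , u) → let hs , v = to (true-bit-conjunction bs θ χ) u
                   in (λ { [] refl → t ; (_ ∷ pre) eq → hs pre (List.∷-injectiveʳ eq) }) , v)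
      (λ (hs , v) → hs [] refl , from (true-bit-conjunction bs θ χ) ((λ pre eq → hs (b ∷ pre) (cong (b ∷_) eq)) , v))

    true-quantify-∃ : ∀ n {c} → pol c ≡ ∃′ → ∀ {m} {Γ : Vec κ m} {β} (θ : QBF κ (Vec.replicate n c ++ᵛ Γ)) →
                      True pol β (quantify n c θ) ⇔ (∃[ bs ] True pol (bs ++ᵛ β) θ)
    true-quantify-∃ zero    eq θ = mk⇔ ([] ,_) λ { ([] , t) → t }
    true-quantify-∃ (suc n) {c} eq {β = β} θ = mk⇔
      (λ t → let bs , u = to (true-quantify-∃ n eq (quant c θ)) t
                 b , v = subst (λ q → Over q λ b → True pol (b ∷ bs ++ᵛ β) θ) eq u
             in b ∷ bs , v)
      (λ { (b ∷ bs , v) → from (true-quantify-∃ n eq (quant c θ))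
             (bs , subst (λ q → Over q λ b → True pol (b ∷ bs ++ᵛ β) θ) (sym eq) (b , v)) })

    -- The alternative `n ≡ 0` admits polarities without a universal kind: in the game for NP no
    -- option bits are bound.
    true-quantify-∀ : ∀ n {c} → n ≡ 0 ⊎ pol c ≡ ∀′ → ∀ {m} {Γ : Vec κ m} {β} (θ : QBF κ (Vec.replicate n c ++ᵛ Γ)) →
                      True pol β (quantify n c θ) ⇔ (∀ bs → True pol (bs ++ᵛ β) θ)
    true-quantify-∀ zero    eq θ = mk⇔ (λ { t [] → t }) (λ t → t [])
    true-quantify-∀ (suc n) {c} (inj₂ eq) {β = β} θ = mk⇔
      (λ { t (b ∷ bs) → subst (λ q → Over q λ b → True pol (b ∷ bs ++ᵛ β) θ) eq (to (true-quantify-∀ n (inj₂ eq) (quant c θ)) t bs) b })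
      (λ t → from (true-quantify-∀ n (inj₂ eq) (quant c θ)) λ bs →
             subst (λ q → Over q λ b → True pol (b ∷ bs ++ᵛ β) θ) (sym eq) λ b → t (b ∷ bs))

-- Printing the building blocks

module Printing {κ : Set} (𝒜 : Alphabet κ) (K D : ℕ) where

  -- (c , vs) denotes c + D * (the total length of the variables in vs).

  Index : ℕ → Set
  Index k = ℕ × List (Fin k)

  total : ∀ {k} → Env k → List (Fin k) → ℕ
  total ρ vs = sum (List.map (length ∘ lookup ρ) vs)

  value-of : ∀ {k} → Env k → Index k → ℕ
  value-of ρ (c , vs) = c + D * total ρ vs

  total-++ : ∀ {k} (ρ : Env k) us vs → total ρ (us ++ vs) ≡ total ρ us + total ρ vs
  total-++ ρ []       vs = refl
  total-++ ρ (u ∷ us) vs = trans (cong (length (lookup ρ u) +_) (total-++ ρ us vs)) (sym (+-assoc (length (lookup ρ u)) _ _))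

  record Prints {k} (ρ : Env k) (G : Gen k) {m} {Γ : Vec κ m} (θ : QBF κ Γ) : Set where
    constructor prints
    field printed≡code : printed G ρ ≡ code 𝒜 K θ

  open Prints public

  print-variables : ∀ {k} → List (Fin k) → Gen k
  print-variables []       = put []
  print-variables (v ∷ vs) = for v (λ _ → put (repeat (K * D) (true ∷ []))) ⨾ print-variables vs

  printed-variables : ∀ {k} (ρ : Env k) vs → printed (print-variables vs) ρ ≡ repeat (total ρ vs * (K * D)) (true ∷ [])
  printed-variables ρ []       = refl
  printed-variables ρ (v ∷ vs) = begin
    loop (λ _ _ → w) (lookup ρ v) ++ printed (print-variables vs) ρ
      ≡⟨ cong₂ _++_ (trans (loop-repeat w (lookup ρ v)) (sym (repeat-* n (K * D) one))) (printed-variables ρ vs) ⟩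
    repeat (n * (K * D)) one ++ repeat (total ρ vs * (K * D)) one
      ≡⟨ sym (repeat-+ (n * (K * D)) _ one) ⟩
    repeat (n * (K * D) + total ρ vs * (K * D)) one
      ≡⟨ cong (λ m → repeat m one) (sym (*-distribʳ-+ (K * D) n (total ρ vs))) ⟩
    repeat ((n + total ρ vs) * (K * D)) one
      ∎
    where
    open ≡-Reasoning
    one w : List Bool
    one = true ∷ []
    w = repeat (K * D) one
    n : ℕ
    n = length (lookup ρ v)

  print-index : ∀ {k} → Index k → Gen k
  print-index (c , vs) = put (repeat (K * c) (true ∷ [])) ⨾ print-variables vs

  printed-index : ∀ {k} (ρ : Env k) ix → printed (print-index ix) ρ ≡ replicate (K * value-of ρ ix) true
  printed-index ρ (c , vs) = begin
    repeat (K * c) (true ∷ []) ++ printed (print-variables vs) ρ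
      ≡⟨ cong (repeat (K * c) (true ∷ []) ++_) (printed-variables ρ vs) ⟩
    repeat (K * c) (true ∷ []) ++ repeat (total ρ vs * (K * D)) (true ∷ [])
      ≡⟨ sym (repeat-+ (K * c) _ _) ⟩
    repeat (K * c + total ρ vs * (K * D)) (true ∷ [])
      ≡⟨ repeat-true _ ⟩
    replicate (K * c + total ρ vs * (K * D)) true
      ≡⟨ cong (λ n → replicate n true) (arithmetic K c (total ρ vs) D) ⟩
    replicate (K * (c + D * total ρ vs)) true
      ∎
    where
    open ≡-Reasoning
    arithmetic : ∀ K c t D → K * c + t * (K * D) ≡ K * (c + D * t)
    arithmetic = solve-∀

  print-template : ∀ {k} → Index k → List (Maybe Bool) → Gen k
  print-template ix []            = put []
  print-template ix (nothing ∷ t) = print-index ix ⨾ print-template ix t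
  print-template ix (just b ∷ t)  = put (b ∷ []) ⨾ print-template ix t

  printed-template : ∀ {k} (ρ : Env k) ix t → printed (print-template ix t) ρ ≡ fill (K * value-of ρ ix) t
  printed-template ρ ix []            = refl
  printed-template ρ ix (nothing ∷ t) = cong₂ _++_ (printed-index ρ ix) (printed-template ρ ix t)
  printed-template ρ ix (just b ∷ t)  = cong (b ∷_) (printed-template ρ ix t)

  print-∧ print-∨ : ∀ {k} → Gen k → Gen k → Gen k
  print-∧ G H = put (and 𝒜) ⨾ (G ⨾ H)
  print-∨ G H = put (or 𝒜) ⨾ (G ⨾ H)

  prints-∧ : ∀ {k} {ρ : Env k} {G H m} {Γ : Vec κ m} {θ χ : QBF κ Γ} →
             Prints ρ G θ → Prints ρ H χ → Prints ρ (print-∧ G H) (θ ∧ χ)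
  prints-∧ (prints g) (prints h) = prints (cong (and 𝒜 ++_) (cong₂ _++_ g h))

  prints-∨ : ∀ {k} {ρ : Env k} {G H m} {Γ : Vec κ m} {θ χ : QBF κ Γ} →
             Prints ρ G θ → Prints ρ H χ → Prints ρ (print-∨ G H) (θ ∨ χ)
  prints-∨ (prints g) (prints h) = prints (cong (or 𝒜 ++_) (cong₂ _++_ g h))

  print-literal : ∀ {k} → κ → Index k → Bool → Gen k
  print-literal c ix b = print-template ix (literal 𝒜 c b)

  Denotes : ∀ {k} → Env k → ∀ {m} → Vec κ m → κ → Index k → Fin m → Set
  Denotes ρ Γ c ix i = lookup Γ i ≡ c × toℕ i ≡ value-of ρ ix

  prints-literal : ∀ {k} (ρ : Env k) {m} (Γ : Vec κ m) {c ix i} b → Denotes ρ Γ c ix i →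
                   Prints ρ (print-literal c ix b) {Γ = Γ} (lit b i)
  prints-literal ρ Γ {ix = ix} {i} b (refl , eq) = prints (trans (printed-template ρ ix (literal 𝒜 (lookup Γ i) b))
    (cong (λ n → fill (K * n) (literal 𝒜 (lookup Γ i) b)) (sym eq)))

  print-constant : ∀ {k} → κ → Bool → Gen k
  print-constant c true  = print-∨ (print-literal c (0 , []) true) (print-literal c (0 , []) false)
  print-constant c false = print-∧ (print-literal c (0 , []) true) (print-literal c (0 , []) false)

  prints-constant : ∀ {k} (ρ : Env k) {m} (Γ : Vec κ m) {c} b → Prints ρ (print-constant c b) (constant {Γ = c ∷ Γ} b)
  prints-constant ρ Γ {c} b = cases b
    where
    first : Denotes ρ (c ∷ Γ) c (0 , []) zero
    first = refl , sym (*-zeroʳ D)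
    cases : ∀ b → Prints ρ (print-constant c b) (constant {Γ = c ∷ Γ} b)
    cases true  = prints-∨ (prints-literal ρ _ true first) (prints-literal ρ _ false first)
    cases false = prints-∧ (prints-literal ρ _ true first) (prints-literal ρ _ false first)

  print-decide : ∀ {k} n → κ → (Fin n → Index k) → (Vec Bool n → Gen k) → Gen k
  print-decide zero    c ix G = G []
  print-decide (suc n) c ix G =
    print-∨ (print-∧ (print-literal c (ix zero) true) (print-decide n c (ix ∘ suc) (G ∘ (true ∷_))))
            (print-∧ (print-literal c (ix zero) false) (print-decide n c (ix ∘ suc) (G ∘ (false ∷_))))

  prints-decide : ∀ {k} (ρ : Env k) {m} {Γ : Vec κ m} n {c} {ix : Fin n → Index k} {f G} {θ : Vec Bool n → QBF κ Γ} →
                  (∀ d → Denotes ρ Γ c (ix d) (f d)) → (∀ v → Prints ρ (G v) (θ v)) →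
                  Prints ρ (print-decide n c ix G) (decide n f θ)
  prints-decide ρ zero    den h = h []
  prints-decide ρ {Γ = Γ} (suc n) {c} {ix} {f} {G} {θ} den h =
    prints-∨ (branch true) (branch false)
    where
    branch : ∀ b → Prints ρ (print-∧ (print-literal c (ix zero) b) (print-decide n c (ix ∘ suc) (G ∘ (b ∷_))))
                            (lit b (f zero) ∧ decide n (f ∘ suc) (θ ∘ (b ∷_)))
    branch b = prints-∧
      (prints-literal ρ Γ b (den zero)) (prints-decide ρ n (den ∘ suc) (h ∘ (b ∷_)))

  -- In Polish notation a right-nested conjunction is a plain sequence of pieces, each a connective
  -- followed by a conjunct, with the innermost formula at the end. So a loop without memory can
  -- print it.
  print-bit-conjunction : ∀ {k} → Fin k → (Bool → Gen (suc k)) → Gen k → Gen k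
  print-bit-conjunction v G H = for v (λ b → put (and 𝒜) ⨾ G b) ⨾ H

  prints-bit-conjunction : ∀ {k} {ρ : Env k} v {G H m} {Γ : Vec κ m} {θ : Bool → ℕ → QBF κ Γ} {χ : QBF κ Γ} →
    (∀ b bs → length bs < length (lookup ρ v) → Prints (bs ∷ ρ) (G b) (θ b (length bs))) → Prints ρ H χ →
    Prints ρ (print-bit-conjunction v G H) (bit-conjunction (lookup ρ v) θ χ)
  prints-bit-conjunction {ρ = ρ} v {G} {H} {θ = θ} {χ} hs h = prints (go (lookup ρ v) hs)
    where
    go : ∀ xs → (∀ b bs → length bs < length xs → Prints (bs ∷ ρ) (G b) (θ b (length bs))) →
         loop (λ b bs → and 𝒜 ++ printed (G b) (bs ∷ ρ)) xs ++ printed H ρ ≡ code 𝒜 K (bit-conjunction xs θ χ)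
    go []       hs = printed≡code h
    go (b ∷ bs) hs = begin
      ((and 𝒜 ++ printed (G b) (bs ∷ ρ)) ++ loop _ bs) ++ printed H ρ
        ≡⟨ List.++-assoc (and 𝒜 ++ printed (G b) (bs ∷ ρ)) _ _ ⟩
      (and 𝒜 ++ printed (G b) (bs ∷ ρ)) ++ (loop _ bs ++ printed H ρ)
        ≡⟨ List.++-assoc (and 𝒜) _ _ ⟩
      and 𝒜 ++ printed (G b) (bs ∷ ρ) ++ loop _ bs ++ printed H ρ
        ≡⟨ cong (and 𝒜 ++_) (cong₂ _++_ (printed≡code (hs b bs ≤-refl)) (go bs λ b′ bs′ lt → hs b′ bs′ (m≤n⇒m≤1+n lt))) ⟩
      code 𝒜 K (θ b (length bs) ∧ bit-conjunction bs θ χ)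
        ∎
      where open ≡-Reasoning

  bit-conjunction-constant : ∀ {m} {Γ : Vec κ m} xs (θ : ℕ → QBF κ Γ) χ →
    bit-conjunction xs (λ _ → θ) χ ≡ conjunction (length xs) θ χ
  bit-conjunction-constant []       θ χ = refl
  bit-conjunction-constant (b ∷ bs) θ χ = cong (θ (length bs) ∧_) (bit-conjunction-constant bs θ χ)

  print-conjunction : ∀ {k} → Fin k → Gen (suc k) → Gen k → Gen k
  print-conjunction v G H = print-bit-conjunction v (λ _ → G) H

  prints-conjunction : ∀ {k} {ρ : Env k} v {n} → length (lookup ρ v) ≡ n →
    ∀ {G H m} {Γ : Vec κ m} {θ : ℕ → QBF κ Γ} {χ : QBF κ Γ} →
    (∀ bs → length bs < n → Prints (bs ∷ ρ) G (θ (length bs))) → Prints ρ H χ →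
    Prints ρ (print-conjunction v G H) (conjunction n θ χ)
  prints-conjunction {ρ = ρ} v refl {θ = θ} {χ} hs h = prints (trans
    (printed≡code (prints-bit-conjunction v (λ _ → hs) h)) (cong (code 𝒜 K) (bit-conjunction-constant (lookup ρ v) θ χ)))

  code-quantify : ∀ n c {m} {Γ : Vec κ m} (θ : QBF κ (Vec.replicate n c ++ᵛ Γ)) →
                  code 𝒜 K (quantify n c θ) ≡ repeat n (block 𝒜 c) ++ code 𝒜 K θ
  code-quantify zero    c θ = refl
  code-quantify (suc n) c θ = trans (code-quantify n c (quant c θ))
    (trans (sym (List.++-assoc (repeat n w) w _)) (cong (_++ code 𝒜 K θ) (repeat-snoc n)))
    where
    w : List Bool
    w = block 𝒜 c
    repeat-snoc : ∀ n → repeat n w ++ w ≡ w ++ repeat n w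
    repeat-snoc zero    = sym (List.++-identityʳ w)
    repeat-snoc (suc n) = trans (List.++-assoc w (repeat n w) w) (cong (w ++_) (repeat-snoc n))

-- Tilings

-- The local view of a row: its header, visible from everywhere, and two of its columns.
Window : ℕ → ℕ → Set
Window h D = Vec Bool h × Vec Bool D × Vec Bool D

-- The constraint on the columns r and r + 1 of a row is labelled false, the one on its first
-- and last column true.

record Tiling (h a D : ℕ) : Set₁ where
  field
    start : Maybe Bool → Vec Bool h → Vec Bool D → Set
    link  : Bool → Vec Bool a → (old new : Window h D) → Set
    final : Bool → Window h D → Set

Row : ℕ → ℕ → ℕ → Set
Row h D M = Vec Bool h × Vec (Vec Bool D) (suc M)

column : ∀ {h D M} → Row h D M → ℕ → Vec Bool D
column w c = lookup (proj₂ w) (clamp c)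

window : ∀ {h D M} → Row h D M → ℕ → ℕ → Window h D
window w i j = proj₁ w , column w i , column w j

module Game {h a D} (𝒯 : Tiling h a D) where

  open Tiling 𝒯

  Finished : ∀ {M} → Row h D M → Set
  Finished {M} w = (∀ {r} → r < M → final false (window w r (suc r))) × final true (window w 0 M)

  Linked : ∀ {M} → Vec Bool a → Row h D M → Row h D M → Set
  Linked {M} bs w w′ = (∀ {r} → r < M → link false bs (window w r (suc r)) (window w′ r (suc r))) ×
                       link true bs (window w 0 M) (window w′ 0 M)

  -- xs is the reversal of the input, since the generator sees the input as a stack.

  Started : ∀ {M} → List Bool → ℕ → Row h D M → Set
  Started {M} xs P w = (∀ pre {b suf} → xs ≡ pre ++ b ∷ suf → start (just b) (proj₁ w) (column w (length suf))) ×
                       (∀ {j} → j < P → start nothing (proj₁ w) (column w (length xs + j))) ×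
                       start nothing (proj₁ w) (column w M)

  Win : ∀ {M} → ℕ → Row h D M → Set
  Win zero    w = Finished w
  Win (suc t) w = ∀ bs → ∃[ w′ ] Linked bs w w′ × Win t w′

  Winning : ℕ → List Bool → ℕ → ℕ → Set
  Winning M xs P t = ∃[ w ] Started {M} xs P w × Win t w

-- The formula of a tiling game

module Formulas (em : ExcludedMiddle 0ℓ) {κ : Set} (e α : κ) {h a D} (𝒯 : Tiling (suc h) a D) (M : ℕ) where

  open Tiling 𝒯
  open Game 𝒯

  cells : ℕ
  cells = suc h + suc M * D

  rowᶜ : ∀ {m} → Vec κ m → Vec κ (cells + m)
  rowᶜ Γ = Vec.replicate cells e ++ᵛ Γ

  optionᶜ : ∀ {m} → Vec κ m → Vec κ (a + m)
  optionᶜ Γ = Vec.replicate a α ++ᵛ Γ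

  -- The constraints of a tiling are arbitrary propositions. Once `decide` has fixed the bits of the
  -- windows, only finitely many remain, and excluded middle replaces each by a constant. The
  -- variable needed by `constant` exists because headers have length `suc h`.
  test : ∀ {m} {Γ : Vec κ (suc m)} → Set → QBF κ Γ
  test X = constant (does (em {X}))

  module _ {m} {Γ : Vec κ m} (f : Fin cells → Fin m) where

    decide-header : (Vec Bool (suc h) → QBF κ Γ) → QBF κ Γ
    decide-header = decide (suc h) (λ d → f (d ↑ˡ (suc M * D)))

    decide-column : ℕ → (Vec Bool D → QBF κ Γ) → QBF κ Γ
    decide-column c = decide D (λ d → f (suc h ↑ʳ combine (clamp {M} c) d))

    decide-window : ℕ → ℕ → (Window (suc h) D → QBF κ Γ) → QBF κ Γ
    decide-window i j θ = decide-header λ hd → decide-column i λ c → decide-column j λ c′ → θ (hd , c , c′)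

  this : ∀ {m} → Fin cells → Fin (cells + m)
  this {m} i = i ↑ˡ m

  previous : ∀ {m} → Fin cells → Fin (cells + (a + (cells + m)))
  previous {m} i = cells ↑ʳ (a ↑ʳ (i ↑ˡ m))

  option : ∀ {m} → Fin a → Fin (cells + (a + m))
  option {m} d = cells ↑ʳ (d ↑ˡ m)

  module _ {m} {Γ : Vec κ m} where

    final-tile : Bool → ℕ → ℕ → QBF κ (rowᶜ Γ)
    final-tile b i j = decide-window this i j λ x → test (final b x)

    link-tile : Bool → ℕ → ℕ → QBF κ (rowᶜ (optionᶜ (rowᶜ Γ)))
    link-tile b i j = decide a option λ bs → decide-window previous i j λ old → decide-window this i j λ new →
      test (link b bs old new)

    start-tile : Maybe Bool → ℕ → QBF κ (rowᶜ Γ)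
    start-tile s c = decide-header this λ hd → decide-column this c λ x → test (start s hd x)

    finalᶠ : QBF κ (rowᶜ Γ)
    finalᶠ = conjunction M (λ r → final-tile false r (suc r)) (final-tile true 0 M)

    linkᶠ : QBF κ (rowᶜ (optionᶜ (rowᶜ Γ)))
    linkᶠ = conjunction M (λ r → link-tile false r (suc r)) (link-tile true 0 M)

    -- In the reductions `M` is `n + P`, so the loop reaches the columns from `n` to just before
    -- `M`; the extra formula treats column `M` and also ends the conjunction.
    paddingᶠ : ℕ → ℕ → QBF κ (rowᶜ Γ)
    paddingᶠ n P = conjunction P (λ j → start-tile nothing (n + j)) (start-tile nothing M)

    startᶠ : List Bool → ℕ → QBF κ (rowᶜ Γ)
    startᶠ xs P = bit-conjunction xs (λ b c → start-tile (just b) c) (paddingᶠ (length xs) P)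

  winᶠ : ∀ {m} {Γ : Vec κ m} → ℕ → QBF κ (rowᶜ Γ)
  winᶠ zero    = finalᶠ
  winᶠ (suc t) = quantify a α (quantify cells e (linkᶠ ∧ winᶠ t))

  winningᶠ : List Bool → ℕ → ℕ → QBF κ []
  winningᶠ xs P t = quantify cells e (startᶠ xs P ∧ winᶠ t)

  bits : Row (suc h) D M → Vec Bool cells
  bits (hd , cs) = hd ++ᵛ concat cs

  module _ (pol : κ → Quantifier) (pol-e : pol e ≡ ∃′) (pol-α : a ≡ 0 ⊎ pol α ≡ ∀′) where

    true-test : ∀ {m} {Γ : Vec κ (suc m)} {β X} → True pol β (test {Γ = Γ} X) ⇔ X
    true-test {Γ = Γ} {β} {X} = mk⇔ (λ t → decided em (to (true-constant pol {Γ = Γ} {β} (does (em {X}))) t))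
                        (λ x → from (true-constant pol {Γ = Γ} {β} (does (em {X}))) (holds em x))
      where
      decided : (d : Dec X) → does d ≡ true → X
      decided (yes x) _ = x
      holds : (d : Dec X) → X → does d ≡ true
      holds (yes _) _ = refl
      holds (no ¬x) x = ⊥-elim (¬x x)

    Shows : ∀ {m} → Vec Bool m → (Fin cells → Fin m) → Row (suc h) D M → Set
    Shows β f w = ∀ i → lookup β (f i) ≡ lookup (bits w) i

    module _ {m} {Γ : Vec κ m} (β : Vec Bool m) (f : Fin cells → Fin m) w (shows : Shows β f w) where

      header-shown : tabulate (λ d → lookup β (f (d ↑ˡ (suc M * D)))) ≡ proj₁ w
      header-shown = trans (Vec.tabulate-cong λ d → trans (shows _) (Vec.lookup-++ˡ (proj₁ w) (concat (proj₂ w)) d))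
                           (Vec.tabulate∘lookup (proj₁ w))

      column-shown : ∀ c → tabulate (λ d → lookup β (f (suc h ↑ʳ combine (clamp {M} c) d))) ≡ column w c
      column-shown c = trans (Vec.tabulate-cong λ d → trans (shows _)
          (trans (Vec.lookup-++ʳ (proj₁ w) (concat (proj₂ w)) (combine (clamp {M} c) d)) (lookup-concat (proj₂ w) (clamp c) d)))
        (Vec.tabulate∘lookup (column w c))

      true-header : ∀ (θ : Vec Bool (suc h) → QBF κ Γ) → True pol β (decide-header f θ) ⇔ True pol β (θ (proj₁ w))
      true-header θ = subst (λ v → True pol β (decide-header f θ) ⇔ True pol β (θ v)) header-shown
        (true-decide pol (suc h) (λ d → f (d ↑ˡ (suc M * D))) θ)

      true-column : ∀ c (θ : Vec Bool D → QBF κ Γ) → True pol β (decide-column f c θ) ⇔ True pol β (θ (column w c))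
      true-column c θ = subst (λ v → True pol β (decide-column f c θ) ⇔ True pol β (θ v)) (column-shown c)
        (true-decide pol D (λ d → f (suc h ↑ʳ combine (clamp {M} c) d)) θ)

      true-window : ∀ i j (θ : Window (suc h) D → QBF κ Γ) →
                    True pol β (decide-window f i j θ) ⇔ True pol β (θ (window w i j))
      true-window i j θ = ⇔-trans (true-header λ hd → decide-column f i λ c → decide-column f j λ c′ → θ (hd , c , c′))
        (⇔-trans (true-column i λ c → decide-column f j λ c′ → θ (proj₁ w , c , c′)) (true-column j λ c′ → θ (proj₁ w , column w i , c′)))

    shows-this : ∀ {m} w (β : Vec Bool m) → Shows (bits w ++ᵛ β) this w
    shows-this w β i = Vec.lookup-++ˡ (bits w) β i

    shows-previous : ∀ {m} w (bs : Vec Bool a) w′ (β : Vec Bool m) → Shows (bits w′ ++ᵛ (bs ++ᵛ (bits w ++ᵛ β))) previous w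
    shows-previous w bs w′ β i = trans (Vec.lookup-++ʳ (bits w′) _ _) (trans (Vec.lookup-++ʳ bs _ _) (Vec.lookup-++ˡ (bits w) β i))

    option-shown : ∀ {m} (bs : Vec Bool a) w′ (β : Vec Bool m) → tabulate (lookup (bits w′ ++ᵛ (bs ++ᵛ β)) ∘ option) ≡ bs
    option-shown bs w′ β = trans (Vec.tabulate-cong λ d → trans (Vec.lookup-++ʳ (bits w′) _ _) (Vec.lookup-++ˡ bs β d)) (Vec.tabulate∘lookup bs)

    module _ {m} {Γ : Vec κ m} {β : Vec Bool m} where

      true-final-tile : ∀ w b i j → True pol (bits w ++ᵛ β) (final-tile {Γ = Γ} b i j) ⇔ final b (window w i j)
      true-final-tile w b i j = ⇔-trans (true-window (bits w ++ᵛ β) this w (shows-this w β) i j λ x → test (final b x))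
                                        (true-test {β = bits w ++ᵛ β})

      true-start-tile : ∀ w s c → True pol (bits w ++ᵛ β) (start-tile {Γ = Γ} s c) ⇔ start s (proj₁ w) (column w c)
      true-start-tile w s c = ⇔-trans
        (true-header (bits w ++ᵛ β) this w (shows-this w β) λ hd → decide-column this c λ x → test (start s hd x))
        (⇔-trans (true-column (bits w ++ᵛ β) this w (shows-this w β) c λ x → test (start s (proj₁ w) x)) (true-test {β = bits w ++ᵛ β}))

      true-link-tile : ∀ w bs w′ b i j → True pol (bits w′ ++ᵛ (bs ++ᵛ (bits w ++ᵛ β))) (link-tile {Γ = Γ} b i j) ⇔
                       link b bs (window w i j) (window w′ i j)
      true-link-tile w bs w′ b i j = ⇔-trans
        (subst (λ v → True pol β′ (link-tile b i j) ⇔ True pol β′ (θ v)) (option-shown bs w′ (bits w ++ᵛ β)) (true-decide pol a option θ))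
        (⇔-trans (true-window β′ previous w (shows-previous w bs w′ β) i j λ old → decide-window this i j λ new → test (link b bs old new))
        (⇔-trans (true-window β′ this w′ (shows-this w′ (bs ++ᵛ (bits w ++ᵛ β))) i j λ new → test (link b bs (window w i j) new))
        (true-test {β = β′})))
        where
        β′ : Vec Bool (cells + (a + (cells + m)))
        β′ = bits w′ ++ᵛ (bs ++ᵛ (bits w ++ᵛ β))
        θ : Vec Bool a → QBF κ (rowᶜ (optionᶜ (rowᶜ Γ)))
        θ bs = decide-window previous i j λ old → decide-window this i j λ new → test (link b bs old new)

      true-finalᶠ : ∀ w → True pol (bits w ++ᵛ β) (finalᶠ {Γ = Γ}) ⇔ Finished w
      true-finalᶠ w = ⇔-trans (true-conjunction pol M (λ r → final-tile false r (suc r)) (final-tile true 0 M))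
        (mk⇔ (λ (hs , t) → (λ {r} r<M → to (true-final-tile w false r (suc r)) (hs r<M)) , to (true-final-tile w true 0 M) t)
             (λ (hs , t) → (λ {r} r<M → from (true-final-tile w false r (suc r)) (hs r<M)) , from (true-final-tile w true 0 M) t))

      true-linkᶠ : ∀ w bs w′ → True pol (bits w′ ++ᵛ (bs ++ᵛ (bits w ++ᵛ β))) (linkᶠ {Γ = Γ}) ⇔ Linked bs w w′
      true-linkᶠ w bs w′ = ⇔-trans (true-conjunction pol M (λ r → link-tile false r (suc r)) (link-tile true 0 M))
        (mk⇔ (λ (hs , t) → (λ {r} r<M → to (true-link-tile w bs w′ false r (suc r)) (hs r<M)) , to (true-link-tile w bs w′ true 0 M) t)
             (λ (hs , t) → (λ {r} r<M → from (true-link-tile w bs w′ false r (suc r)) (hs r<M)) , from (true-link-tile w bs w′ true 0 M) t))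

      true-startᶠ : ∀ w xs P → True pol (bits w ++ᵛ β) (startᶠ {Γ = Γ} xs P) ⇔ Started xs P w
      true-startᶠ w xs P = ⇔-trans (true-bit-conjunction pol xs (λ b c → start-tile (just b) c) (paddingᶠ n P))
        (mk⇔ (λ (hs , t) → let ks , u = to padding t in
                (λ pre {b} {suf} eq → to (true-start-tile w (just b) (length suf)) (hs pre eq)) ,
                (λ {j} j<P → to (true-start-tile w nothing (n + j)) (ks j<P)) , to (true-start-tile w nothing M) u)
             (λ (hs , ks , u) → (λ pre {b} {suf} eq → from (true-start-tile w (just b) (length suf)) (hs pre eq)) ,
                from padding ((λ {j} j<P → from (true-start-tile w nothing (n + j)) (ks j<P)) ,
                              from (true-start-tile w nothing M) u)))
        where
        n : ℕ
        n = length xs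
        padding : True pol (bits w ++ᵛ β) (paddingᶠ {Γ = Γ} n P) ⇔
                  ((∀ {j} → j < P → True pol (bits w ++ᵛ β) (start-tile {Γ = Γ} nothing (n + j))) ×
                   True pol (bits w ++ᵛ β) (start-tile {Γ = Γ} nothing M))
        padding = true-conjunction pol P (λ j → start-tile nothing (n + j)) (start-tile nothing M)

    rows-cover : (v : Vec Bool cells) → ∃[ w ] v ≡ bits w
    rows-cover v = let hd , rest , eq = Vec.splitAt (suc h) v
                       cs , eq′ = Vec.group (suc M) D rest
                   in (hd , cs) , trans eq (cong (hd ++ᵛ_) eq′)

    true-row : ∀ {m} {Γ : Vec κ m} {β} (θ : QBF κ (rowᶜ Γ)) {Q : Row (suc h) D M → Set} →
               (∀ w → True pol (bits w ++ᵛ β) θ ⇔ Q w) → True pol β (quantify cells e θ) ⇔ ∃ Q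
    true-row θ {Q} h = ⇔-trans (true-quantify-∃ pol cells pol-e θ)
      (mk⇔ (λ (v , t) → let w , eq = rows-cover v in w , to (h w) (subst (λ v → True pol (v ++ᵛ _) θ) eq t))
           (λ (w , q) → bits w , from (h w) q))

    true-winᶠ : ∀ {m} {Γ : Vec κ m} {β : Vec Bool m} t w → True pol (bits w ++ᵛ β) (winᶠ {Γ = Γ} t) ⇔ Win t w
    true-winᶠ         zero    w = true-finalᶠ w
    true-winᶠ {β = β} (suc t) w = ⇔-trans (true-quantify-∀ pol a pol-α (quantify cells e (linkᶠ ∧ winᶠ t)))
      (mk⇔ (λ t bs → to (round bs) (t bs)) (λ t bs → from (round bs) (t bs)))
      where
      round : ∀ bs → True pol (bs ++ᵛ (bits w ++ᵛ β)) (quantify cells e (linkᶠ ∧ winᶠ t)) ⇔ (∃[ w′ ] Linked bs w w′ × Win t w′)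
      round bs = true-row (linkᶠ ∧ winᶠ t) λ w′ → mk⇔
        (Product.map (to (true-linkᶠ w bs w′)) (to (true-winᶠ t w′)))
        (Product.map (from (true-linkᶠ w bs w′)) (from (true-winᶠ t w′)))

    true-winningᶠ : ∀ xs P t → True pol [] (winningᶠ xs P t) ⇔ Winning M xs P t
    true-winningᶠ xs P t = true-row (startᶠ xs P ∧ winᶠ t) λ w → mk⇔
      (Product.map (to (true-startᶠ w xs P)) (to (true-winᶠ t w)))
      (Product.map (from (true-startᶠ w xs P)) (from (true-winᶠ t w)))

-- The generator of the formula

print-polynomial : ∀ {k} → Polynomial → Fin k → Gen k
print-polynomial []       v = put []
print-polynomial (a ∷ as) v = put (replicate a true) ⨾ for v (λ _ → print-polynomial as (suc v))

length-loop-constant : ∀ {f c} xs → (∀ b bs → length (f b bs) ≡ c) → length (loop f xs) ≡ length xs * c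
length-loop-constant         []       h = refl
length-loop-constant {f} (b ∷ bs) h = trans (List.length-++ (f b bs)) (cong₂ _+_ (h b bs) (length-loop-constant bs h))

-- Horner's rule in unary: the loop prints the value of the remaining coefficients once per letter
-- of the argument.
length-polynomial : ∀ {k} p v (ρ : Env k) → length (printed (print-polynomial p v) ρ) ≡ ⟦ p ⟧ (length (lookup ρ v))
length-polynomial []       v ρ = refl
length-polynomial (a ∷ as) v ρ = trans (List.length-++ (replicate a true))
  (cong₂ _+_ (List.length-replicate a) (length-loop-constant (lookup ρ v) λ b bs → length-polynomial as (suc v) (bs ∷ ρ)))

module Generator (em : ExcludedMiddle 0ℓ) {κ : Set} (e α : κ) {h a D} (𝒯 : Tiling (suc h) a D) (𝒜 : Alphabet κ) (K : ℕ) where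

  open Printing 𝒜 K D
  open Tiling 𝒯

  Position : ℕ → Set
  Position k = ℕ × List (Fin k)

  position : ∀ {k} → Env k → Position k → ℕ
  position ρ (c , vs) = c + total ρ vs

  header-index : ∀ {k} → Index k → Fin (suc h) → Index k
  header-index (o , vs) d = o + toℕ d , vs

  -- The lengths in the offset of a row and those in a column number both enter with the factor `D`,
  -- so their lists of variables are simply concatenated.
  column-index : ∀ {k} → Index k → Position k → Fin D → Index k
  column-index (o , vs) (c , us) d = o + (suc h + (D * c + toℕ d)) , vs ++ us

  print-test : ∀ {k} → Set → Gen k
  print-test X = print-constant e (does (em {X}))

  print-header : ∀ {k} → Index k → (Vec Bool (suc h) → Gen k) → Gen k
  print-header o = print-decide (suc h) e (header-index o)

  print-column : ∀ {k} → Index k → Position k → (Vec Bool D → Gen k) → Gen k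
  print-column o i = print-decide D e (column-index o i)

  print-window : ∀ {k} → Index k → (i j : Position k) → (Window (suc h) D → Gen k) → Gen k
  print-window o i j G = print-header o λ hd → print-column o i λ c → print-column o j λ c′ → G (hd , c , c′)

  this-offset : ∀ {k} → Index k
  this-offset = 0 , []

  -- The current row is bound innermost and takes `suc h + D + D * M` variables, where `M` is the
  -- length of the list `m`. The option bits follow it, and the previous row comes after these `a`
  -- bits.
  option-index : ∀ {k} → Fin k → Fin a → Index k
  option-index m d = suc h + D + toℕ d , m ∷ []

  previous-offset : ∀ {k} → Fin k → Index k
  previous-offset m = suc h + D + a , m ∷ []

  print-final-tile : ∀ {k} → Bool → (i j : Position k) → Gen k
  print-final-tile b i j = print-window this-offset i j λ x → print-test (final b x)

  print-link-tile : ∀ {k} → Fin k → Bool → (i j : Position k) → Gen k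
  print-link-tile m b i j = print-decide a α (option-index m) λ bs → print-window (previous-offset m) i j λ old →
    print-window this-offset i j λ new → print-test (link b bs old new)

  print-start-tile : ∀ {k} → Maybe Bool → Position k → Gen k
  print-start-tile s i = print-header this-offset λ hd → print-column this-offset i λ x → print-test (start s hd x)

  print-final : ∀ {k} → Fin k → Gen k
  print-final m = print-conjunction m
    (print-final-tile false (0 , zero ∷ []) (1 , zero ∷ [])) (print-final-tile true (0 , []) (0 , m ∷ []))

  print-link : ∀ {k} → Fin k → Gen k
  print-link m = print-conjunction m
    (print-link-tile (suc m) false (0 , zero ∷ []) (1 , zero ∷ [])) (print-link-tile m true (0 , []) (0 , m ∷ []))

  print-start : ∀ {k} → (x p m : Fin k) → Gen k
  print-start x p m = print-bit-conjunction x (λ b → print-start-tile (just b) (0 , zero ∷ []))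
    (print-conjunction p (print-start-tile nothing (0 , suc x ∷ zero ∷ [])) (print-start-tile nothing (0 , m ∷ [])))

  print-row : ∀ {k} → Fin k → Gen k
  print-row m = put (repeat (suc h + D) (block 𝒜 e)) ⨾ for m (λ _ → put (repeat D (block 𝒜 e)))

  print-round : ∀ {k} → Fin k → Gen k
  print-round m = put (repeat a (block 𝒜 α)) ⨾ (print-row m ⨾ (put (and 𝒜) ⨾ print-link m))

  print-win : ∀ {k} → (t m : Fin k) → Gen k
  print-win t m = for t (λ _ → print-round (suc m)) ⨾ print-final m

  print-winning : ∀ {k} → (t m p x : Fin k) → Gen k
  print-winning t m p x = print-row m ⨾ print-∧ (print-start x p m) (print-win t m)

  module _ (M : ℕ) where

    open Formulas em e α 𝒯 M

    record RowAt {k} (ρ : Env k) (o : Index k) {m} (Γ : Vec κ m) (f : Fin cells → Fin m) : Set where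
      field
        kind   : ∀ i → lookup Γ (f i) ≡ e
        number : ∀ i → toℕ (f i) ≡ value-of ρ o + toℕ i

    open RowAt

    module _ {k} {ρ : Env k} {o : Index k} {m} {Γ : Vec κ m} {f : Fin cells → Fin m} (at : RowAt ρ o Γ f) where

      header-denoted : ∀ d → Denotes ρ Γ e (header-index o d) (f (d ↑ˡ (suc M * D)))
      header-denoted d = kind at _ , (begin
        toℕ (f (d ↑ˡ (suc M * D)))                       ≡⟨ number at _ ⟩
        value-of ρ o + toℕ (d ↑ˡ (suc M * D))            ≡⟨ cong (value-of ρ o +_) (Fin.toℕ-↑ˡ d _) ⟩
        proj₁ o + D * total ρ (proj₂ o) + toℕ d          ≡⟨ arithmetic (proj₁ o) (D * total ρ (proj₂ o)) (toℕ d) ⟩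
        proj₁ o + toℕ d + D * total ρ (proj₂ o)          ∎)
        where
        open ≡-Reasoning
        arithmetic : ∀ x y z → x + y + z ≡ x + z + y
        arithmetic = solve-∀

      column-denoted : ∀ {i c} → position ρ i ≡ c → c ≤ M → ∀ d →
                       Denotes ρ Γ e (column-index o i d) (f (suc h ↑ʳ combine (clamp {M} c) d))
      column-denoted {i} {c} refl c≤M d = kind at _ , (begin
        toℕ (f (suc h ↑ʳ combine (clamp {M} c) d))
          ≡⟨ number at _ ⟩
        value-of ρ o + toℕ (suc h ↑ʳ combine (clamp {M} c) d)
          ≡⟨ cong (value-of ρ o +_) (trans (Fin.toℕ-↑ʳ (suc h) (combine (clamp {M} c) d)) (cong (suc h +_) (Fin.toℕ-combine (clamp {M} c) d))) ⟩
        value-of ρ o + (suc h + (D * toℕ (clamp {M} c) + toℕ d))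
          ≡⟨ cong (λ n → value-of ρ o + (suc h + (D * n + toℕ d))) (toℕ-clamp c≤M) ⟩
        proj₁ o + D * total ρ (proj₂ o) + (suc h + (D * (proj₁ i + total ρ (proj₂ i)) + toℕ d))
          ≡⟨ arithmetic (proj₁ o) D (total ρ (proj₂ o)) (suc h) (proj₁ i) (total ρ (proj₂ i)) (toℕ d) ⟩
        proj₁ o + (suc h + (D * proj₁ i + toℕ d)) + D * (total ρ (proj₂ o) + total ρ (proj₂ i))
          ≡⟨ cong (λ n → proj₁ o + (suc h + (D * proj₁ i + toℕ d)) + D * n) (sym (total-++ ρ (proj₂ o) (proj₂ i))) ⟩
        value-of ρ (column-index o i d)
          ∎)
        where
        open ≡-Reasoning
        arithmetic : ∀ o D t s i u d → o + D * t + (s + (D * (i + u) + d)) ≡ o + (s + (D * i + d)) + D * (t + u)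
        arithmetic = solve-∀

      prints-header : ∀ {G} {θ : Vec Bool (suc h) → QBF κ Γ} → (∀ v → Prints ρ (G v) (θ v)) →
                      Prints ρ (print-header o G) (decide-header f θ)
      prints-header = prints-decide ρ (suc h) {ix = header-index o} header-denoted

      prints-column : ∀ {i c G} {θ : Vec Bool D → QBF κ Γ} → position ρ i ≡ c → c ≤ M → (∀ v → Prints ρ (G v) (θ v)) →
                      Prints ρ (print-column o i G) (decide-column f c θ)
      prints-column {i} eq c≤M = prints-decide ρ D {ix = column-index o i} (column-denoted {i} eq c≤M)

      prints-window : ∀ {i j c c′ G} {θ : Window (suc h) D → QBF κ Γ} →
                      position ρ i ≡ c → c ≤ M → position ρ j ≡ c′ → c′ ≤ M → (∀ x → Prints ρ (G x) (θ x)) →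
                      Prints ρ (print-window o i j G) (decide-window f c c′ θ)
      prints-window {i} {j} eq c≤M eq′ c′≤M hs =
        prints-header λ hd → prints-column {i} eq c≤M λ c → prints-column {j} eq′ c′≤M λ c′ → hs (hd , c , c′)

    lookup-block : ∀ n (c : κ) {m} (Γ : Vec κ m) i → lookup (Vec.replicate n c ++ᵛ Γ) (i ↑ˡ m) ≡ c
    lookup-block n c Γ i = trans (Vec.lookup-++ˡ (Vec.replicate n c) Γ i) (Vec.lookup-replicate i c)

    at-this : ∀ {k} (ρ : Env k) {m} (Γ : Vec κ m) → RowAt ρ this-offset (rowᶜ Γ) this
    at-this ρ Γ = record
      { kind   = lookup-block cells e Γ
      ; number = λ i → trans (Fin.toℕ-↑ˡ i _) (cong (_+ toℕ i) (sym (*-zeroʳ D)))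
      }

    module _ {k} {ρ : Env k} {v : Fin k} (width : length (lookup ρ v) ≡ M) where

      at-previous : ∀ {m} (Γ : Vec κ m) → RowAt ρ (previous-offset v) (rowᶜ (optionᶜ (rowᶜ Γ))) previous
      at-previous {m} Γ = record
        { kind   = λ i → trans (Vec.lookup-++ʳ (Vec.replicate cells e) (optionᶜ (rowᶜ Γ)) _)
                     (trans (Vec.lookup-++ʳ (Vec.replicate a α) (rowᶜ Γ) _) (lookup-block cells e Γ i))
        ; number = λ i → begin
            toℕ (previous i)
              ≡⟨ trans (Fin.toℕ-↑ʳ cells _) (cong (cells +_) (trans (Fin.toℕ-↑ʳ a _) (cong (a +_) (Fin.toℕ-↑ˡ i m)))) ⟩
            suc h + (D + M * D) + (a + toℕ i)
              ≡⟨ arithmetic (suc h) D M a (toℕ i) ⟩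
            suc h + D + a + D * (M + 0) + toℕ i
              ≡⟨ cong (λ n → suc h + D + a + D * (n + 0) + toℕ i) (sym width) ⟩
            value-of ρ (previous-offset v) + toℕ i
              ∎
        }
        where
        open ≡-Reasoning
        arithmetic : ∀ s D M a i → s + (D + M * D) + (a + i) ≡ s + D + a + D * (M + 0) + i
        arithmetic = solve-∀

      option-denoted : ∀ {m} (Γ : Vec κ m) d → Denotes ρ (rowᶜ (optionᶜ Γ)) α (option-index v d) (option d)
      option-denoted {m} Γ d = trans (Vec.lookup-++ʳ (Vec.replicate cells e) (optionᶜ Γ) _) (lookup-block a α Γ d) , (begin
        toℕ (option {m} d)                        ≡⟨ trans (Fin.toℕ-↑ʳ cells _) (cong (cells +_) (Fin.toℕ-↑ˡ d m)) ⟩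
        suc h + (D + M * D) + toℕ d               ≡⟨ arithmetic (suc h) D M (toℕ d) ⟩
        suc h + D + toℕ d + D * (M + 0)           ≡⟨ cong (λ n → suc h + D + toℕ d + D * (n + 0)) (sym width) ⟩
        value-of ρ (option-index v d)             ∎)
        where
        open ≡-Reasoning
        arithmetic : ∀ s D M d → s + (D + M * D) + d ≡ s + D + d + D * (M + 0)
        arithmetic = solve-∀

      prints-link-tile : ∀ {m} (Γ : Vec κ m) {b i j c c′} → position ρ i ≡ c → c ≤ M → position ρ j ≡ c′ → c′ ≤ M →
                         Prints ρ (print-link-tile v b i j) (link-tile {Γ = Γ} b c c′)
      prints-link-tile Γ {b} {i = i} {j} eq c≤M eq′ c′≤M = prints-decide ρ a {ix = option-index v} (option-denoted (rowᶜ Γ)) λ bs →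
        prints-window (at-previous Γ) {i} {j} eq c≤M eq′ c′≤M λ old →
        prints-window (at-this ρ (optionᶜ (rowᶜ Γ))) {i} {j} eq c≤M eq′ c′≤M λ new →
        prints-constant ρ _ (does (em {link b bs old new}))

    module _ {k} {ρ : Env k} {m} (Γ : Vec κ m) where

      prints-final-tile : ∀ {b i j c c′} → position ρ i ≡ c → c ≤ M → position ρ j ≡ c′ → c′ ≤ M →
                          Prints ρ (print-final-tile b i j) (final-tile {Γ = Γ} b c c′)
      prints-final-tile {b} {i = i} {j} eq c≤M eq′ c′≤M =
        prints-window (at-this ρ Γ) {i} {j} eq c≤M eq′ c′≤M λ x → prints-constant ρ _ (does (em {final b x}))

      prints-start-tile : ∀ {s i c} → position ρ i ≡ c → c ≤ M → Prints ρ (print-start-tile s i) (start-tile {Γ = Γ} s c)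
      prints-start-tile {s} {i = i} eq c≤M = prints-header (at-this ρ Γ) λ hd →
        prints-column (at-this ρ Γ) {i} eq c≤M λ x → prints-constant ρ _ (does (em {start s hd x}))

    module _ {k} {ρ : Env k} {v : Fin k} (width : length (lookup ρ v) ≡ M) where

      prints-final : ∀ {m} (Γ : Vec κ m) → Prints ρ (print-final v) (finalᶠ {Γ = Γ})
      prints-final Γ = prints-conjunction v width
        (λ bs bs<M → prints-final-tile {ρ = bs ∷ ρ} Γ {i = 0 , zero ∷ []} {1 , zero ∷ []}
          (+-identityʳ _) (<⇒≤ bs<M) (cong suc (+-identityʳ _)) bs<M)
        (prints-final-tile {ρ = ρ} Γ {i = 0 , []} {0 , v ∷ []} refl z≤n (trans (+-identityʳ _) width) ≤-refl)

      prints-link : ∀ {m} (Γ : Vec κ m) → Prints ρ (print-link v) (linkᶠ {Γ = Γ})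
      prints-link Γ = prints-conjunction v width
        (λ bs bs<M → prints-link-tile {ρ = bs ∷ ρ} {suc v} width Γ {i = 0 , zero ∷ []} {1 , zero ∷ []}
          (+-identityʳ _) (<⇒≤ bs<M) (cong suc (+-identityʳ _)) bs<M)
        (prints-link-tile {ρ = ρ} width Γ {i = 0 , []} {0 , v ∷ []} refl z≤n (trans (+-identityʳ _) width) ≤-refl)

      prints-start : ∀ x {p P m} (Γ : Vec κ m) → length (lookup ρ p) ≡ P → length (lookup ρ x) + P ≤ M →
                     Prints ρ (print-start x p v) (startᶠ {Γ = Γ} (lookup ρ x) P)
      prints-start x {p} {P} Γ eq bound = prints-bit-conjunction x
        (λ b bs bs<x → prints-start-tile {ρ = bs ∷ ρ} Γ {i = 0 , zero ∷ []}
          (+-identityʳ _) (≤-trans (<⇒≤ bs<x) (≤-trans (m≤m+n _ P) bound)))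
        (prints-conjunction p eq
          (λ bs bs<P → prints-start-tile {ρ = bs ∷ ρ} Γ {i = 0 , suc x ∷ zero ∷ []} (cong (length (lookup ρ x) +_) (+-identityʳ _))
            (≤-trans (+-monoʳ-≤ (length (lookup ρ x)) (<⇒≤ bs<P)) bound))
          (prints-start-tile {ρ = ρ} Γ {i = 0 , v ∷ []} (trans (+-identityʳ _) width) ≤-refl))

      printed-row : printed (print-row v) ρ ≡ repeat cells (block 𝒜 e)
      printed-row = begin
        repeat (suc h + D) w ++ loop (λ _ _ → repeat D w) (lookup ρ v)
          ≡⟨ cong (repeat (suc h + D) w ++_) (trans (loop-repeat _ (lookup ρ v)) (cong (λ n → repeat n (repeat D w)) width)) ⟩
        repeat (suc h + D) w ++ repeat M (repeat D w)
          ≡⟨ cong (repeat (suc h + D) w ++_) (sym (repeat-* M D w)) ⟩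
        repeat (suc h + D) w ++ repeat (M * D) w
          ≡⟨ sym (repeat-+ (suc h + D) (M * D) w) ⟩
        repeat (suc h + D + M * D) w
          ≡⟨ cong (λ n → repeat n w) (+-assoc (suc h) D (M * D)) ⟩
        repeat cells w
          ∎
        where
        open ≡-Reasoning
        w : List Bool
        w = block 𝒜 e

    prints-win : ∀ {k} {ρ : Env k} {v} t → length (lookup ρ v) ≡ M → ∀ {m} (Γ : Vec κ m) →
                 Prints ρ (print-win t v) (winᶠ {Γ = Γ} (length (lookup ρ t)))
    prints-win {k} {ρ} {v} t width Γ = prints (go (lookup ρ t) Γ)
      where
      open ≡-Reasoning
      round : List Bool → List Bool
      round bs = printed (print-round (suc v)) (bs ∷ ρ)
      -- `Γ` has to be general: every round extends it, while the text of a round does not depend on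
      -- it.
      go : ∀ xs {m} (Γ : Vec κ m) → loop (λ _ → round) xs ++ printed (print-final v) ρ ≡ code 𝒜 K (winᶠ {Γ = Γ} (length xs))
      go []       Γ = printed≡code (prints-final {ρ = ρ} {v} width Γ)
      go (b ∷ bs) Γ = begin
        ((w ++ row ++ and 𝒜 ++ printed (print-link (suc v)) (bs ∷ ρ)) ++ loop (λ _ → round) bs) ++ end
          ≡⟨ reassociate w row (and 𝒜) _ _ _ ⟩
        w ++ row ++ and 𝒜 ++ printed (print-link (suc v)) (bs ∷ ρ) ++ loop (λ _ → round) bs ++ end
          ≡⟨ cong (w ++_) (cong₂ _++_ (printed-row {ρ = bs ∷ ρ} {suc v} width)
               (cong (and 𝒜 ++_) (cong₂ _++_ (printed≡code (prints-link {ρ = bs ∷ ρ} {suc v} width Γ)) (go bs (optionᶜ (rowᶜ Γ)))))) ⟩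
        w ++ repeat cells (block 𝒜 e) ++ code 𝒜 K (linkᶠ {Γ = Γ} ∧ winᶠ (length bs))
          ≡⟨ cong (w ++_) (sym (code-quantify cells e (linkᶠ ∧ winᶠ (length bs)))) ⟩
        w ++ code 𝒜 K (quantify cells e (linkᶠ {Γ = Γ} ∧ winᶠ (length bs)))
          ≡⟨ sym (code-quantify a α (quantify cells e (linkᶠ ∧ winᶠ (length bs)))) ⟩
        code 𝒜 K (winᶠ {Γ = Γ} (suc (length bs)))
          ∎
        where
        w row end : List Bool
        w = repeat a (block 𝒜 α)
        row = printed (print-row (suc v)) (bs ∷ ρ)
        end = printed (print-final v) ρ
        reassociate : ∀ (p q r s t u : List Bool) → ((p ++ q ++ r ++ s) ++ t) ++ u ≡ p ++ q ++ r ++ s ++ t ++ u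
        reassociate p q r s t u = trans (List.++-assoc (p ++ q ++ r ++ s) t u) (trans (List.++-assoc p (q ++ r ++ s) (t ++ u))
          (cong (p ++_) (trans (List.++-assoc q (r ++ s) (t ++ u)) (cong (q ++_) (List.++-assoc r s (t ++ u))))))

    prints-winning : ∀ {k} {ρ : Env k} t {v p P} x → length (lookup ρ v) ≡ M → length (lookup ρ p) ≡ P →
                     length (lookup ρ x) + P ≤ M →
                     Prints ρ (print-winning t v p x) (winningᶠ (lookup ρ x) P (length (lookup ρ t)))
    prints-winning {ρ = ρ} t {v} {p} {P} x width eq bound = prints (trans
      (cong₂ _++_ (printed-row {ρ = ρ} {v} width) (printed≡code (prints-∧
        (prints-start {ρ = ρ} {v} width x {p} [] eq bound) (prints-win {ρ = ρ} {v} t width []))))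
      (sym (code-quantify cells e (startᶠ (lookup ρ x) P ∧ winᶠ (length (lookup ρ t))))))

  -- Loops need lists to run over, so lists of the lengths `P`, `M` and the number of rounds are
  -- printed to stacks before the formula itself.
  generator : (p q : Polynomial) → Gen 1
  generator p q =
    bind (print-polynomial p 0F)
    (bind (for 1F (λ _ → put (true ∷ [])) ⨾ for 0F (λ _ → put (true ∷ [])))
    (bind (print-polynomial q 2F)
    (print-winning 0F 1F 2F 3F)))

  generator-correct : ∀ p q xs → let n = length xs in let M = n + ⟦ p ⟧ n in
    printed (generator p q) (xs ∷ []) ≡ code 𝒜 K (Formulas.winningᶠ em e α 𝒯 M xs (⟦ p ⟧ n) (⟦ q ⟧ n))
  generator-correct p q xs = trans
    (printed≡code (prints-winning M {ρ = ts ∷ ms ∷ ps ∷ xs ∷ []} 0F {1F} {2F} {⟦ p ⟧ n} 3F ms≡ ps≡ ≤-refl))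
    (cong (λ t → code 𝒜 K (Formulas.winningᶠ em e α 𝒯 M xs (⟦ p ⟧ n) t)) ts≡)
    where
    n M : ℕ
    n = length xs
    M = n + ⟦ p ⟧ n
    ps ms ts : List Bool
    ps = reverse (printed (print-polynomial p 0F) (xs ∷ []))
    ms = reverse (loop (λ _ _ → true ∷ []) xs ++ loop (λ _ _ → true ∷ []) ps)
    ts = reverse (printed (print-polynomial q 2F) (ms ∷ ps ∷ xs ∷ []))
    ps≡ : length ps ≡ ⟦ p ⟧ n
    ps≡ = trans (List.length-reverse (printed (print-polynomial p 0F) (xs ∷ []))) (length-polynomial p 0F (xs ∷ []))
    ones : ∀ xs → length (loop (λ _ _ → true ∷ []) xs) ≡ length xs
    ones xs = trans (length-loop-constant xs λ _ _ → refl) (*-identityʳ _)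
    ms≡ : length ms ≡ M
    ms≡ = trans (List.length-reverse (loop (λ _ _ → true ∷ []) xs ++ loop (λ _ _ → true ∷ []) ps))
      (trans (List.length-++ (loop (λ _ _ → true ∷ []) xs)) (cong₂ _+_ (ones xs) (trans (ones ps) ps≡)))
    ts≡ : length ts ≡ ⟦ q ⟧ n
    ts≡ = trans (List.length-reverse (printed (print-polynomial q 2F) (ms ∷ ps ∷ xs ∷ []))) (length-polynomial q 2F (ms ∷ ps ∷ xs ∷ []))

take-++ : ∀ {A : Set} {m n} (xs : Vec A m) (ys : Vec A n) → Vec.take m (xs ++ᵛ ys) ≡ xs
take-++ []       ys = refl
take-++ (x ∷ xs) ys = cong (x ∷_) (take-++ xs ys)

drop-++ : ∀ {A : Set} {m n} (xs : Vec A m) (ys : Vec A n) → Vec.drop m (xs ++ᵛ ys) ≡ ys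
drop-++ []       ys = refl
drop-++ (x ∷ xs) ys = drop-++ xs ys

lookup-injective : ∀ {A : Set} {n} {xs ys : Vec A n} → (∀ i → lookup xs i ≡ lookup ys i) → xs ≡ ys
lookup-injective {xs = xs} {ys} h = trans (sym (Vec.tabulate∘lookup xs)) (trans (Vec.tabulate-cong h) (Vec.tabulate∘lookup ys))

-- Configurations as rows

-- Every bit vector is a code, so that formulas need not exclude junk.

record Coding (X : Set) : Set where
  field
    width      : ℕ
    read       : Vec Bool width → X
    write      : X → Vec Bool width
    read-write : ∀ x → read (write x) ≡ x

open Coding

coding-onto : ∀ {X Y} (f : X → Y) (g : Y → X) → (∀ y → f (g y) ≡ y) → Coding X → Coding Y
coding-onto f g f∘g c = record
  { read       = f ∘ read c
  ; write      = write c ∘ g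
  ; read-write = λ y → trans (cong f (read-write c (g y))) (f∘g y)
  }

-- A truncated unary code: the first `true` marks the element, and the word without any `true` is
-- the code of the last one. Hence every word can be read.
coding-Fin : ∀ n → Coding (Fin (suc n))
coding-Fin zero    = record { width = 0 ; read = λ _ → zero ; write = λ _ → [] ; read-write = λ { zero → refl } }
coding-Fin (suc n) = record { read = read′ ; write = write′ ; read-write = read-write′ }
  where
  c : Coding (Fin (suc n))
  c = coding-Fin n
  read′ : Vec Bool (suc (width c)) → Fin (suc (suc n))
  read′ (true ∷ v)  = zero
  read′ (false ∷ v) = suc (read c v)
  write′ : Fin (suc (suc n)) → Vec Bool (suc (width c))
  write′ zero    = true ∷ Vec.replicate _ true
  write′ (suc i) = false ∷ write c i
  read-write′ : ∀ i → read′ (write′ i) ≡ i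
  read-write′ zero    = refl
  read-write′ (suc i) = cong suc (read-write c i)

coding-× : ∀ {X Y} → Coding X → Coding Y → Coding (X × Y)
coding-× c d = record
  { width      = width c + width d
  ; read       = λ v → read c (Vec.take (width c) v) , read d (Vec.drop (width c) v)
  ; write      = λ (x , y) → write c x ++ᵛ write d y
  ; read-write = λ (x , y) → cong₂ _,_
      (trans (cong (read c) (take-++ (write c x) (write d y))) (read-write c x))
      (trans (cong (read d) (drop-++ (write c x) (write d y))) (read-write d y))
  }

coding-Vec : ∀ {X} → Coding X → ∀ n → Coding (Vec X n)
coding-Vec c zero    = record { width = 0 ; read = λ _ → [] ; write = λ _ → [] ; read-write = λ { [] → refl } }
coding-Vec c (suc n) = coding-onto (λ (x , xs) → x ∷ xs) (λ { (x ∷ xs) → x , xs }) (λ { (x ∷ xs) → refl }) (coding-× c (coding-Vec c n))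

-- The idle bit makes the width positive, so that a header always provides a variable for
-- `constant`.
coding-padded : ∀ {X} → Coding X → Coding X
coding-padded c = record { width = suc (width c) ; read = read c ∘ Vec.tail ; write = λ x → true ∷ write c x ; read-write = read-write c }

coding-Maybe : ∀ {X n} → X ↔ Fin n → Coding (Maybe X)
coding-Maybe f = coding-onto element index strictlyInverseʳ (coding-Fin _)
  where open Inverse (proj₂ (finite-Maybe (_ , f))) using (strictlyInverseʳ) renaming (to to index; from to element)

-- `X` may be empty, and an empty type has no coding in which every word is read; hence `Maybe X`.
-- Blank shares a tag with the auxiliary letters, and surplus pairs are read as bits.
coding-Symbol : ∀ {X n} → X ↔ Fin n → Coding (Symbol X)
coding-Symbol {X} f = coding-onto to′ from′ to∘from (coding-× (coding-Fin 2) (coding-Maybe f))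
  where
  to′ : Fin 3 × Maybe X → Symbol X
  to′ (0F , nothing) = blank
  to′ (0F , just x)  = aux x
  to′ (1F , _)       = bit false
  to′ (2F , _)       = bit true
  from′ : Symbol X → Fin 3 × Maybe X
  from′ blank       = 0F , nothing
  from′ (aux x)     = 0F , just x
  from′ (bit false) = 1F , nothing
  from′ (bit true)  = 2F , nothing
  to∘from : ∀ s → to′ (from′ s) ≡ s
  to∘from blank       = refl
  to∘from (aux x)     = refl
  to∘from (bit false) = refl
  to∘from (bit true)  = refl

coding-Move : Coding Move
coding-Move = coding-onto {Fin 3} (λ { 0F → left ; 1F → stay ; 2F → right }) (λ { left → 0F ; stay → 1F ; right → 2F })
  (λ { left → refl ; stay → refl ; right → refl }) (coding-Fin 2)

module _ {Aux : Set} where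

  private
    Cell : Set
    Cell = Symbol Aux × Symbol Aux

  nth : List (Symbol Aux) → ℕ → Symbol Aux
  nth []       r       = blank
  nth (s ∷ ss) zero    = s
  nth (s ∷ ss) (suc r) = nth ss r

  nth-beyond : ∀ ss {r} → length ss ≤ r → nth ss r ≡ blank
  nth-beyond []       h       = refl
  nth-beyond (s ∷ ss) (s≤s h) = nth-beyond ss h

  nth-length : ∀ (us : List (Symbol Aux)) {s vs} → nth (us ++ s ∷ vs) (length us) ≡ s
  nth-length []       = refl
  nth-length (u ∷ us) = nth-length us

  -- The two cells at distance r + 1 from the head.

  cell : Tape (Symbol Aux) → ℕ → Cell
  cell t r = nth (before t) r , nth (after t) r

  -- x, y become x′, y′, and c is the letter under the head afterwards.  Cells beyond the last
  -- column are taken to be blank.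

  tape-tile : Bool → Symbol Aux × Move → Symbol Aux → (x y x′ y′ : Cell) → Set
  tape-tile false (s , left)  c x y x′ y′ = proj₁ x′ ≡ proj₁ y × proj₂ y′ ≡ proj₂ x
  tape-tile false (s , stay)  c x y x′ y′ = x′ ≡ x
  tape-tile false (s , right) c x y x′ y′ = proj₂ x′ ≡ proj₂ y × proj₁ y′ ≡ proj₁ x
  tape-tile true  (s , left)  c x y x′ y′ = c ≡ proj₁ x × proj₂ x′ ≡ s × proj₁ y′ ≡ blank
  tape-tile true  (s , stay)  c x y x′ y′ = c ≡ s × y′ ≡ y
  tape-tile true  (s , right) c x y x′ y′ = c ≡ proj₂ x × proj₁ x′ ≡ s × proj₂ y′ ≡ blank

  act-left : ∀ s t → let t′ = act (s , left) t in current t′ ≡ nth (before t) 0 × nth (after t′) 0 ≡ s ×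
             (∀ r → nth (before t′) r ≡ nth (before t) (suc r)) × (∀ r → nth (after t′) (suc r) ≡ nth (after t) r)
  act-left s ⟨ []    , c , rs ⟩ = refl , refl , (λ r → refl) , λ r → refl
  act-left s ⟨ _ ∷ _ , c , rs ⟩ = refl , refl , (λ r → refl) , λ r → refl

  act-right : ∀ s t → let t′ = act (s , right) t in current t′ ≡ nth (after t) 0 × nth (before t′) 0 ≡ s ×
              (∀ r → nth (after t′) r ≡ nth (after t) (suc r)) × (∀ r → nth (before t′) (suc r) ≡ nth (before t) r)
  act-right s ⟨ ls , c , []    ⟩ = refl , refl , (λ r → refl) , λ r → refl
  act-right s ⟨ ls , c , _ ∷ _ ⟩ = refl , refl , (λ r → refl) , λ r → refl

  module _ {M : ℕ} (t : Tape (Symbol Aux)) (x x′ : ℕ → Cell) {c : Symbol Aux} (now : ∀ {r} → r ≤ M → x r ≡ cell t r)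
           (edge : cell t (suc M) ≡ (blank , blank)) where

    private
      lowered : ∀ {f g h : ℕ → Symbol Aux} → (∀ {r} → r < M → f r ≡ g (suc r)) → f M ≡ g (suc M) → (∀ r → h r ≡ g (suc r)) →
                ∀ {r} → r ≤ M → f r ≡ h r
      lowered {f} {g} {h} inner end shift r≤M = cases (m≤n⇒m<n∨m≡n r≤M)
        where
        cases : ∀ {r} → r < M ⊎ r ≡ M → f r ≡ h r
        cases (inj₁ r<M)  = trans (inner r<M) (sym (shift _))
        cases (inj₂ refl) = trans end (sym (shift M))

      raised : ∀ {f g h : ℕ → Symbol Aux} → f 0 ≡ h 0 → (∀ {r} → r < M → f (suc r) ≡ g r) → (∀ r → h (suc r) ≡ g r) →
               ∀ {r} → r ≤ M → f r ≡ h r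
      raised zero≡ inner shift {zero}  _   = zero≡
      raised zero≡ inner shift {suc r} r<M = trans (inner r<M) (sym (shift r))

    -- A move brings one half of the tape nearer to the head and the other farther away. The inner
    -- tiles settle the first half below column `M` and the second above column 0. The end tile adds
    -- the letter written, in column 0, and the blank entering column `M`, which is right by `edge`.
    tape-sound : ∀ a → (∀ {r} → r < M → tape-tile false a c (x r) (x (suc r)) (x′ r) (x′ (suc r))) →
                 tape-tile true a c (x 0) (x M) (x′ 0) (x′ M) →
                 c ≡ current (act a t) × (∀ {r} → r ≤ M → x′ r ≡ cell (act a t) r)
    tape-sound (s , left) inner (c≡ , x′0 , x′M) =
      let cur , first , shiftˡ , shiftʳ = act-left s t in
      trans c≡ (trans (cong proj₁ (now z≤n)) (sym cur)) , λ r≤M → cong₂ _,_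
        (lowered {proj₁ ∘ x′} {nth (before t)} (λ r<M → trans (proj₁ (inner r<M)) (cong proj₁ (now r<M)))
          (trans x′M (sym (cong proj₁ edge))) shiftˡ r≤M)
        (raised {proj₂ ∘ x′} {h = nth (after (act (s , left) t))} (trans x′0 (sym first))
          (λ r<M → trans (proj₂ (inner r<M)) (cong proj₂ (now (<⇒≤ r<M)))) shiftʳ r≤M)
    tape-sound (s , stay) inner (c≡ , x′M) = c≡ , λ r≤M → same (m≤n⇒m<n∨m≡n r≤M)
      where
      same : ∀ {r} → r < M ⊎ r ≡ M → x′ r ≡ cell t r
      same (inj₁ r<M)  = trans (inner r<M) (now (<⇒≤ r<M))
      same (inj₂ refl) = trans x′M (now ≤-refl)
    tape-sound (s , right) inner (c≡ , x′0 , x′M) =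
      let cur , first , shiftʳ , shiftˡ = act-right s t in
      trans c≡ (trans (cong proj₂ (now z≤n)) (sym cur)) , λ r≤M → cong₂ _,_
        (raised {proj₁ ∘ x′} {h = nth (before (act (s , right) t))} (trans x′0 (sym first))
          (λ r<M → trans (proj₂ (inner r<M)) (cong proj₁ (now (<⇒≤ r<M)))) shiftˡ r≤M)
        (lowered {proj₂ ∘ x′} {nth (after t)} (λ r<M → trans (proj₁ (inner r<M)) (cong proj₂ (now r<M)))
          (trans x′M (sym (cong proj₂ edge))) shiftʳ r≤M)

    tape-complete : ∀ a → c ≡ current (act a t) → (∀ {r} → r ≤ M → x′ r ≡ cell (act a t) r) →
                    (∀ {r} → r < M → tape-tile false a c (x r) (x (suc r)) (x′ r) (x′ (suc r))) ×
                    tape-tile true a c (x 0) (x M) (x′ 0) (x′ M)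
    tape-complete (s , left) c≡ later =
      let cur , first , shiftˡ , shiftʳ = act-left s t in
      (λ {r} r<M → trans (cong proj₁ (later (<⇒≤ r<M))) (trans (shiftˡ r) (sym (cong proj₁ (now r<M)))) ,
                   trans (cong proj₂ (later r<M)) (trans (shiftʳ r) (sym (cong proj₂ (now (<⇒≤ r<M)))))) ,
      trans c≡ (trans cur (sym (cong proj₁ (now z≤n)))) , trans (cong proj₂ (later z≤n)) first ,
      trans (cong proj₁ (later ≤-refl)) (trans (shiftˡ M) (cong proj₁ edge))
    tape-complete (s , stay) c≡ later =
      (λ r<M → trans (later (<⇒≤ r<M)) (sym (now (<⇒≤ r<M)))) , c≡ , trans (later ≤-refl) (sym (now ≤-refl))
    tape-complete (s , right) c≡ later =
      let cur , first , shiftʳ , shiftˡ = act-right s t in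
      (λ {r} r<M → trans (cong proj₂ (later (<⇒≤ r<M))) (trans (shiftʳ r) (sym (cong proj₂ (now r<M)))) ,
                   trans (cong proj₁ (later r<M)) (trans (shiftˡ r) (sym (cong proj₁ (now (<⇒≤ r<M)))))) ,
      trans c≡ (trans cur (sym (cong proj₂ (now z≤n)))) , trans (cong proj₁ (later z≤n)) first ,
      trans (cong proj₂ (later ≤-refl)) (trans (shiftʳ M) (cong proj₂ edge))

row-of : ∀ {h D M} → Vec Bool h → (ℕ → Vec Bool D) → Row h D M
row-of hd f = hd , tabulate (f ∘ toℕ)

column-row-of : ∀ {h D M} {hd : Vec Bool h} (f : ℕ → Vec Bool D) {r} → r ≤ M → column {M = M} (row-of hd f) r ≡ f r
column-row-of f r≤M = trans (Vec.lookup∘tabulate (f ∘ toℕ) (clamp _)) (cong f (toℕ-clamp r≤M))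

module _ (𝓜 : Machine) where

  open Machine 𝓜

  Head : Set
  Head = (Maybe State × Vec (Symbol Aux × Move) (suc extra)) × Vec (Symbol Aux) (suc extra)

  Cells : Set
  Cells = Vec (Symbol Aux × Symbol Aux) (suc extra)

  head-coding-exists : Coding Head
  head-coding-exists = coding-×
    (coding-× (coding-Maybe (proj₂ state-finite)) (coding-Vec (coding-× (coding-Symbol (proj₂ aux-finite)) coding-Move) (suc extra)))
    (coding-Vec (coding-Symbol (proj₂ aux-finite)) (suc extra))

  cells-coding-exists : Coding Cells
  cells-coding-exists = coding-Vec (coding-× (coding-Symbol (proj₂ aux-finite)) (coding-Symbol (proj₂ aux-finite))) (suc extra)

-- Simulation of a machine by rows

module Simulation (𝓜 : Machine) (bare-head-coding : Coding (Head 𝓜)) (cells-coding : Coding (Cells 𝓜)) where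

  open Machine 𝓜

  τ : ℕ
  τ = suc extra

  Letter Action Extended : Set
  Letter   = Symbol Aux
  Action   = Maybe State × Vec (Letter × Move) τ
  Extended = Maybe State × Vec (Tape Letter) τ

  -- The state nothing precedes the initial one, with the head one cell to the left of the input,
  -- so that letter i of the input is in column i.  A halted machine idles.

  or-idle : State → Vec Letter τ → List (State × Vec (Letter × Move) τ) → List Action
  or-idle q ss []       = (just q , keep ss) ∷ []
  or-idle q ss (a ∷ as) = List.map (map₁ just) (a ∷ as)

  extended : Maybe State → Vec Letter τ → List Action
  extended nothing  ss = (just start , keep ss Vec.[ zero ]≔ (lookup ss zero , right)) ∷ []
  extended (just q) ss = or-idle q ss (δ q ss)

  Next : Extended → Extended → Set
  Next (q , ts) (q′ , ts′) = ∃[ as ] (q′ , as) ∈ extended q (Vec.map current ts) × ts′ ≡ Vec.zipWith act as ts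

  head-coding : Coding (Head 𝓜)
  head-coding = coding-padded bare-head-coding

  h D : ℕ
  h = width bare-head-coding
  D = width cells-coding

  state-of : Vec Bool (suc h) → Maybe State
  state-of hd = proj₁ (proj₁ (read head-coding hd))

  action-of : Vec Bool (suc h) → Vec (Letter × Move) τ
  action-of hd = proj₂ (proj₁ (read head-coding hd))

  letters-of : Vec Bool (suc h) → Vec Letter τ
  letters-of hd = proj₂ (read head-coding hd)

  cells-of : Vec Bool D → Cells 𝓜
  cells-of = read cells-coding

  -- The head of a row records the action that led to it, so that all tiles use the same action.

  step-tile : Bool → (old new : Window (suc h) D) → Set
  step-tile b (hd , x , y) (hd′ , x′ , y′) =
    (state-of hd′ , action-of hd′) ∈ extended (state-of hd) (letters-of hd) ×
    (∀ k → tape-tile b (lookup (action-of hd′) k) (lookup (letters-of hd′) k)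
             (lookup (cells-of x) k) (lookup (cells-of y) k) (lookup (cells-of x′) k) (lookup (cells-of y′) k))

  AcceptingHead : Vec Bool (suc h) → Set
  AcceptingHead hd = ∃[ q ] state-of hd ≡ just q × T (accepting q) × δ q (letters-of hd) ≡ []

  tiling : Tiling (suc h) 0 D
  tiling = record
    { start = λ s hd x → (state-of hd ≡ nothing × letters-of hd ≡ Vec.replicate τ blank) ×
                         cells-of x ≡ (blank , maybe bit blank s) ∷ Vec.replicate extra (blank , blank)
    ; link  = λ b _ → step-tile b
    ; final = λ _ (hd , _) → AcceptingHead hd
    }

  open Game tiling

  -- The action stored in the header is left open, since it tells how the configuration was reached
  -- and not what it is.
  record Represents {M} (w : Row (suc h) D M) (c : Extended) : Set where
    field
      state≡   : state-of (proj₁ w) ≡ proj₁ c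
      letters≡ : letters-of (proj₁ w) ≡ Vec.map current (proj₂ c)
      cells≡   : ∀ {r} → r ≤ M → ∀ k → lookup (cells-of (column w r)) k ≡ cell (lookup (proj₂ c) k) r

  open Represents

  -- A step shifts a tape by at most one column, so the cells just beyond the last column are the
  -- only ones that could enter unseen.
  Fits : ℕ → Extended → Set
  Fits M c = ∀ k → cell (lookup (proj₂ c) k) (suc M) ≡ (blank , blank)

  Stepped : ∀ {M} → Row (suc h) D M → Row (suc h) D M → Set
  Stepped = Linked []

  module _ {M : ℕ} (as : Vec (Letter × Move) τ) (c : Extended) where

    private
      cells-at : ℕ → Cells 𝓜
      cells-at r = tabulate (λ k → cell (lookup (proj₂ c) k) r)

    row-for : Row (suc h) D M
    row-for = row-of (write head-coding ((proj₁ c , as) , Vec.map current (proj₂ c))) (λ r → write cells-coding (cells-at r))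

    head-row-for : read head-coding (proj₁ row-for) ≡ ((proj₁ c , as) , Vec.map current (proj₂ c))
    head-row-for = read-write head-coding _

    represents-row-for : Represents row-for c
    represents-row-for = record
      { state≡   = cong (proj₁ ∘ proj₁) head-row-for
      ; letters≡ = cong proj₂ head-row-for
      ; cells≡   = λ {r} r≤M k → trans (cong (λ v → lookup (cells-of v) k) 
          (column-row-of {hd = proj₁ row-for} (λ r → write cells-coding (cells-at r)) r≤M))
          (trans (cong (λ v → lookup v k) (read-write cells-coding (cells-at r)))
                 (Vec.lookup∘tabulate (λ k → cell (lookup (proj₂ c) k) r) k))
      }

  module _ {M : ℕ} {w : Row (suc h) D M} {c} (rep : Represents w c) where

    step-sound : Fits M c → ∀ {w′} → Stepped w w′ → ∃[ c′ ] Next c c′ × Represents w′ c′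
    step-sound fits {w′} (inner , ends) = _ , (action-of (proj₁ w′) , allowed , refl) , record
      { state≡   = refl
      ; letters≡ = lookup-injective λ k → trans (proj₁ (moved k))
          (sym (trans (Vec.lookup-map k current ts′) (cong current (Vec.lookup-zipWith act k (action-of (proj₁ w′)) ts))))
      ; cells≡   = λ {r} r≤M k → trans (proj₂ (moved k) r≤M)
          (cong (λ t → cell t r) (sym (Vec.lookup-zipWith act k (action-of (proj₁ w′)) ts)))
      }
      where
      ts ts′ : Vec (Tape Letter) τ
      ts = proj₂ c
      ts′ = Vec.zipWith act (action-of (proj₁ w′)) ts
      allowed : (state-of (proj₁ w′) , action-of (proj₁ w′)) ∈ extended (proj₁ c) (Vec.map current ts)
      allowed = subst₂ (λ q ss → _ ∈ extended q ss) (state≡ rep) (letters≡ rep) (proj₁ ends)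
      moved : ∀ k → lookup (letters-of (proj₁ w′)) k ≡ current (act (lookup (action-of (proj₁ w′)) k) (lookup ts k)) ×
                    (∀ {r} → r ≤ M → lookup (cells-of (column w′ r)) k ≡ cell (act (lookup (action-of (proj₁ w′)) k) (lookup ts k)) r)
      moved k = tape-sound (lookup ts k) (λ r → lookup (cells-of (column w r)) k) (λ r → lookup (cells-of (column w′ r)) k)
        (λ r≤M → cells≡ rep r≤M k) (fits k) (lookup (action-of (proj₁ w′)) k) (λ r<M → proj₂ (inner r<M) k) (proj₂ ends k)

    step-complete : Fits M c → ∀ {c′} → Next c c′ → ∃[ w′ ] Stepped w w′ × Represents w′ c′
    step-complete fits {q′ , ts′} (as , as∈ , refl) = w′ ,
      ((λ r<M → allowed , λ k → proj₁ (tiles k) r<M) , (allowed , λ k → proj₂ (tiles k))) , rep′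
      where
      ts : Vec (Tape Letter) τ
      ts = proj₂ c
      w′ : Row (suc h) D M
      w′ = row-for as (q′ , ts′)
      rep′ : Represents w′ (q′ , ts′)
      rep′ = represents-row-for as (q′ , ts′)
      head≡ : read head-coding (proj₁ w′) ≡ ((q′ , as) , Vec.map current ts′)
      head≡ = head-row-for {M} as (q′ , ts′)
      allowed : (state-of (proj₁ w′) , action-of (proj₁ w′)) ∈ extended (state-of (proj₁ w)) (letters-of (proj₁ w))
      allowed = subst₂ (λ q ss → (state-of (proj₁ w′) , action-of (proj₁ w′)) ∈ extended q ss) (sym (state≡ rep)) (sym (letters≡ rep))
        (subst (_∈ extended (proj₁ c) (Vec.map current ts)) (sym (cong proj₁ head≡)) as∈)
      action≡ : ∀ k → lookup (action-of (proj₁ w′)) k ≡ lookup as k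
      action≡ k = cong (λ v → lookup v k) (cong (proj₂ ∘ proj₁) head≡)
      act≡ : ∀ k → lookup ts′ k ≡ act (lookup (action-of (proj₁ w′)) k) (lookup ts k)
      act≡ k = trans (Vec.lookup-zipWith act k as ts) (cong (λ a → act a (lookup ts k)) (sym (action≡ k)))
      tiles : ∀ k → _
      tiles k = tape-complete (lookup ts k) (λ r → lookup (cells-of (column w r)) k) (λ r → lookup (cells-of (column w′ r)) k)
        (λ r≤M → cells≡ rep r≤M k) (fits k) (lookup (action-of (proj₁ w′)) k)
        (trans (cong (λ v → lookup v k) (letters≡ rep′)) (trans (Vec.lookup-map k current ts′) (cong current (act≡ k))))
        (λ {r} r≤M → trans (cells≡ rep′ r≤M k) (cong (λ t → cell t r) (act≡ k)))

  data Steps {M} : ℕ → Row (suc h) D M → Row (suc h) D M → Set where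
    none : ∀ {w} → Steps 0 w w
    more : ∀ {n w w′ w″} → Stepped w w′ → Steps n w′ w″ → Steps (suc n) w w″

  steps-++ : ∀ {M m n} {u v w : Row (suc h) D M} → Steps m u v → Steps n v w → Steps (m + n) u w
  steps-++ none       s′ = s′
  steps-++ (more x s) s′ = more x (steps-++ s s′)

  steps-split : ∀ {M} m {n} {u w : Row (suc h) D M} → Steps (m + n) u w → ∃[ v ] Steps m u v × Steps n v w
  steps-split zero    s          = _ , none , s
  steps-split (suc m) (more x s) = let v , s₁ , s₂ = steps-split m s in v , more x s₁ , s₂

  embed : Config 𝓜 → Extended
  embed c = just (state c) , tapes c

  or-idle-∈ : ∀ {q ss q′ as} l → (q′ , as) ∈ or-idle q ss l →
              (∃[ p ] (p , as) ∈ l × q′ ≡ just p) ⊎ (l ≡ [] × q′ ≡ just q × as ≡ keep ss)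
  or-idle-∈ []      (here refl) = inj₂ (refl , refl , refl)
  or-idle-∈ (_ ∷ _) as∈         with ∈-map⁻ (map₁ just) as∈
  ... | _ , a∈ , refl = inj₁ (_ , a∈ , refl)

  ∈-or-idle : ∀ {q ss p as l} → (p , as) ∈ l → (just p , as) ∈ or-idle q ss l
  ∈-or-idle {l = _ ∷ _} a∈ = ∈-map⁺ (map₁ just) a∈

  halted⇒stuck : ∀ c → Halted 𝓜 c → δ (state c) (Vec.map current (tapes c)) ≡ []
  halted⇒stuck c eq = map-[] _ eq
    where
    map-[] : ∀ {A B : Set} {f : A → B} xs → List.map f xs ≡ [] → xs ≡ []
    map-[] []      _  = refl
    map-[] (_ ∷ _) ()

  next-embed : ∀ {c x} → Next (embed c) x → (∃[ d ] d ∈ successors 𝓜 c × x ≡ embed d) ⊎ (Halted 𝓜 c × x ≡ embed c)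
  next-embed {c} (as , as∈ , refl) with or-idle-∈ (δ (state c) (Vec.map current (tapes c))) as∈
  ... | inj₁ (p , a∈ , refl)         = inj₁ (_ , ∈-map⁺ _ a∈ , refl)
  ... | inj₂ (eq , refl , refl) = inj₂ (cong (List.map _) eq , cong (just (state c) ,_) (act-keep (tapes c)))

  embed-next : ∀ {c d} → d ∈ successors 𝓜 c → Next (embed c) (embed d)
  embed-next d∈ with ∈-map⁻ _ d∈
  ... | (p , as) , a∈ , refl = as , ∈-or-idle a∈ , refl

  embed-idle : ∀ {c} → Halted 𝓜 c → Next (embed c) (embed c)
  embed-idle {c} halted = keep (Vec.map current (tapes c)) ,
    subst (λ l → (just (state c) , keep (Vec.map current (tapes c))) ∈ or-idle (state c) (Vec.map current (tapes c)) l)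
      (sym (halted⇒stuck c halted)) (here refl) ,
    sym (act-keep (tapes c))

  Confined : ℕ → Config 𝓜 → Set
  Confined M c = ∀ {n d} → Run 𝓜 n c d → Fits M (embed d)

  -- Rows may idle after the machine has halted, whereas its run stops; idle steps are dropped,
  -- which leaves `m ≤ n`.
  steps-sound : ∀ {M n w w′ c} → Confined M c → Represents w (embed c) → Steps {M} n w w′ →
                ∃[ m ] ∃[ d ] m ≤ n × Run 𝓜 m c d × Represents w′ (embed d)
  steps-sound conf rep none       = _ , _ , z≤n , done , rep
  steps-sound conf rep (more x s) with step-sound rep (conf done) x
  ... | c′ , nxt , rep′ with next-embed nxt
  ... | inj₁ (d , d∈ , refl) = let m , e , m≤n , r , rep″ = steps-sound (conf ∘ step d∈) rep′ s in suc m , e , s≤s m≤n , step d∈ r , rep″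
  ... | inj₂ (_ , refl)      = let m , e , m≤n , r , rep″ = steps-sound conf rep′ s in m , e , m≤n⇒m≤1+n m≤n , r , rep″

  steps-run : ∀ {M n c d} {w : Row (suc h) D M} → Confined M c → Represents w (embed c) → Run 𝓜 n c d →
              ∃[ w′ ] Steps n w w′ × Represents w′ (embed d)
  steps-run conf rep done        = _ , none , rep
  steps-run conf rep (step d∈ r) =
    let w₁ , x , rep₁ = step-complete rep (conf done) (embed-next d∈)
        w₂ , s , rep₂ = steps-run (conf ∘ step d∈) rep₁ r
    in w₂ , more x s , rep₂

  steps-idle : ∀ {M d} {w : Row (suc h) D M} n → Confined M d → Represents w (embed d) → Halted 𝓜 d →
               ∃[ w′ ] Steps n w w′ × Represents w′ (embed d)
  steps-idle zero    conf rep halted = _ , none , rep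
  steps-idle (suc n) conf rep halted =
    let w₁ , x , rep₁ = step-complete rep (conf done) (embed-idle halted)
        w₂ , s , rep₂ = steps-idle n conf rep₁ halted
    in w₂ , more x s , rep₂

  steps-halting : ∀ {M m n c d} {w : Row (suc h) D M} → Confined M c → Represents w (embed c) →
                  Run 𝓜 m c d → Halted 𝓜 d → m ≤ n → ∃[ w′ ] Steps n w w′ × Represents w′ (embed d)
  steps-halting {m = m} {n} {w = w} conf rep r halted m≤n =
    let w₁ , s₁ , rep₁ = steps-run conf rep r
        w₂ , s₂ , rep₂ = steps-idle (n ∸ m) (conf ∘ Run-++ 𝓜 r) rep₁ halted
    in w₂ , subst (λ n → Steps n w w₂) (m+[n∸m]≡n m≤n) (steps-++ s₁ s₂) , rep₂

  accepting-represented : ∀ {M c} {w : Row (suc h) D M} → Represents w (embed c) →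
                          AcceptingHead (proj₁ w) ⇔ (Halted 𝓜 c × T (accepting (state c)))
  accepting-represented {c = c} {w} rep = mk⇔ forth λ (halted , acc) →
    state c , state≡ rep , acc , trans (cong (δ (state c)) (letters≡ rep)) (halted⇒stuck c halted)
    where
    forth : AcceptingHead (proj₁ w) → Halted 𝓜 c × T (accepting (state c))
    forth (q , eq , acc , stuck) with refl ← trans (sym eq) (state≡ rep) =
      cong (List.map _) (trans (cong (δ q) (sym (letters≡ rep))) stuck) , acc

  pre-initial : List Bool → Extended
  pre-initial x = nothing , ⟨ [] , blank , List.map bit x ⟩ ∷ Vec.replicate extra (load [])

  module _ (x : List Bool) where

    private
      first : Tape Letter
      first = act (blank , right) ⟨ [] , blank , List.map bit x ⟩

      rest : Vec (Tape Letter) extra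
      rest = Vec.replicate extra (load [])

      started : Extended
      started = just start , first ∷ rest

    cell-first : ∀ r → cell first r ≡ cell (load (List.map bit x)) r
    cell-first = go x
      where
      nth-blank : ∀ r → nth {Aux} (blank ∷ []) r ≡ blank
      nth-blank zero    = refl
      nth-blank (suc r) = refl
      go : ∀ x r → cell (act (blank , right) ⟨ [] , blank , List.map bit x ⟩) r ≡ cell {Aux} (load (List.map bit x)) r
      go []      r = cong (_, blank) (nth-blank r)
      go (b ∷ x) r = cong (_, nth (List.map bit x) r) (nth-blank r)

    current-first : current first ≡ current (load (List.map bit x))
    current-first = go x
      where
      go : ∀ x → current (act (blank , right) ⟨ [] , blank , List.map bit x ⟩) ≡ current {Symbol Aux} (load (List.map bit x))
      go []      = refl
      go (b ∷ x) = refl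

    next-pre-initial : ∀ {c} → Next (pre-initial x) c → c ≡ started
    next-pre-initial (as , here refl , refl) = cong (λ ts → just start , first ∷ ts) (act-keep rest)

    pre-initial-next : Next (pre-initial x) started
    pre-initial-next = _ , here refl , cong (first ∷_) (sym (act-keep rest))

    -- The step into the input leaves a stored blank on its left, so `started` is not literally the
    -- initial configuration. The two agree cell by cell, which is all that a row records.
    started-initial : ∀ {M} {w : Row (suc h) D M} → Represents w started ⇔ Represents w (embed (initial 𝓜 x))
    started-initial = mk⇔
      (λ rep → record
        { state≡   = state≡ rep
        ; letters≡ = trans (letters≡ rep) (cong (_∷ Vec.map current rest) current-first)
        ; cells≡   = λ { r≤M zero → trans (cells≡ rep r≤M zero) (cell-first _) ; r≤M (suc k) → cells≡ rep r≤M (suc k) }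
        })
      (λ rep → record
        { state≡   = state≡ rep
        ; letters≡ = trans (letters≡ rep) (cong (_∷ Vec.map current rest) (sym current-first))
        ; cells≡   = λ { r≤M zero → trans (cells≡ rep r≤M zero) (sym (cell-first _)) ; r≤M (suc k) → cells≡ rep r≤M (suc k) }
        })

    pre-initial-fits : ∀ {M} → length x ≤ M → Fits M (pre-initial x)
    pre-initial-fits x≤M zero    = cong (blank ,_)
      (nth-beyond (List.map bit x) (≤-trans (≤-reflexive (List.length-map bit x)) (m≤n⇒m≤1+n x≤M)))
    pre-initial-fits x≤M (suc k) = cong (λ t → cell t (suc _)) (Vec.lookup-replicate k (load []))

    from-pre-initial : ∀ {M n} {w w′ : Row (suc h) D M} → length x ≤ M → Represents w (pre-initial x) → Steps (suc n) w w′ →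
                       ∃[ u ] Represents u (embed (initial 𝓜 x)) × Steps n u w′
    from-pre-initial x≤M rep (more s ss) with step-sound rep (pre-initial-fits x≤M) s
    ... | c , nxt , rep′ with refl ← next-pre-initial nxt = _ , to started-initial rep′ , ss

    to-pre-initial : ∀ {M} {w : Row (suc h) D M} → length x ≤ M → Represents w (pre-initial x) →
                     ∃[ u ] Represents u (embed (initial 𝓜 x)) × Stepped w u
    to-pre-initial x≤M rep = let u , s , rep′ = step-complete rep (pre-initial-fits x≤M) pre-initial-next in u , to started-initial rep′ , s

    column-cells : ℕ → Cells 𝓜
    column-cells r = (blank , nth (List.map bit x) r) ∷ Vec.replicate extra (blank , blank)

    cells-pre-initial : ∀ r k → lookup (column-cells r) k ≡ cell (lookup (proj₂ (pre-initial x)) k) r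
    cells-pre-initial r zero    = refl
    cells-pre-initial r (suc k) = trans (Vec.lookup-replicate k (blank , blank))
      (sym (cong (λ t → cell t r) (Vec.lookup-replicate k (load []))))

    nth-input : ∀ pre {b suf} → reverse x ≡ pre ++ b ∷ suf → nth {Aux} (List.map bit x) (length suf) ≡ bit b
    nth-input pre {b} {suf} eq = begin
      nth (List.map bit x) (length suf)
        ≡⟨ cong₂ (λ x n → nth (List.map bit x) n) x≡ (sym (trans (List.length-map bit (reverse suf)) (List.length-reverse suf))) ⟩
      nth (List.map bit (reverse suf ++ b ∷ reverse pre)) (length (List.map bit (reverse suf)))
        ≡⟨ cong (λ ss → nth ss _) (List.map-++ bit (reverse suf) (b ∷ reverse pre)) ⟩
      nth (List.map bit (reverse suf) ++ bit b ∷ List.map bit (reverse pre)) (length (List.map bit (reverse suf)))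
        ≡⟨ nth-length (List.map bit (reverse suf)) ⟩
      bit b
        ∎
      where
      open ≡-Reasoning
      x≡ : x ≡ reverse suf ++ b ∷ reverse pre
      x≡ = begin
        x                                       ≡⟨ sym (List.reverse-involutive x) ⟩
        reverse (reverse x)                     ≡⟨ cong reverse eq ⟩
        reverse (pre ++ b ∷ suf)                ≡⟨ List.reverse-++ pre (b ∷ suf) ⟩
        reverse (b ∷ suf) ++ reverse pre        ≡⟨ cong (_++ reverse pre) (List.unfold-reverse b suf) ⟩
        (reverse suf ++ b ∷ []) ++ reverse pre  ≡⟨ List.++-assoc (reverse suf) (b ∷ []) (reverse pre) ⟩
        reverse suf ++ b ∷ reverse pre          ∎

    position-of : ∀ (ys : List Bool) {r} → r < length ys → ∃[ pre ] ∃[ b ] ∃[ suf ] ys ≡ pre ++ b ∷ suf × length suf ≡ r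
    position-of (b ∷ ys) (s≤s r≤ys) with m≤n⇒m<n∨m≡n r≤ys
    ... | inj₂ refl = [] , b , ys , refl , refl
    ... | inj₁ r<ys = let pre , b′ , suf , eq , eq′ = position-of ys r<ys in b ∷ pre , b′ , suf , cong (b ∷_) eq , eq′

    represents-started : ∀ {P M} {w : Row (suc h) D M} → M ≡ length x + P →
                         Started (reverse x) P w ⇔ Represents w (pre-initial x)
    represents-started {P} {M} {w} refl = mk⇔ forth back
      where
      beyond : ∀ {r} → length x ≤ r → nth {Aux} (List.map bit x) r ≡ blank
      beyond x≤r = nth-beyond (List.map bit x) (≤-trans (≤-reflexive (List.length-map bit x)) x≤r)
      lr : length (reverse x) ≡ length x
      lr = List.length-reverse x
      forth : Started (reverse x) P w → Represents w (pre-initial x)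
      forth (onx , padding , ((q≡ , ss≡) , end)) = record
        { state≡   = q≡
        ; letters≡ = trans ss≡ (cong (blank ∷_) (sym (Vec.map-replicate current (load []) extra)))
        ; cells≡   = λ {r} r≤M k → trans (cong (λ v → lookup v k) (at r r≤M)) (cells-pre-initial r k)
        }
        where
        at-last : cells-of (column w M) ≡ column-cells M
        at-last = trans end (cong (λ s → (blank , s) ∷ _) (sym (beyond (m≤m+n (length x) P))))
        at : ∀ r → r ≤ M → cells-of (column w r) ≡ column-cells r
        at r r≤M with <-≤-connex r (length x)
        ... | inj₁ r<x with position-of (reverse x) (subst (r <_) (sym lr) r<x)
        ... | pre , b , suf , eq , refl = trans (proj₂ (onx pre eq)) (cong (λ s → (blank , s) ∷ _) (sym (nth-input pre eq)))
        at r r≤M | inj₂ x≤r with m≤n⇒m<n∨m≡n r≤M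
        ... | inj₂ refl = at-last
        ... | inj₁ r<M = trans (cong (cells-of ∘ column w) (sym r≡))
            (trans (proj₂ (padding (+-cancelˡ-< (length (reverse x)) _ _ (subst₂ _<_ (sym r≡) (cong (_+ P) (sym lr)) r<M))))
            (cong (λ s → (blank , s) ∷ _) (sym (beyond x≤r))))
          where
          r≡ : length (reverse x) + (r ∸ length x) ≡ r
          r≡ = trans (cong (_+ (r ∸ length x)) lr) (m+[n∸m]≡n x≤r)
      back : Represents w (pre-initial x) → Started (reverse x) P w
      back rep = (λ pre {b} {suf} eq → hd , trans (at (<⇒≤ (inside pre eq))) (cong (λ s → (blank , s) ∷ _) (nth-input pre eq)))
               , (λ {j} j<P → hd , trans (at (subst (λ n → n + j ≤ M) (sym lr) (+-monoʳ-≤ (length x) (<⇒≤ j<P))))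
                                    (cong (λ s → (blank , s) ∷ _)
                                      (beyond (≤-trans (m≤m+n (length x) j) (≤-reflexive (cong (_+ j) (sym lr)))))))
               , (hd , trans (at ≤-refl) (cong (λ s → (blank , s) ∷ _) (beyond (m≤m+n (length x) P))))
        where
        hd : state-of (proj₁ w) ≡ nothing × letters-of (proj₁ w) ≡ Vec.replicate τ blank
        hd = state≡ rep , trans (letters≡ rep) (cong (blank ∷_) (Vec.map-replicate current (load []) extra))
        at : ∀ {r} → r ≤ M → cells-of (column w r) ≡ column-cells r
        at {r} r≤M = lookup-injective λ k → trans (cells≡ rep r≤M k) (sym (cells-pre-initial r k))
        inside : ∀ pre {b suf} → reverse x ≡ pre ++ b ∷ suf → length suf < M
        inside pre {b} {suf} eq = ≤-trans (m≤n+m (suc (length suf)) (length pre)) (≤-trans (≤-reflexive (sym (List.length-++ pre)))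
          (≤-trans (≤-reflexive (trans (sym (cong length eq)) lr)) (m≤m+n (length x) P)))

-- Tape lengths along runs

module _ {A : Set} where

  act-length : ∀ a (t : Tape (Symbol A)) → length (before (act a t)) ≤ suc (length (before t)) ×
                                           length (after (act a t)) ≤ suc (length (after t))
  act-length (s , left)  ⟨ []     , c , rs ⟩     = z≤n , ≤-refl
  act-length (s , left)  ⟨ l ∷ ls , c , rs ⟩     = m≤n⇒m≤1+n (n≤1+n _) , ≤-refl
  act-length (s , stay)  t                       = n≤1+n _ , n≤1+n _
  act-length (s , right) ⟨ ls     , c , [] ⟩     = ≤-refl , z≤n
  act-length (s , right) ⟨ ls     , c , r ∷ rs ⟩ = ≤-refl , m≤n⇒m≤1+n (n≤1+n _)

  length-contents : (t : Tape (Symbol A)) → length (contents t) ≡ length (before t) + suc (length (after t))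
  length-contents ⟨ ls , c , rs ⟩ = trans (List.length-++ (reverse ls)) (cong (_+ suc (length rs)) (List.length-reverse ls))

lookup-≤-sum : ∀ {n} (v : Vec ℕ n) k → lookup v k ≤ Vec.sum v
lookup-≤-sum (x ∷ v) zero    = m≤m+n x _
lookup-≤-sum (x ∷ v) (suc k) = ≤-trans (lookup-≤-sum v k) (m≤n+m _ x)

module _ (𝓜 : Machine) where

  open Machine 𝓜

  record Narrow (M : ℕ) (c : Config 𝓜) : Set where
    constructor narrow
    field widths : ∀ k → length (before (lookup (tapes c) k)) ≤ M × length (after (lookup (tapes c) k)) ≤ M

  narrow-weaken : ∀ {M N c} → M ≤ N → Narrow M c → Narrow N c
  narrow-weaken M≤N (narrow h) = narrow λ k → ≤-trans (proj₁ (h k)) M≤N , ≤-trans (proj₂ (h k)) M≤N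

  narrow-initial : ∀ x → Narrow (length x) (initial 𝓜 x)
  narrow-initial x = narrow (go x)
    where
    go : ∀ x k → length (before (lookup (tapes (initial 𝓜 x)) k)) ≤ length x × length (after (lookup (tapes (initial 𝓜 x)) k)) ≤ length x
    go []      zero    = z≤n , z≤n
    go (b ∷ x) zero    = z≤n , ≤-trans (≤-reflexive (List.length-map bit x)) (n≤1+n _)
    go x       (suc k) = subst (λ t → length (before t) ≤ length x × length (after t) ≤ length x)
      (sym (Vec.lookup-replicate k (load []))) (z≤n , z≤n)

  narrow-step : ∀ {M c d} → d ∈ successors 𝓜 c → Narrow M c → Narrow (suc M) d
  narrow-step {M} {c} d∈ (narrow h) with ∈-map⁻ _ d∈
  ... | (q , as) , _ , refl = narrow λ k →
    let lengths = act-length (lookup as k) (lookup (tapes c) k)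
    in subst (λ t → length (before t) ≤ suc M × length (after t) ≤ suc M) (sym (Vec.lookup-zipWith act k as (tapes c)))
         (≤-trans (proj₁ lengths) (s≤s (proj₁ (h k))) , ≤-trans (proj₂ lengths) (s≤s (proj₂ (h k))))

  narrow-run : ∀ {M n c d} → Run 𝓜 n c d → Narrow M c → Narrow (n + M) d
  narrow-run done        h = h
  narrow-run {M} {suc n} (step d∈ r) h = narrow-weaken (≤-reflexive (+-suc n M)) (narrow-run r (narrow-step d∈ h))

  narrow-space : ∀ {s} c → space 𝓜 c ≤ s → Narrow s c
  narrow-space {s} c h = narrow λ k →
    let t = lookup (tapes c) k
        bound = ≤-trans (≤-reflexive (trans (sym (length-contents t)) (sym (Vec.lookup-map k (length ∘ contents) (tapes c)))))
                  (≤-trans (lookup-≤-sum (Vec.map (length ∘ contents) (tapes c)) k) h)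
    in ≤-trans (m≤m+n _ _) bound , ≤-trans (n≤1+n _) (≤-trans (m≤n+m _ (length (before t))) bound)

  Bounded : ℕ → List Bool → Set
  Bounded M x = ∀ {n c} → Run 𝓜 n (initial 𝓜 x) c → Narrow M c

  -- A step lengthens each half of a tape by at most one cell, so the running time bounds what is
  -- added to the input.
  time-bounded : ∀ {t x} → RunsInTime 𝓜 t → Bounded (length x + t (length x)) x
  time-bounded {t} {x} h r = narrow-weaken (≤-trans (≤-reflexive (+-comm _ (length x))) (+-monoʳ-≤ (length x) (h x r)))
    (narrow-run r (narrow-initial x))

  space-bounded : ∀ {s x} → RunsInSpace 𝓜 s → Bounded (length x + s (length x)) x
  space-bounded {s} {x} h r = narrow-weaken (m≤n+m _ (length x)) (narrow-space _ (h x r))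

  run-split : ∀ {n c e} i → i ≤ n → Run 𝓜 n c e → ∃[ d ] Run 𝓜 i c d × Run 𝓜 (n ∸ i) d e
  run-split zero    _         r           = _ , done , r
  run-split (suc i) (s≤s i≤n) (step d∈ r) = let d , r₁ , r₂ = run-split i i≤n r in d , step d∈ r₁ , r₂

-- Numbering of rows

bit-index : Bool → Fin 2
bit-index false = 0F
bit-index true  = 1F

bit-index-injective : ∀ {a b} → bit-index a ≡ bit-index b → a ≡ b
bit-index-injective {false} {false} _ = refl
bit-index-injective {true}  {true}  _ = refl

number : ∀ {n} → Vec Bool n → Fin (2 ^ n)
number []      = 0F
number (b ∷ v) = combine (bit-index b) (number v)

number-injective : ∀ {n} {u v : Vec Bool n} → number u ≡ number v → u ≡ v
number-injective {u = []}    {[]}     _  = refl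
number-injective {u = a ∷ u} {b ∷ v} eq =
  let eqˡ , eqʳ = Fin.combine-injective (bit-index a) (number u) (bit-index b) (number v) eq
  in cong₂ _∷_ (bit-index-injective eqˡ) (number-injective eqʳ)

concat-injective : ∀ {A : Set} {m n} (us vs : Vec (Vec A n) m) → concat us ≡ concat vs → us ≡ vs
concat-injective []       []       _  = refl
concat-injective (u ∷ us) (v ∷ vs) eq = let eqˡ , eqʳ = Vec.++-injective u v eq in cong₂ _∷_ eqˡ (concat-injective us vs eqʳ)

row-number : ∀ {h D M} → Row h D M → Fin (2 ^ (h + suc M * D))
row-number (hd , cs) = number (hd ++ᵛ concat cs)

row-number-injective : ∀ {h D M} {u v : Row h D M} → row-number u ≡ row-number v → u ≡ v
row-number-injective {u = hd , cs} {hd′ , cs′} eq =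
  let eqˡ , eqʳ = Vec.++-injective hd hd′ (number-injective eq) in cong₂ _,_ eqˡ (concat-injective cs cs′ eqʳ)

-- Acceptance in terms of rows

module Acceptance (𝓜 : Machine) (bare-head-coding : Coding (Head 𝓜)) (cells-coding : Coding (Cells 𝓜)) where

  open Machine 𝓜
  open Simulation 𝓜 bare-head-coding cells-coding public
  open Game tiling using (Started)
  open Represents

  module _ {x P M} (M≡ : M ≡ length x + P) (bounded : Bounded 𝓜 M x) where

    x≤M : length x ≤ M
    x≤M = ≤-trans (m≤m+n (length x) P) (≤-reflexive (sym M≡))

    confined : Confined M (initial 𝓜 x)
    confined {d = d} r k = let h , h′ = Narrow.widths (bounded r) k
                       in cong₂ _,_ (nth-beyond (before (lookup (tapes d) k)) (m≤n⇒m≤1+n h))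
                                   (nth-beyond (after (lookup (tapes d) k)) (m≤n⇒m≤1+n h′))

    -- The first of the `t` steps leads from the pre-initial configuration to the initial one.
    -- Therefore soundness needs `0 < t`, and completeness a run strictly shorter than `t`.
    RowsAccept : ℕ → Set
    RowsAccept t = ∃[ w ] ∃[ w′ ] Started (reverse x) P w × Steps {M} t w w′ × AcceptingHead (proj₁ w′)

    rows-accept-sound : ∀ {t} → 0 < t → RowsAccept t → Accepts 𝓜 x
    rows-accept-sound {suc t} _ (w , w′ , st , s , acc) =
      let u , rep , s′ = from-pre-initial x x≤M (to (represents-started x M≡) st) s
          m , d , _ , r , rep′ = steps-sound confined rep s′
          halted , a = to (accepting-represented rep′) acc
      in m , d , r , halted , a

    rows-accept-complete : ∀ {n t c} → Run 𝓜 n (initial 𝓜 x) c → Halted 𝓜 c → T (accepting (state c)) → n < t → RowsAccept t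
    rows-accept-complete {t = suc t} r halted acc (s≤s n≤t) =
      -- No step leads to the first row, so the action recorded in it is arbitrary.
      let w = row-for {M} (Vec.replicate _ (blank , stay)) (pre-initial x)
          rep = represents-row-for _ (pre-initial x)
          u , rep₁ , s = to-pre-initial x x≤M rep
          w′ , s′ , rep₂ = steps-halting confined rep₁ r halted n≤t
      in w , w′ , from (represents-started x M≡) rep , more s s′ , from (accepting-represented rep₂) (halted , acc)

    -- Two visited configurations with the same row would need equally long to halt.

    halting-time : Deterministic 𝓜 → ∀ {n c} → Run 𝓜 n (initial 𝓜 x) c → Halted 𝓜 c → n < 2 ^ (suc h + suc M * D)
    halting-time det {n} {e} r halted with <-≤-connex n (2 ^ (suc h + suc M * D))
    ... | inj₁ n<2^ = n<2^
    ... | inj₂ 2^≤n = ⊥-elim (repetition (Fin.pigeonhole (s≤s 2^≤n) (row-number ∘ row)))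
      where
      i≤n : (i : Fin (suc n)) → toℕ i ≤ n
      i≤n i = s≤s⁻¹ (Fin.toℕ<n i)
      visited : (i : Fin (suc n)) → ∃[ d ] Run 𝓜 (toℕ i) (initial 𝓜 x) d × Run 𝓜 (n ∸ toℕ i) d e
      visited i = run-split 𝓜 (toℕ i) (i≤n i) r
      row : Fin (suc n) → Row (suc h) D M
      row i = row-for (Vec.replicate _ (blank , stay)) (embed (proj₁ (visited i)))
      represents-row : ∀ i → Represents (row i) (embed (proj₁ (visited i)))
      represents-row i = represents-row-for _ (embed (proj₁ (visited i)))
      repetition : ∃[ i ] ∃[ j ] toℕ i < toℕ j × row-number (row i) ≡ row-number (row j) → ⊥
      repetition (i , j , i<j , eq) =
        let _ , rᵢ , rᵢ′ = visited i
            _ , rⱼ , rⱼ′ = visited j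
            -- The rows for the rest of the run from position `j` start with the common row, so they
            -- also describe a run from position `i`. That run halts within `n ∸ toℕ j` steps,
            -- although by determinism it has to take the larger number `n ∸ toℕ i`.
            w , s , rep = steps-run (confined ∘ Run-++ 𝓜 rⱼ) (represents-row j) rⱼ′
            m , d , m≤ , r′ , rep′ = steps-sound (confined ∘ Run-++ 𝓜 rᵢ) (represents-row i)
              (subst (λ u → Steps (n ∸ toℕ j) u w) (sym (row-number-injective eq)) s)
        in <⇒≱ (∸-monoʳ-< i<j (i≤n j)) (≤-trans (halted-run-longest 𝓜 det r′ (halted-alike rep rep′) rᵢ′) m≤)
        where
        halted-alike : ∀ {w d} → Represents {M} w (embed e) → Represents w (embed d) → Halted 𝓜 d
        halted-alike {w} {d} rep rep′ with refl ← trans (sym (state≡ rep)) (state≡ rep′) =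
          cong (List.map _) (trans (cong (δ (state e)) (trans (sym (letters≡ rep′)) (letters≡ rep))) (halted⇒stuck e halted))

    module _ where
      open Game tiling

      win⇒steps : ∀ t {w : Row (suc h) D M} → Win t w → ∃[ w′ ] Steps t w w′ × AcceptingHead (proj₁ w′)
      win⇒steps zero    (_ , acc) = _ , none , acc
      win⇒steps (suc t) win       = let w₁ , s , win′ = win []
                                        w₂ , s′ , acc = win⇒steps t win′
                                    in w₂ , more s s′ , acc

      steps⇒win : ∀ {t} {w w′ : Row (suc h) D M} → Steps t w w′ → AcceptingHead (proj₁ w′) → Win t w
      steps⇒win none       acc = (λ _ → acc) , acc
      steps⇒win (more s s′) acc [] = _ , s , steps⇒win s′ acc

      winning⇔rows-accept : ∀ t → Winning M (reverse x) P t ⇔ RowsAccept t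
      winning⇔rows-accept t = mk⇔
        (λ (w , st , win) → let w′ , s , acc = win⇒steps t win in w , w′ , st , s , acc)
        (λ (w , w′ , st , s , acc) → w , st , steps⇒win s acc)

-- Rows side by side

module _ {h h′ D D′ : ℕ} where

  left-window : Window (h + h′) (D + D′) → Window h D
  left-window (hd , x , y) = Vec.take h hd , Vec.take D x , Vec.take D y

  right-window : Window (h + h′) (D + D′) → Window h′ D′
  right-window (hd , x , y) = Vec.drop h hd , Vec.drop D x , Vec.drop D y

  module _ {M : ℕ} where

    left-row : Row (h + h′) (D + D′) M → Row h D M
    left-row (hd , cs) = Vec.take h hd , Vec.map (Vec.take D) cs

    right-row : Row (h + h′) (D + D′) M → Row h′ D′ M
    right-row (hd , cs) = Vec.drop h hd , Vec.map (Vec.drop D) cs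

    pair-row : Row h D M → Row h′ D′ M → Row (h + h′) (D + D′) M
    pair-row (hd , cs) (hd′ , cs′) = hd ++ᵛ hd′ , Vec.zipWith _++ᵛ_ cs cs′

    left-pair : ∀ u w → left-row (pair-row u w) ≡ u
    left-pair (hd , cs) (hd′ , cs′) = cong₂ _,_ (take-++ hd hd′) (go cs cs′)
      where
      go : ∀ {n} (cs : Vec (Vec Bool D) n) cs′ → Vec.map (Vec.take D) (Vec.zipWith (_++ᵛ_ {n = D′}) cs cs′) ≡ cs
      go []       []         = refl
      go (c ∷ cs) (c′ ∷ cs′) = cong₂ _∷_ (take-++ c c′) (go cs cs′)

    right-pair : ∀ u w → right-row (pair-row u w) ≡ w
    right-pair (hd , cs) (hd′ , cs′) = cong₂ _,_ (drop-++ hd hd′) (go cs cs′)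
      where
      go : ∀ {n} (cs : Vec (Vec Bool D) n) cs′ → Vec.map (Vec.drop D) (Vec.zipWith (_++ᵛ_ {n = D′}) cs cs′) ≡ cs′
      go []       []         = refl
      go (c ∷ cs) (c′ ∷ cs′) = cong₂ _∷_ (drop-++ c c′) (go cs cs′)

    column-left : ∀ w c → column (left-row w) c ≡ Vec.take D (column w c)
    column-left (hd , cs) c = Vec.lookup-map (clamp c) (Vec.take D) cs

    window-left : ∀ w i j → left-window (window w i j) ≡ window (left-row w) i j
    window-left w i j = cong₂ (λ x y → _ , x , y) (sym (column-left w i)) (sym (column-left w j))

    window-right : ∀ w i j → right-window (window w i j) ≡ window (right-row w) i j
    window-right (hd , cs) i j =
      cong₂ (λ x y → _ , x , y) (sym (Vec.lookup-map (clamp i) (Vec.drop D) cs)) (sym (Vec.lookup-map (clamp j) (Vec.drop D) cs))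

-- A column before the last is the first column of an inner window; the last column and the header
-- are seen in the end window, which exists even for `M` equal to 0.
row-injective : ∀ {h D M} {u v : Row h D M} → (∀ {r} → r < M → window u r (suc r) ≡ window v r (suc r)) →
                window u 0 M ≡ window v 0 M → u ≡ v
row-injective {M = M} {u} {v} inner ends = cong₂ _,_ (cong proj₁ ends) (lookup-injective λ i →
  subst (λ i → lookup (proj₂ u) i ≡ lookup (proj₂ v) i) (Fin.toℕ-injective (toℕ-clamp (s≤s⁻¹ (Fin.toℕ<n i))))
    (columns (m≤n⇒m<n∨m≡n (s≤s⁻¹ (Fin.toℕ<n i)))))
  where
  columns : ∀ {r} → r < M ⊎ r ≡ M → column u r ≡ column v r
  columns (inj₁ r<M)  = cong (proj₁ ∘ proj₂) (inner r<M)
  columns (inj₂ refl) = cong (proj₂ ∘ proj₂) ends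

-- Savitch's theorem

-- A row holds two configurations and a guess for the one halfway between them; the universal
-- player selects the half to be verified.

module Savitch (𝓜 : Machine) (bare-head-coding : Coding (Head 𝓜)) (cells-coding : Coding (Cells 𝓜)) where

  open Acceptance 𝓜 bare-head-coding cells-coding

  source-window target-window middle-window : Window (suc h + (suc h + suc h)) (D + (D + D)) → Window (suc h) D
  source-window w = left-window w
  target-window w = left-window {suc h} {suc h} {D} {D} (right-window {suc h} {suc h + suc h} {D} {D + D} w)
  middle-window w = right-window {suc h} {suc h} {D} {D} (right-window {suc h} {suc h + suc h} {D} {D + D} w)

  -- The target is guessed together with the source and only has to be accepting. The bit `true`
  -- selects the half from source to middle, and the new middle is unconstrained. When the rounds
  -- are over, source and target must be a single step apart.
  savitch-tiling : Tiling (suc (h + (suc h + suc h))) 1 (D + (D + D))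
  savitch-tiling = record
    { start = λ s hd x → Tiling.start tiling s (Vec.take (suc h) hd) (Vec.take D x) ×
                         AcceptingHead (Vec.take (suc h) (Vec.drop (suc h) hd))
    ; link  = λ { _ (b ∷ []) old new →
        source-window new ≡ (if b then source-window old else middle-window old) ×
        target-window new ≡ (if b then middle-window old else target-window old) }
    ; final = λ b w → step-tile b (source-window w) (target-window w)
    }

  open Game savitch-tiling
  module Single = Game tiling

  Triple : ℕ → Set
  Triple M = Row (suc (h + (suc h + suc h))) (D + (D + D)) M

  module _ {M : ℕ} where

    source target middle : Triple M → Row (suc h) D M
    source w = left-row w
    target w = left-row {suc h} {suc h} {D} {D} (right-row {suc h} {suc h + suc h} {D} {D + D} w)
    middle w = right-row {suc h} {suc h} {D} {D} (right-row {suc h} {suc h + suc h} {D} {D + D} w)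

    triple : (u v m : Row (suc h) D M) → Triple M
    triple u v m = pair-row u (pair-row v m)

    source-triple : ∀ u v m → source (triple u v m) ≡ u
    source-triple u v m = left-pair u (pair-row v m)

    target-triple : ∀ u v m → target (triple u v m) ≡ v
    target-triple u v m = trans (cong (left-row {suc h} {suc h} {D} {D}) (right-pair u (pair-row v m))) (left-pair v m)

    middle-triple : ∀ u v m → middle (triple u v m) ≡ m
    middle-triple u v m = trans (cong (right-row {suc h} {suc h} {D} {D}) (right-pair u (pair-row v m))) (right-pair v m)

    window-source : ∀ w i j → source-window (window w i j) ≡ window (source w) i j
    window-source w i j = window-left {suc h} {suc h + suc h} {D} {D + D} w i j

    window-target : ∀ w i j → target-window (window w i j) ≡ window (target w) i j
    window-target w i j = trans
      (cong (left-window {suc h} {suc h} {D} {D}) (window-right {suc h} {suc h + suc h} {D} {D + D} w i j))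
      (window-left {suc h} {suc h} {D} {D} (right-row {suc h} {suc h + suc h} {D} {D + D} w) i j)

    window-middle : ∀ w i j → middle-window (window w i j) ≡ window (middle w) i j
    window-middle w i j = trans
      (cong (right-window {suc h} {suc h} {D} {D}) (window-right {suc h} {suc h + suc h} {D} {D + D} w i j))
      (window-right {suc h} {suc h} {D} {D} (right-row {suc h} {suc h + suc h} {D} {D + D} w) i j)

    Halves : Bool → Triple M → Triple M → Set
    Halves b w w′ = source w′ ≡ (if b then source w else middle w) × target w′ ≡ (if b then middle w else target w)

    -- Tiles can enforce the copying of a row only window by window; this turns such a family of
    -- local equations into one equation between rows.
    windows-agree : ∀ {u v : Row (suc h) D M} (f g : ℕ → ℕ → Window (suc h) D) →
                    (∀ i j → f i j ≡ window u i j) → (∀ i j → g i j ≡ window v i j) →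
                    ((∀ {r} → r < M → f r (suc r) ≡ g r (suc r)) × f 0 M ≡ g 0 M) ⇔ u ≡ v
    windows-agree {u} {v} f g f≡ g≡ = mk⇔
      (λ (inner , ends) → row-injective (λ {r} r<M → trans (sym (f≡ r (suc r))) (trans (inner r<M) (g≡ r (suc r))))
                                        (trans (sym (f≡ 0 M)) (trans ends (g≡ 0 M))))
      (λ { refl → (λ {r} _ → trans (f≡ r (suc r)) (sym (g≡ r (suc r)))) , trans (f≡ 0 M) (sym (g≡ 0 M)) })

    linked⇔halves : ∀ b w w′ → Linked (b ∷ []) w w′ ⇔ Halves b w w′
    linked⇔halves b w w′ = mk⇔
      (λ (inner , ends) → to sources ((λ r<M → proj₁ (inner r<M)) , proj₁ ends) , to targets ((λ r<M → proj₂ (inner r<M)) , proj₂ ends))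
      (λ (eq , eq′) → let inner , end = from sources eq
                          inner′ , end′ = from targets eq′
                      in (λ r<M → inner r<M , inner′ r<M) , (end , end′))
      where
      old-source old-target : ℕ → ℕ → Window (suc h) D
      old-source i j = if b then source-window (window w i j) else middle-window (window w i j)
      old-target i j = if b then middle-window (window w i j) else target-window (window w i j)
      old-source≡ : ∀ b i j → (if b then source-window (window w i j) else middle-window (window w i j)) ≡
                              window (if b then source w else middle w) i j
      old-source≡ true  = window-source w
      old-source≡ false = window-middle w
      old-target≡ : ∀ b i j → (if b then middle-window (window w i j) else target-window (window w i j)) ≡
                              window (if b then middle w else target w) i j
      old-target≡ true  = window-middle w
      old-target≡ false = window-target w
      sources : ((∀ {r} → r < M → source-window (window w′ r (suc r)) ≡ old-source r (suc r)) ×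
                 source-window (window w′ 0 M) ≡ old-source 0 M) ⇔ source w′ ≡ (if b then source w else middle w)
      sources = windows-agree (λ i j → source-window (window w′ i j)) old-source (window-source w′) (old-source≡ b)
      targets : ((∀ {r} → r < M → target-window (window w′ r (suc r)) ≡ old-target r (suc r)) ×
                 target-window (window w′ 0 M) ≡ old-target 0 M) ⇔ target w′ ≡ (if b then middle w else target w)
      targets = windows-agree (λ i j → target-window (window w′ i j)) old-target (window-target w′) (old-target≡ b)

    finished⇔stepped : ∀ w → Finished w ⇔ Stepped (source w) (target w)
    finished⇔stepped w = mk⇔
      (λ (inner , ends) → (λ {r} r<M → subst₂ (step-tile false) (window-source w r (suc r)) (window-target w r (suc r)) (inner r<M)) ,
                          subst₂ (step-tile true) (window-source w 0 M) (window-target w 0 M) ends)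
      (λ (inner , ends) → (λ {r} r<M → subst₂ (step-tile false) (sym (window-source w r (suc r)))
                                                                    (sym (window-target w r (suc r))) (inner r<M)) ,
                          subst₂ (step-tile true) (sym (window-source w 0 M)) (sym (window-target w 0 M)) ends)

    win⇒steps-2^ : ∀ t {w} → Win t w → Steps (2 ^ t) (source w) (target w)
    win⇒steps-2^ zero    {w} win = more (to (finished⇔stepped w) win) none
    win⇒steps-2^ (suc t) {w} win =
      let w₁ , linked₁ , win₁ = win (true ∷ [])
          w₂ , linked₂ , win₂ = win (false ∷ [])
          source₁ , target₁ = to (linked⇔halves true w w₁) linked₁
          source₂ , target₂ = to (linked⇔halves false w w₂) linked₂
      in subst (λ n → Steps (2 ^ t + n) (source w) (target w)) (sym (+-identityʳ (2 ^ t)))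
           (steps-++ (subst₂ (Steps (2 ^ t)) source₁ target₁ (win⇒steps-2^ t win₁))
                     (subst₂ (Steps (2 ^ t)) source₂ target₂ (win⇒steps-2^ t win₂)))

    steps-2^⇒win : ∀ t {u v} → Steps (2 ^ t) u v → ∃[ m ] Win t (triple u v m)
    -- Nothing is halved any more, so any row may serve as the middle.
    steps-2^⇒win zero {u} {v} (more s none) = u , from (finished⇔stepped (triple u v u))
      (subst₂ Stepped (sym (source-triple u v u)) (sym (target-triple u v u)) s)
    steps-2^⇒win (suc t) {u} {v} s =
      let m , s₁ , s₂ = steps-split (2 ^ t) (subst (λ n → Steps (2 ^ t + n) u v) (+-identityʳ (2 ^ t)) s)
          m₁ , win₁ = steps-2^⇒win t s₁
          m₂ , win₂ = steps-2^⇒win t s₂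
      in m , λ
        { (true ∷ [])  → triple u m m₁ , from (linked⇔halves true (triple u v m) (triple u m m₁))
            (trans (source-triple u m m₁) (sym (source-triple u v m)) , trans (target-triple u m m₁) (sym (middle-triple u v m))) , win₁
        ; (false ∷ []) → triple m v m₂ , from (linked⇔halves false (triple u v m) (triple m v m₂))
            (trans (source-triple m v m₂) (sym (middle-triple u v m)) , trans (target-triple m v m₂) (sym (target-triple u v m))) , win₂
        }

    started⇔ : ∀ {xs P} w → Started xs P w ⇔ (Single.Started xs P (source w) × AcceptingHead (proj₁ (target w)))
    started⇔ {xs} {P} w = mk⇔
      (λ (onx , padding , end) →
        ((λ pre {b} {suf} eq → first (just b) (length suf) (proj₁ (onx pre eq))) ,
         (λ {j} j<P → first nothing (length xs + j) (proj₁ (padding j<P))) , first nothing M (proj₁ end)) , proj₂ end)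
      (λ ((onx , padding , end) , acc) →
        (λ pre {b} {suf} eq → first⁻ (just b) (length suf) (onx pre eq) , acc) ,
        (λ {j} j<P → first⁻ nothing (length xs + j) (padding j<P) , acc) , first⁻ nothing M end , acc)
      where
      column-source : ∀ c → column (source w) c ≡ Vec.take D (column w c)
      column-source = column-left {suc h} {suc h + suc h} {D} {D + D} w
      first : ∀ s c → Tiling.start tiling s (Vec.take (suc h) (proj₁ w)) (Vec.take D (column w c)) →
              Tiling.start tiling s (proj₁ (source w)) (column (source w) c)
      first s c = subst (Tiling.start tiling s (proj₁ (source w))) (sym (column-source c))
      first⁻ : ∀ s c → Tiling.start tiling s (proj₁ (source w)) (column (source w) c) →
               Tiling.start tiling s (Vec.take (suc h) (proj₁ w)) (Vec.take D (column w c))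
      first⁻ s c = subst (Tiling.start tiling s (proj₁ (source w))) (column-source c)

  module _ {x P M} (M≡ : M ≡ length x + P) (bounded : Bounded 𝓜 M x) where

    winning⇔rows-accept-2^ : ∀ t → Winning M (reverse x) P t ⇔ RowsAccept M≡ bounded (2 ^ t)
    winning⇔rows-accept-2^ t = mk⇔
      (λ (w , st , win) → let st′ , acc = to (started⇔ w) st in source w , target w , st′ , win⇒steps-2^ t win , acc)
      (λ (u , v , st , s , acc) → let m , win = steps-2^⇒win t s in triple u v m ,
        from (started⇔ (triple u v m)) (subst (Single.Started (reverse x) P) (sym (source-triple u v m)) st ,
                       subst (AcceptingHead ∘ proj₁) (sym (target-triple u v m)) acc) , win)

-- The reductions

poly-time-cong : ∀ {f g} → (∀ x → f x ≡ g x) → PolyTime f → PolyTime g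
poly-time-cong f≗g (M , p , det , t , out) = M , p , det , t , λ x → subst (Outputs M x) (f≗g x) (out x)

module Reduction (em : ExcludedMiddle 0ℓ) {κ : Set} (e α : κ) {h a D} (𝒯 : Tiling (suc h) a D) (p q : Polynomial) where

  input-length padding breadth rounds : List Bool → ℕ
  input-length x = length (reverse x)
  padding x      = ⟦ p ⟧ (input-length x)
  breadth x      = input-length x + padding x
  rounds x       = ⟦ q ⟧ (input-length x)

  formula : List Bool → QBF κ []
  formula x = Formulas.winningᶠ em e α 𝒯 (breadth x) (reverse x) (padding x) (rounds x)

  formula-poly-time : ∀ 𝒜 K → PolyTime (λ x → code 𝒜 K (formula x))
  formula-poly-time 𝒜 K = poly-time-cong (λ x → Generator.generator-correct em e α 𝒯 𝒜 K p q (reverse x))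
    (generated-poly-time (Generator.generator em e α 𝒯 𝒜 K p q))

  true-formula : ∀ pol → pol e ≡ ∃′ → a ≡ 0 ⊎ pol α ≡ ∀′ → ∀ x →
                 True pol [] (formula x) ⇔ Game.Winning 𝒯 (breadth x) (reverse x) (padding x) (rounds x)
  true-formula pol pol-e pol-α x = Formulas.true-winningᶠ em e α 𝒯 (breadth x) pol pol-e pol-α (reverse x) (padding x) (rounds x)

  breadth≡ : ∀ x → breadth x ≡ length x + padding x
  breadth≡ x = cong (_+ padding x) (List.length-reverse x)

  bounded : ∀ {𝓜} → (∀ {x} → Bounded 𝓜 (length x + ⟦ p ⟧ (length x)) x) → ∀ x → Bounded 𝓜 (breadth x) x
  bounded {𝓜} h x = subst (λ n → Bounded 𝓜 (n + ⟦ p ⟧ n) x) (sym (List.length-reverse x)) (λ {n c} → h {n = n} {c})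

module Nondeterministic (em : ExcludedMiddle 0ℓ) (𝓜 : Machine) (p : Polynomial) (time : RunsInTime 𝓜 ⟦ p ⟧) where

  open Acceptance 𝓜 (head-coding-exists 𝓜) (cells-coding-exists 𝓜)
  -- One round more than the time bound, for the step into the initial configuration. A single kind
  -- of variable suffices, as nothing alternates.
  open Reduction em tt tt tiling p ((1 ∷ []) ⊕ p) public

  private
    narrow-enough : ∀ x → Bounded 𝓜 (breadth x) x
    narrow-enough = bounded {𝓜} (time-bounded 𝓜 {⟦ p ⟧} time)

    rounds≡ : ∀ x → rounds x ≡ suc (⟦ p ⟧ (length x))
    rounds≡ x = trans (⟦⊕⟧ (1 ∷ []) p n) (cong suc (cong₂ _+_ (*-zeroʳ n) (cong ⟦ p ⟧ (List.length-reverse x))))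
      where
      n : ℕ
      n = input-length x

  formula⇔accepts : ∀ x → True (λ _ → ∃′) [] (formula x) ⇔ Accepts 𝓜 x
  formula⇔accepts x = mk⇔
    (λ t → rows-accept-sound (breadth≡ x) (narrow-enough x) (subst (0 <_) (sym (rounds≡ x)) (s≤s z≤n)) (to game t))
    (λ (n , c , r , halted , acc) → from game (rows-accept-complete (breadth≡ x) (narrow-enough x) r halted acc
      (subst (n <_) (sym (rounds≡ x)) (s≤s (time x r)))))
    where
    game : True (λ _ → ∃′) [] (formula x) ⇔ RowsAccept (breadth≡ x) (narrow-enough x) (rounds x)
    game = ⇔-trans (true-formula (λ _ → ∃′) refl (inj₁ refl) x) (winning⇔rows-accept (breadth≡ x) (narrow-enough x) (rounds x))

kind : Bool → Quantifier
kind true  = ∃′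
kind false = ∀′

module Deterministic-space (em : ExcludedMiddle 0ℓ) (𝓜 : Machine) (p : Polynomial)
                           (det : Deterministic 𝓜) (space : RunsInSpace 𝓜 ⟦ p ⟧) where

  open Savitch 𝓜 (head-coding-exists 𝓜) (cells-coding-exists 𝓜)
  open Acceptance 𝓜 (head-coding-exists 𝓜) (cells-coding-exists 𝓜)

  private
    -- The number of bits in a row for a single configuration. By `halting-time` a halting run is
    -- shorter than 2 to this power, so halving this many times is enough.
    bits-poly : PolyBounded (λ n → suc h + suc (n + ⟦ p ⟧ n) * D)
    bits-poly = poly-+ (poly-const (suc h)) (poly-* (poly-+ (poly-const 1) (poly-+ poly-id (p , λ _ → ≤-refl))) (poly-const D))

  open Reduction em true false savitch-tiling p (proj₁ bits-poly) public

  private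
    narrow-enough : ∀ x → Bounded 𝓜 (breadth x) x
    narrow-enough = bounded {𝓜} (space-bounded 𝓜 {⟦ p ⟧} space)

  formula⇔accepts : ∀ x → True kind [] (formula x) ⇔ Accepts 𝓜 x
  formula⇔accepts x = mk⇔
    (λ t → rows-accept-sound (breadth≡ x) (narrow-enough x) (m^n>0 2 (rounds x)) (to game t))
    (λ (n , c , r , halted , acc) → from game (rows-accept-complete (breadth≡ x) (narrow-enough x) r halted acc
      (≤-trans (halting-time (breadth≡ x) (narrow-enough x) det r halted) (^-monoʳ-≤ 2 (proj₂ bits-poly (input-length x))))))
    where
    game : True kind [] (formula x) ⇔ RowsAccept (breadth≡ x) (narrow-enough x) (2 ^ rounds x)
    game = ⇔-trans (true-formula kind refl (inj₂ refl) x) (winning⇔rows-accept-2^ (breadth≡ x) (narrow-enough x) (rounds x))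

-- Hardness

module _ (em : ExcludedMiddle 0ℓ) {σ : Signature} {A B : Structure σ} where

  open Classical em

  Simulating : Quantifier → ℕ → Set
  Simulating q K = ∃[ g ] Simulates {σ} {K} q A g × Simulates q B g

  some-breaks∧ : SomeBreaks∧ A B → ∃[ k ] ∀ p → Simulating ∃′ (k + p)
  some-breaks∧ (k , qs , φ₁ , φ₂ , onA , onB) =
    k , λ p → padded p qs φ₁ φ₂ , breaks∧⇒simulates p qs φ₁ φ₂ A onA , breaks∧⇒simulates p qs φ₁ φ₂ B onB

  some-breaks∨ : SomeBreaks∨ A B → ∃[ k ] ∀ p → Simulating ∀′ (k + p)
  some-breaks∨ (k , qs , ψ₁ , ψ₂ , onA , onB) =
    k , λ p → padded p qs ψ₁ ψ₂ , breaks∨⇒simulates p qs ψ₁ ψ₂ A onA , breaks∨⇒simulates p qs ψ₁ ψ₂ B onB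

  module _ {κ : Set} {K : ℕ} (pol : κ → Quantifier) (sim : ∀ c → Simulating (pol c) K) where

    open Translation (proj₁ ∘ sim)

    -- Truth is carried into `A` for members and back from `B` for non-members. Both concern the
    -- same sentence, so the gadgets on the two structures must consist of the same formulas.
    hard-by : (L : Language) (θ : List Bool → QBF κ []) →
              PolyTime (λ x → code (gadget-alphabet (proj₁ ∘ sim)) K (θ x)) →
              (∀ x → L x → True pol [] (θ x)) → (∀ x → ¬ L x → ¬ True pol [] (θ x)) →
              ∃[ f ] PolyTime (encode ∘ f) × (∀ x → L x → A ⊨ f x) × (∀ x → ¬ L x → B ⊭ f x)
    hard-by L θ poly yes-true no-false = translate ∘ θ
      , poly-time-cong (λ x → sym (encode-translate (proj₁ ∘ sim) (θ x))) poly
      , (λ x l → true⇒sat em A pol (λ c → proj₁ (proj₂ (sim c))) [] [] (θ x) (λ ()) (yes-true x l))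
      , λ x ¬l s → no-false x ¬l (sat⇒true em B pol (λ c → proj₂ (proj₂ (sim c))) [] [] (θ x) (λ ()) s)

  NP-hardness : SomeBreaks∧ A B → (NP -hard) (PMC A B)
  NP-hardness breaks L (𝓜 , p , time , L⇔) with some-breaks∧ breaks
  ... | k , sims = hard-by (λ (_ : ⊤) → ∃′) (λ _ → sims 0) L formula (formula-poly-time _ _)
        (λ x l → from (formula⇔accepts x) (to (L⇔ x) l)) (λ x ¬l t → ¬l (from (L⇔ x) (to (formula⇔accepts x) t)))
    where open Nondeterministic em 𝓜 p time

  -- A machine for the complement yields an existential formula that is true exactly outside `L`.
  -- Its dual is universal and true exactly on `L`, and the blocks breaking ∨ simulate the universal
  -- quantifiers.
  coNP-hardness : SomeBreaks∨ A B → (coNP -hard) (PMC A B)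
  coNP-hardness breaks L (𝓜 , p , time , ∁L⇔) with some-breaks∨ breaks
  ... | k , sims = hard-by (λ (_ : ⊤) → ∀′) (λ _ → sims 0) L (dual ∘ formula)
        (poly-time-cong (λ x → sym (code-dual _ _ (formula x))) (formula-poly-time _ _))
        (λ x l → dual-true (λ _ → ∃′) (formula x) λ t → from (∁L⇔ x) (to (formula⇔accepts x) t) l)
        (λ x ¬l → dual-false (λ _ → ∃′) (formula x) (from (formula⇔accepts x) (to (∁L⇔ x) ¬l)))
    where open Nondeterministic em 𝓜 p time

  PSPACE-hardness : SomeBreaks∧ A B → SomeBreaks∨ A B → (PSPACE -hard) (PMC A B)
  PSPACE-hardness breaks∧ breaks∨ L (𝓜 , p , det , _ , space , L⇔) with some-breaks∧ breaks∧ | some-breaks∨ breaks∨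
  ... | k , sims∧ | l , sims∨ = hard-by kind sims L formula (formula-poly-time _ _)
        (λ x l → from (formula⇔accepts x) (to (L⇔ x) l)) (λ x ¬l t → ¬l (from (L⇔ x) (to (formula⇔accepts x) t)))
    where
    open Deterministic-space em 𝓜 p det space
    -- Each block is padded by the length of the other, so both kinds of variables occupy `k + l`
    -- places and offsets stay multiples of one constant.
    sims : ∀ c → Simulating (kind c) (k + l)
    sims true  = sims∧ l
    sims false = subst (Simulating ∀′) (+-comm l k) (sims∨ k)

lemma29 : ExcludedMiddle 0ℓ →
    (σ : Signature) (A B : Structure σ) →
    (∀ (θ : Sentence σ) → A ⊨ θ → B ⊨ θ) →
    (SomeBreaks∧ A B → (NP -hard) (PMC A B)) ×
    (SomeBreaks∨ A B → (coNP -hard) (PMC A B)) ×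
    (SomeBreaks∧ A B × SomeBreaks∨ A B → (PSPACE -hard) (PMC A B))
lemma29 em σ A B _ = NP-hardness em , coNP-hardness em , λ (b∧ , b∨) → PSPACE-hardness em b∧ b∨
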